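{- (i) Let $G$ be a finite connected graph (multiple edges allowed) in which every edge is a resistor of resistance $1$, and let $a,b$ be two distinct vertices of $G$. If the effective resistance $r(a,b)$ between $a$ and $b$ equals the rational number $q/p>1$, written in lowest terms with $p,q$ positive integers, then $G$ has at least $\max\{q/p,\ \log_2 q\}$ edges. (ii) There is a universal constant $C_1>0$ such that for every rational number $q/p>1$ in lowest terms there exists a finite connected planar graph $G$ (multiple edges allowed), with unit resistance on every edge, and two vertices $a,b$ of $G$ with $r(a,b)=q/p$, such that $G$ has at most $q/p+C_1\log_2 p$ edges.
   Context: Effective resistance: for a finite connected multigraph $G$ with unit resistances and distinct vertices $a,b$, let $\phi$ be the unique function on the vertices with $\phi(a)=1$, $\phi(b)=0$, and such that for every vertex $v\neq a,b$, $\sum_{e=\{v,w\}}(\phi(v)-\phi(w))=0$ (sum over edges at $v$, counted with multiplicity; Kirchhoff's current law with Ohm's law, the current along an edge $\{v,w\}$ from $v$ to $w$ being $\phi(v)-\phi(w)$). Let $I=\sum_{e=\{a,w\}}(\phi(a)-\phi(w))$ be the total current leaving $a$. Then $r(a,b)=1/I$ (potential difference divided by current). -}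

module Defs where

open import Data.Nat as ℕ using (ℕ; zero; suc; _≤ᵇ_)
open import Data.Bool using (Bool; true; false; _∧_; if_then_else_)
open import Data.Fin as Fin using (Fin; toℕ; splitAt; join)
open import Data.Fin.Properties using () renaming (_≟_ to _≟ᶠ_)
open import Data.Product using (Σ; _×_; _,_; proj₁; proj₂; ∃)
open import Data.Sum using (_⊎_; inj₁; inj₂; swap)
open import Data.Rational as ℚ using (ℚ; 0ℚ; 1ℚ; _+_; _-_; _*_)
open import Relation.Binary.PropositionalEquality using (_≡_; _≢_)
open import Relation.Nullary using (does)

record Graph (n m : ℕ) : Set where
  field
    ends   : Fin m → Fin n × Fin n
    noLoop : ∀ e → proj₁ (ends e) ≢ proj₂ (ends e)
open Graph public

data Reach {n m : ℕ} (G : Graph n m) : Fin n → Fin n → Set where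
  here  : ∀ {u} → Reach G u u
  fwd   : ∀ {u w} (e : Fin m) → proj₁ (ends G e) ≡ u → Reach G (proj₂ (ends G e)) w → Reach G u w
  bwd   : ∀ {u w} (e : Fin m) → proj₂ (ends G e) ≡ u → Reach G (proj₁ (ends G e)) w → Reach G u w

Connected : ∀ {n m} → Graph n m → Set
Connected G = ∀ u v → Reach G u v

sumFin : ∀ {k} → (Fin k → ℚ) → ℚ
sumFin {zero}  f = 0ℚ
sumFin {suc k} f = f Fin.zero + sumFin (λ i → f (Fin.suc i))

currentOut : ∀ {n m} → Graph n m → (Fin n → ℚ) → Fin n → ℚ
currentOut G φ v = sumFin λ e →
  let x = proj₁ (ends G e) ; y = proj₂ (ends G e) in
  (if does (v ≟ᶠ x) then φ x - φ y else 0ℚ) +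
  (if does (v ≟ᶠ y) then φ y - φ x else 0ℚ)

IsPotential : ∀ {n m} → Graph n m → Fin n → Fin n → (Fin n → ℚ) → Set
IsPotential G a b φ =
  (φ a ≡ 1ℚ) × (φ b ≡ 0ℚ) × (∀ v → v ≢ a → v ≢ b → currentOut G φ v ≡ 0ℚ)

-- r(a,b) = r : for the (unique) potential φ, r = 1 / I, written r * I ≡ 1.
EffRes : ∀ {n m} → Graph n m → Fin n → Fin n → ℚ → Set
EffRes G a b r = Σ (Fin _ → ℚ) λ φ → IsPotential G a b φ × (r * currentOut G φ a ≡ 1ℚ)

-- Planarity via rotation systems (combinatorial maps).
-- Darts: Fin (m + m); join (inj₁ e) is edge e seen from proj₁ (ends e),
-- join (inj₂ e) is edge e seen from proj₂ (ends e).

tailD : ∀ {n m} → Graph n m → Fin (m ℕ.+ m) → Fin n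
tailD {m = m} G d with splitAt m d
... | inj₁ e = proj₁ (ends G e)
... | inj₂ e = proj₂ (ends G e)

revD : ∀ {m} → Fin (m ℕ.+ m) → Fin (m ℕ.+ m)
revD {m} d = join m m (swap (splitAt m d))

iter : ∀ {A : Set} → (A → A) → ℕ → A → A
iter f zero    x = x
iter f (suc k) x = f (iter f k x)

allBelow : ℕ → (ℕ → Bool) → Bool
allBelow zero    P = true
allBelow (suc k) P = allBelow k P ∧ P k

countFin : ∀ {k} → (Fin k → Bool) → ℕ
countFin {zero}  P = 0
countFin {suc k} P = (if P Fin.zero then 1 else 0) ℕ.+ countFin (λ i → P (Fin.suc i))

-- number of orbits of a permutation f of Fin k: count the elements that
-- are the minimum of their orbit (orbits have size ≤ k).
numOrbits : ∀ {k} → (Fin k → Fin k) → ℕ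
numOrbits {k} f = countFin λ d → allBelow k λ i → toℕ d ≤ᵇ toℕ (iter f i d)

record RotationSystem {n m : ℕ} (G : Graph n m) : Set where
  field
    σ      : Fin (m ℕ.+ m) → Fin (m ℕ.+ m)
    σ⁻¹    : Fin (m ℕ.+ m) → Fin (m ℕ.+ m)
    inv₁   : ∀ d → σ⁻¹ (σ d) ≡ d
    inv₂   : ∀ d → σ (σ⁻¹ d) ≡ d
    atVert : ∀ d → tailD G (σ d) ≡ tailD G d
    cyclic : ∀ d d' → tailD G d ≡ tailD G d' → ∃ λ k → iter σ k d ≡ d'
open RotationSystem public

numFaces : ∀ {n m} {G : Graph n m} → RotationSystem G → ℕ
numFaces {m = m} R = numOrbits (λ d → σ R (revD {m} d))

-- A connected graph is planar iff it has a rotation system of genus 0,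
-- i.e. V − E + F = 2 (the edgeless one-vertex graph is planar too).
Planar : ∀ {n m} → Graph n m → Set
Planar {n} {zero}  G = n ≡ 1
Planar {n} {suc m} G = Σ (RotationSystem G) λ R → n ℕ.+ numFaces R ≡ suc m ℕ.+ 2

{-# OPTIONS --safe #-}

-- (i) Clear denominators, so that Φ is an integral potential with drop D and current J. The
-- edges crossing any level of Φ carry J in total, hence no edge carries more than J, and the
-- energy D J is at most m J ². For the bound 2 ^ m, approximate k Φ from below by the largest
-- integral subharmonic function with boundary values k and 0. Its Laplacian is a superstable
-- configuration, and there are at most 2 ^ m of those by burning; two of them agreeing for
-- k = 0 , … , 2 ^ m , some N ≤ 2 ^ m admits an integral harmonic function with boundary values
-- N and 0. By the symmetry of the energy form N J is a multiple of D, so q divides N.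
--
-- (ii) In the Wheatstone bridge with three unit resistors, a fourth arm of resistance
-- 1 + 1 / x′ and a bridging resistor (1 − c) / c realise 1 + 1 / x with x = 4 x′ + 1 + c. Taking
-- c in a finite set makes 1 + 8 / y cost O(log y) edges. For x = N / δ one chooses x′ in ℤ / 8,
-- and c then has denominator O(δ) and stays away from 0 and 1, so that c is treated
-- recursively as a ratio of height O(δ); the costs O(log (N / δ)) telescope to O(log N).
module Submission where

-- The obstacle in (ii) is the cost of the Euclidean algorithm: unit resistors added in series and
-- in parallel cost the sum of the partial quotients, which for 1 + 1 / x with integral x is x + 1,
-- linear rather than logarithmic. The bridge escapes this because it multiplies x by 4 for a
-- bounded number of edges, at the price of one auxiliary resistor whose value must again be
-- realised. That value can lie below 1, and inverting a resistance corresponds to planar duality;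
-- hence every ratio is built together with its inverse. The bridge allows this because, closed by
-- an edge between its terminals, it is the self-dual graph K4. The same closing edge makes
-- planarity compositional: replacing an edge by a network acts alike on vertices and on faces, and
-- Euler's relation adds up. Kirchhoff's law is used throughout in weak form, as an identity for all
-- test functions: this gives flux through level sets and reciprocity in (i), and in (ii) it lets
-- glued networks inherit solutions from their parts.

-- Dirichlet forms and Laplacians over the integers

module Forms where

  open import Defs
  open import Data.Nat as ℕ using (ℕ; zero; suc)
  open import Data.Fin using (Fin; zero; suc)
  open import Data.Fin.Properties using (_≟_)
  open import Data.Bool using (true; false; if_then_else_)
  open import Data.Product
  open import Data.Integer using (ℤ; 0ℤ; 1ℤ; _+_; _-_; _*_; -_) renaming (+_ to pos)
  import Data.Integer.Properties as ℤₚ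
  open import Data.Integer.Tactic.RingSolver using (solve-∀)
  open import Data.Rational as ℚ using (ℚ; 0ℚ; _/_; fromℚᵘ)
  import Data.Rational.Properties as ℚₚ
  open import Data.Rational.Unnormalised as ℚᵘ using (ℚᵘ; mkℚᵘ; *≡*)
  import Data.Rational.Unnormalised.Properties as ℚᵘₚ
  open import Algebra.Properties.Semiring.Sum ℤₚ.+-*-semiring using (sum; sum-cong-≗; ∑-distrib-+; ∑-comm; *-distribˡ-sum; *-distribʳ-sum; sum-replicate-zero)
  open import Relation.Binary.PropositionalEquality
  open import Relation.Nullary using (does; yes; no; contradiction)
  open import Function using (_∘_)

  δ : ∀ {n} → Fin n → Fin n → ℤ
  δ v x = if does (v ≟ x) then 1ℤ else 0ℤ

  δ-refl : ∀ {n} (v : Fin n) → δ v v ≡ 1ℤ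
  δ-refl v with v ≟ v
  ... | yes _ = refl
  ... | no v≢v = contradiction refl v≢v

  δ-≢ : ∀ {n} {v x : Fin n} → v ≢ x → δ v x ≡ 0ℤ
  δ-≢ {v = v} {x} v≢x with v ≟ x
  ... | yes v≡x = contradiction v≡x v≢x
  ... | no _ = refl

  sum-δ : ∀ {n} (f : Fin n → ℤ) x → sum (λ v → f v * δ v x) ≡ f x
  sum-δ {suc n} f zero = begin
    f zero * 1ℤ + sum (λ v → f (suc v) * 0ℤ)  ≡⟨ cong₂ _+_ (ℤₚ.*-identityʳ (f zero)) (sum-cong-≗ (λ v → ℤₚ.*-zeroʳ (f (suc v)))) ⟩
    f zero + sum (λ (v : Fin n) → 0ℤ)         ≡⟨ cong (f zero +_) (sum-replicate-zero n) ⟩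
    f zero + 0ℤ                               ≡⟨ ℤₚ.+-identityʳ _ ⟩
    f zero                                    ∎
    where open ≡-Reasoning
  sum-δ {suc n} f (suc x) = begin
    f zero * 0ℤ + sum (λ v → f (suc v) * δ (suc v) (suc x)) ≡⟨ cong₂ _+_ (ℤₚ.*-zeroʳ (f zero)) (sum-cong-≗ (λ v → cong (f (suc v) *_) (δ-suc v))) ⟩
    0ℤ + sum (λ v → f (suc v) * δ v x)        ≡⟨ ℤₚ.+-identityˡ _ ⟩
    sum (λ v → f (suc v) * δ v x)             ≡⟨ sum-δ (f ∘ suc) x ⟩
    f (suc x)                                 ∎
    where
    open ≡-Reasoning
    δ-suc : ∀ v → δ (suc v) (suc x) ≡ δ v x
    δ-suc v with v ≟ x
    ... | yes _ = refl
    ... | no _ = refl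

  -- `V` stays arbitrary because the vertices of the networks below are labels in nested sums.
  Edges : ∀ (V : Set) → ℕ → Set
  Edges V m = Fin m → V × V

  diff : ∀ {V : Set} → (V → ℤ) → V × V → ℤ
  diff f (x , y) = f x - f y

  form : ∀ {V : Set} {m} → Edges V m → (V → ℤ) → (V → ℤ) → ℤ
  form R f g = sum λ e → diff f (R e) * diff g (R e)

  -- Testing the Dirichlet form against `δ v` gives the net current out of `v`. The sign is that of
  -- degree minus adjacency, so nonpositive means subharmonic.
  lap : ∀ {n m} → Edges (Fin n) m → (Fin n → ℤ) → Fin n → ℤ
  lap R g v = form R (δ v) g

  form-sym : ∀ {V m} (R : Edges V m) f g → form R f g ≡ form R g f
  form-sym R f g = sum-cong-≗ λ e → ℤₚ.*-comm (diff f (R e)) (diff g (R e))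

  form-+ʳ : ∀ {V m} (R : Edges V m) f g h → form R f (λ v → g v + h v) ≡ form R f g + form R f h
  form-+ʳ R f g h = trans (sum-cong-≗ λ e → ring (diff f (R e)) (g (proj₁ (R e))) (g (proj₂ (R e))) (h (proj₁ (R e))) (h (proj₂ (R e)))) (∑-distrib-+ (λ e → diff f (R e) * diff g (R e)) (λ e → diff f (R e) * diff h (R e)))
    where
    ring : ∀ d gx gy hx hy → d * ((gx + hx) - (gy + hy)) ≡ d * (gx - gy) + d * (hx - hy)
    ring = solve-∀

  form-*ʳ : ∀ {V m} (R : Edges V m) f c g → form R f (λ v → c * g v) ≡ c * form R f g
  form-*ʳ R f c g = trans (sum-cong-≗ λ e → ring (diff f (R e)) c (g (proj₁ (R e))) (g (proj₂ (R e)))) (sym (*-distribˡ-sum c (λ e → diff f (R e) * diff g (R e))))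
    where
    ring : ∀ d c gx gy → d * (c * gx - c * gy) ≡ c * (d * (gx - gy))
    ring = solve-∀

  -- Summation by parts: `f` is the combination of the `δ v` with coefficients `f v`, and the sums
  -- over edges and vertices are exchanged.
  form-expand : ∀ {n m} (R : Edges (Fin n) m) f g → form R f g ≡ sum (λ v → f v * lap R g v)
  form-expand R f g = begin
    sum (λ e → diff f (R e) * diff g (R e))
      ≡⟨ sum-cong-≗ (λ e → cong (_* diff g (R e)) (edge (R e))) ⟩
    sum (λ e → sum (λ v → f v * diff (δ v) (R e)) * diff g (R e))
      ≡⟨ sum-cong-≗ (λ e → *-distribʳ-sum (diff g (R e)) (λ v → f v * diff (δ v) (R e))) ⟩
    sum (λ e → sum (λ v → f v * diff (δ v) (R e) * diff g (R e)))
      ≡⟨ ∑-comm (λ e v → f v * diff (δ v) (R e) * diff g (R e)) ⟩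
    sum (λ v → sum (λ e → f v * diff (δ v) (R e) * diff g (R e)))
      ≡⟨ sum-cong-≗ (λ v → trans (sum-cong-≗ (λ e → ℤₚ.*-assoc (f v) (diff (δ v) (R e)) (diff g (R e)))) (sym (*-distribˡ-sum (f v) (λ e → diff (δ v) (R e) * diff g (R e))))) ⟩
    sum (λ v → f v * lap R g v) ∎
    where
    open ≡-Reasoning
    split : ∀ a b c → a * (b - c) ≡ a * b + (- 1ℤ) * (a * c)
    split = solve-∀
    join : ∀ x y → x + (- 1ℤ) * y ≡ x - y
    join = solve-∀
    edge : ∀ p → diff f p ≡ sum (λ v → f v * diff (δ v) p)
    edge (x , y) = sym (begin
      sum (λ v → f v * (δ v x - δ v y))
        ≡⟨ sum-cong-≗ (λ v → split (f v) (δ v x) (δ v y)) ⟩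
      sum (λ v → f v * δ v x + (- 1ℤ) * (f v * δ v y))
        ≡⟨ ∑-distrib-+ (λ v → f v * δ v x) (λ v → (- 1ℤ) * (f v * δ v y)) ⟩
      sum (λ v → f v * δ v x) + sum (λ v → (- 1ℤ) * (f v * δ v y))
        ≡⟨ cong₂ _+_ (sum-δ f x) (sym (*-distribˡ-sum (- 1ℤ) (λ v → f v * δ v y))) ⟩
      f x + (- 1ℤ) * sum (λ v → f v * δ v y)
        ≡⟨ cong (λ s → f x + (- 1ℤ) * s) (sum-δ f y) ⟩
      f x + (- 1ℤ) * f y
        ≡⟨ join (f x) (f y) ⟩
      f x - f y ∎)

  -- In the summation by parts only the source `a` survives. This evaluates the energy, the flux
  -- through a cut, and the pairing of two harmonic functions.
  form-harmonic : ∀ {n m} (R : Edges (Fin n) m) {a b} (f g : Fin n → ℤ) → f b ≡ 0ℤ →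
    (∀ v → v ≢ a → v ≢ b → lap R g v ≡ 0ℤ) → form R f g ≡ f a * lap R g a
  form-harmonic R {a} {b} f g fb≡0 harm = begin
    form R f g                                    ≡⟨ form-expand R f g ⟩
    sum (λ v → f v * lap R g v)                   ≡⟨ sum-cong-≗ point ⟩
    sum (λ v → (f v * lap R g v) * δ v a)         ≡⟨ sum-δ (λ v → f v * lap R g v) a ⟩
    f a * lap R g a                               ∎
    where
    open ≡-Reasoning
    point : ∀ v → f v * lap R g v ≡ (f v * lap R g v) * δ v a
    point v with v ≟ a
    ... | yes _ = sym (ℤₚ.*-identityʳ _)
    ... | no v≢a with v ≟ b
    ...   | yes refl = trans (trans (cong (_* lap R g v) fb≡0) (ℤₚ.*-zeroˡ (lap R g v))) (sym (ℤₚ.*-zeroʳ (f v * lap R g v)))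
    ...   | no v≢b = trans (trans (cong (f v *_) (harm v v≢a v≢b)) (ℤₚ.*-zeroʳ (f v))) (sym (ℤₚ.*-zeroʳ (f v * lap R g v)))

  fromℚᵘ-+ : ∀ p q → fromℚᵘ p ℚ.+ fromℚᵘ q ≡ fromℚᵘ (p ℚᵘ.+ q)
  fromℚᵘ-+ p q = ℚₚ.toℚᵘ-injective (ℚᵘₚ.≃-trans (ℚₚ.toℚᵘ-homo-+ (fromℚᵘ p) (fromℚᵘ q))
    (ℚᵘₚ.≃-trans (ℚᵘₚ.+-cong (ℚₚ.toℚᵘ-fromℚᵘ p) (ℚₚ.toℚᵘ-fromℚᵘ q)) (ℚᵘₚ.≃-sym (ℚₚ.toℚᵘ-fromℚᵘ (p ℚᵘ.+ q)))))

  fromℚᵘ-* : ∀ p q → fromℚᵘ p ℚ.* fromℚᵘ q ≡ fromℚᵘ (p ℚᵘ.* q)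
  fromℚᵘ-* p q = ℚₚ.toℚᵘ-injective (ℚᵘₚ.≃-trans (ℚₚ.toℚᵘ-homo-* (fromℚᵘ p) (fromℚᵘ q))
    (ℚᵘₚ.≃-trans (ℚᵘₚ.*-cong (ℚₚ.toℚᵘ-fromℚᵘ p) (ℚₚ.toℚᵘ-fromℚᵘ q)) (ℚᵘₚ.≃-sym (ℚₚ.toℚᵘ-fromℚᵘ (p ℚᵘ.* q)))))

  fromℚᵘ-neg : ∀ p → ℚ.- fromℚᵘ p ≡ fromℚᵘ (ℚᵘ.- p)
  fromℚᵘ-neg p = ℚₚ.toℚᵘ-injective (ℚᵘₚ.≃-trans (ℚₚ.toℚᵘ-homo‿- (fromℚᵘ p))
    (ℚᵘₚ.≃-trans (ℚᵘₚ.-‿cong (ℚₚ.toℚᵘ-fromℚᵘ p)) (ℚᵘₚ.≃-sym (ℚₚ.toℚᵘ-fromℚᵘ (ℚᵘ.- p)))))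

  /-+ : ∀ x y d → x / suc d ℚ.+ y / suc d ≡ (x + y) / suc d
  /-+ x y d = trans (fromℚᵘ-+ (mkℚᵘ x d) (mkℚᵘ y d)) (ℚₚ.fromℚᵘ-cong {mkℚᵘ x d ℚᵘ.+ mkℚᵘ y d} {mkℚᵘ (x + y) d} (*≡* (ring x y (pos (suc d)))))
    where
    ring : ∀ x y d → (x * d + y * d) * d ≡ (x + y) * (d * d)
    ring = solve-∀

  /-- : ∀ x y d → x / suc d ℚ.- y / suc d ≡ (x - y) / suc d
  /-- x y d = trans (cong (x / suc d ℚ.+_) (fromℚᵘ-neg (mkℚᵘ y d))) (/-+ x (- y) d)

  0/ : ∀ d → 0ℤ / suc d ≡ 0ℚ
  0/ d = ℚₚ.fromℚᵘ-cong {mkℚᵘ 0ℤ d} {mkℚᵘ 0ℤ 0} (*≡* refl)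

  /-cross : ∀ x y c d → x * pos (suc d) ≡ y * pos (suc c) → x / suc c ≡ y / suc d
  /-cross x y c d eq = ℚₚ.fromℚᵘ-cong {mkℚᵘ x c} {mkℚᵘ y d} (*≡* eq)

  /-cross⁻¹ : ∀ x y c d → x / suc c ≡ y / suc d → x * pos (suc d) ≡ y * pos (suc c)
  /-cross⁻¹ x y c d eq with *≡* h ← ℚₚ.fromℚᵘ-injective {mkℚᵘ x c} {mkℚᵘ y d} eq = h

  /-* : ∀ x y c d → (x / suc c) ℚ.* (y / suc d) ≡ (x * y) / (suc c ℕ.* suc d)
  /-* x y c d = fromℚᵘ-* (mkℚᵘ x c) (mkℚᵘ y d)

  sumFin-/ : ∀ {k} (f : Fin k → ℤ) d → sumFin (λ i → f i / suc d) ≡ sum f / suc d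
  sumFin-/ {zero} f d = sym (0/ d)
  sumFin-/ {suc k} f d = trans (cong (f zero / suc d ℚ.+_) (sumFin-/ (f ∘ suc) d)) (/-+ (f zero) (sum (f ∘ suc)) d)

  sumFin-cong : ∀ {k} {f g : Fin k → ℚ} → (∀ i → f i ≡ g i) → sumFin f ≡ sumFin g
  sumFin-cong {zero} h = refl
  sumFin-cong {suc k} h = cong₂ ℚ._+_ (h zero) (sumFin-cong (h ∘ suc))

  -- The two guarded summands of an edge combine into a single product of differences, one term of
  -- the form; this moves the problem from rational to integral potentials.
  currentOut-/ : ∀ {n m} (G : Graph n m) (φ : Fin n → ℚ) (Φ : Fin n → ℤ) d →
    (∀ v → φ v ≡ Φ v / suc d) → ∀ v → currentOut G φ v ≡ lap (ends G) Φ v / suc d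
  currentOut-/ G φ Φ d eq v = trans (sumFin-cong (λ e → edge (proj₁ (ends G e)) (proj₂ (ends G e)))) (sumFin-/ (λ e → diff (δ v) (ends G e) * diff Φ (ends G e)) d)
    where
    φ-diff : ∀ x y → φ x ℚ.- φ y ≡ (Φ x - Φ y) / suc d
    φ-diff x y = trans (cong₂ ℚ._-_ (eq x) (eq y)) (/-- (Φ x) (Φ y) d)
    half : ∀ x (q : ℚ) z → q ≡ z / suc d → (if does (v ≟ x) then q else 0ℚ) ≡ (δ v x * z) / suc d
    half x q z h with does (v ≟ x)
    ... | true = trans h (cong (_/ suc d) (sym (ℤₚ.*-identityˡ z)))
    ... | false = trans (sym (0/ d)) (cong (_/ suc d) (sym (ℤₚ.*-zeroˡ z)))
    ring : ∀ p q x y → p * (x - y) + q * (y - x) ≡ (p - q) * (x - y)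
    ring = solve-∀
    edge : ∀ x y → (if does (v ≟ x) then φ x ℚ.- φ y else 0ℚ) ℚ.+ (if does (v ≟ y) then φ y ℚ.- φ x else 0ℚ)
         ≡ ((δ v x - δ v y) * (Φ x - Φ y)) / suc d
    edge x y = begin
      _ ≡⟨ cong₂ ℚ._+_ (half x _ _ (φ-diff x y)) (half y _ _ (φ-diff y x)) ⟩
      (δ v x * (Φ x - Φ y)) / suc d ℚ.+ (δ v y * (Φ y - Φ x)) / suc d ≡⟨ /-+ (δ v x * (Φ x - Φ y)) (δ v y * (Φ y - Φ x)) d ⟩
      (δ v x * (Φ x - Φ y) + δ v y * (Φ y - Φ x)) / suc d ≡⟨ cong (_/ suc d) (ring (δ v x) (δ v y) (Φ x) (Φ y)) ⟩
      ((δ v x - δ v y) * (Φ x - Φ y)) / suc d ∎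
      where open ≡-Reasoning

  common-denominator : ∀ {n} (φ : Fin n → ℚ) → ∃ λ d → ∃ λ (Φ : Fin n → ℤ) → ∀ v → φ v ≡ Φ v / suc d
  common-denominator {zero} φ = 0 , (λ ()) , λ ()
  common-denominator {suc n} φ with common-denominator (φ ∘ suc)
  ... | d , Φ , eq with φ zero in eq₀
  ... | q@(ℚ.mkℚ x c _) = ℕ.pred (suc c ℕ.* suc d) , Φ′ , eq′
    where
    Φ′ : Fin (suc n) → ℤ
    Φ′ zero = x * pos (suc d)
    Φ′ (suc v) = Φ v * pos (suc c)
    eq′ : ∀ v → φ v ≡ Φ′ v / suc (ℕ.pred (suc c ℕ.* suc d))
    eq′ zero = trans eq₀ (trans (sym (ℚₚ.↥p/↧p≡p q)) (/-cross x (x * pos (suc d)) c (ℕ.pred (suc c ℕ.* suc d)) (trans (cong (x *_) (ℤₚ.pos-* (suc c) (suc d))) (ring x (pos (suc c)) (pos (suc d))))))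
      where
      ring : ∀ x c d → x * (c * d) ≡ x * d * c
      ring = solve-∀
    eq′ (suc v) = trans (eq v) (/-cross (Φ v) (Φ v * pos (suc c)) d (ℕ.pred (suc c ℕ.* suc d)) (trans (cong (Φ v *_) (ℤₚ.pos-* (suc c) (suc d))) (sym (ℤₚ.*-assoc (Φ v) (pos (suc c)) (pos (suc d))))))

-- Superstable configurations and the burning bound

module Burning where

  open Forms
  open import Data.Nat as ℕ using (ℕ; suc; _^_)
  import Data.Nat.Properties as ℕₚ
  open import Data.Fin using (Fin; suc; punchIn)
  open import Data.Fin.Properties using (_≟_; any?)
  open import Data.Bool using (Bool; true; false; not; if_then_else_)
  import Data.Bool.Properties as Boolₚ
  open import Data.Empty using (⊥-elim)
  open import Data.List using ([]; _∷_; length; filter)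
  open import Data.List.Relation.Unary.All as All using (All; []; _∷_)
  import Data.List.Relation.Unary.All.Properties as Allₚ
  open import Data.List.Relation.Unary.AllPairs using (AllPairs; []; _∷_)
  import Data.List.Relation.Unary.AllPairs.Properties as AllPairsₚ
  open import Data.Product
  open import Data.Sum using (_⊎_; inj₁; inj₂)
  open import Data.Vec using (lookup; tabulate)
  open import Data.Vec.Properties using (lookup∘tabulate)
  open import Data.Fin.Subset using (Subset)
  open import Data.Integer using (ℤ; 0ℤ; 1ℤ; _+_; _-_; _*_; -_; _≤_; _<_) renaming (+_ to pos)
  import Data.Integer.Properties as ℤₚ
  open import Data.Integer.Tactic.RingSolver using (solve-∀)
  open import Algebra.Properties.Semiring.Sum ℤₚ.+-*-semiring using (sum-cong-≗; sum-remove; sum-replicate-zero)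
  open import Relation.Binary.PropositionalEquality
  open import Relation.Nullary using (Dec; does; yes; no; ¬_; contradiction; ¬?)
  open import Function using (_∘_)

  ind : Bool → ℤ
  ind b = if b then 1ℤ else 0ℤ

  χ : ∀ {n} → Subset n → Fin n → ℤ
  χ S v = ind (lookup S v)

  -- Burnt vertices act as sinks, where a configuration carries no information.
  Agree : ∀ {n} → (Fin n → Bool) → (Fin n → ℤ) → (Fin n → ℤ) → Set
  Agree burnt c c′ = ∀ v → burnt v ≡ false → c v ≡ c′ v

  -- With the burnt set as sink, c - s is superstable (a parking function): it is nonnegative, and
  -- firing any nonempty unburnt set `S` makes some vertex of `S` negative, since at w in `S` the
  -- Laplacian of `χ S` counts the edges leaving `S`. The base `s` compensates for edges already
  -- deleted.
  Admissible : ∀ {n m} → Edges (Fin n) m → (Fin n → Bool) → (Fin n → ℤ) → (Fin n → ℤ) → Set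
  Admissible R burnt s c =
    (∀ v → burnt v ≡ false → s v ≤ c v) ×
    (∀ S → ∃ (λ v → lookup S v ≡ true) → (∀ v → lookup S v ≡ true → burnt v ≡ false) →
      ∃ λ v → lookup S v ≡ true × c v < s v + lap R (χ S) v)

  length-split : ∀ {A : Set} {P : A → Set} (P? : ∀ x → Dec (P x)) xs →
    length xs ≡ length (filter P? xs) ℕ.+ length (filter (¬? ∘ P?) xs)
  length-split P? [] = refl
  length-split P? (x ∷ xs) with P? x
  ... | yes _ = cong suc (length-split P? xs)
  ... | no _ = trans (cong suc (length-split P? xs)) (sym (ℕₚ.+-suc _ _))

  AllPairs-weaken : ∀ {A : Set} {P : A → Set} {R S : A → A → Set} → (∀ {x y} → P x → P y → R x y → S x y) →
    ∀ {xs} → All P xs → AllPairs R xs → AllPairs S xs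
  AllPairs-weaken f [] [] = []
  AllPairs-weaken f (p ∷ ps) (r ∷ rs) = All.zipWith (λ (q , t) → f p q t) (ps , r) ∷ AllPairs-weaken f ps rs

  burn : ∀ {n} → (Fin n → Bool) → Fin n → Fin n → Bool
  burn burnt v w = if does (v ≟ w) then true else burnt w

  burn-false : ∀ {n} (burnt : Fin n → Bool) v w → burn burnt v w ≡ false → v ≢ w × burnt w ≡ false
  burn-false burnt v w eq with v ≟ w
  ... | no v≢w = v≢w , eq

  burn-unburnt : ∀ {n} (burnt : Fin n → Bool) {v w} → v ≢ w → burnt w ≡ false → burn burnt v w ≡ false
  burn-unburnt burnt {v} {w} v≢w eq with v ≟ w
  ... | yes v≡w = contradiction v≡w v≢w
  ... | no _ = eq

  module Removal {n m} (R : Edges (Fin n) (suc m)) (burnt : Fin n → Bool) (s : Fin n → ℤ)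
    (e : Fin (suc m)) (u v : Fin n) (burnt-u : burnt u ≡ true) (unburnt-v : burnt v ≡ false)
    (ends-e : R e ≡ (u , v) ⊎ R e ≡ (v , u)) where

    R′ : Edges (Fin n) m
    R′ = R ∘ punchIn e

    s′ : Fin n → ℤ
    s′ w = s w + δ w v

    edge-term : ∀ f g → diff f (R e) * diff g (R e) ≡ (f v - f u) * (g v - g u)
    edge-term f g = orient (R e) ends-e
      where
      ring : ∀ a b c d → (a - b) * (c - d) ≡ (b - a) * (d - c)
      ring = solve-∀
      orient : ∀ p → p ≡ (u , v) ⊎ p ≡ (v , u) → diff f p * diff g p ≡ (f v - f u) * (g v - g u)
      orient _ (inj₁ refl) = ring (f u) (f v) (g u) (g v)
      orient _ (inj₂ refl) = refl

    -- Both `δ w` and `χ S` vanish at the burnt end `u`, so the deleted edge contributes the product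
    -- of their values at `v`.
    lap-remove : ∀ S w → (∀ x → lookup S x ≡ true → burnt x ≡ false) → burnt w ≡ false →
      lap R (χ S) w ≡ δ w v * χ S v + lap R′ (χ S) w
    lap-remove S w S-unburnt w-unburnt = trans (sum-remove {i = e} (λ i → diff (δ w) (R i) * diff (χ S) (R i)))
      (cong (_+ lap R′ (χ S) w) (trans (edge-term (δ w) (χ S))
        (trans (cong₂ (λ p q → (δ w v - p) * (χ S v - q)) δwu≡0 χu≡0) (ring (δ w v) (χ S v)))))
      where
      ring : ∀ p q → (p - 0ℤ) * (q - 0ℤ) ≡ p * q
      ring = solve-∀
      δwu≡0 : δ w u ≡ 0ℤ
      δwu≡0 = δ-≢ {v = w} {u} λ { refl → contradiction (trans (sym burnt-u) w-unburnt) λ () }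
      χu≡0 : χ S u ≡ 0ℤ
      χu≡0 with lookup S u in eq
      ... | false = refl
      ... | true = contradiction (trans (sym burnt-u) (S-unburnt u eq)) λ ()

    -- A set that avoids `v` as well as `u` does not see the deleted edge.
    burn-case : ∀ {c} → Admissible R burnt s c → Admissible R′ (burn burnt v) s c
    burn-case {c} (lower , stable) = (λ w w-unburnt → lower w (proj₂ (burn-false burnt v w w-unburnt))) , stable′
      where
      stable′ : ∀ S → ∃ (λ w → lookup S w ≡ true) → (∀ w → lookup S w ≡ true → burn burnt v w ≡ false) →
        ∃ λ w → lookup S w ≡ true × c w < s w + lap R′ (χ S) w
      stable′ S ne S-unburnt with stable S ne (λ w w∈S → proj₂ (burn-false burnt v w (S-unburnt w w∈S)))
      ... | w , w∈S , c<s = w , w∈S , subst (λ z → c w < s w + z) same c<s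
        where
        χv≡0 : χ S v ≡ 0ℤ
        χv≡0 with lookup S v in eq
        ... | false = refl
        ... | true = contradiction refl (proj₁ (burn-false burnt v v (S-unburnt v eq)))
        same : lap R (χ S) w ≡ lap R′ (χ S) w
        same = begin
          lap R (χ S) w                        ≡⟨ lap-remove S w (λ x x∈S → proj₂ (burn-false burnt v x (S-unburnt x x∈S))) (proj₂ (burn-false burnt v w (S-unburnt w w∈S))) ⟩
          δ w v * χ S v + lap R′ (χ S) w       ≡⟨ cong (λ z → δ w v * z + lap R′ (χ S) w) χv≡0 ⟩
          δ w v * 0ℤ + lap R′ (χ S) w          ≡⟨ cong (_+ lap R′ (χ S) w) (ℤₚ.*-zeroʳ (δ w v)) ⟩
          0ℤ + lap R′ (χ S) w                  ≡⟨ ℤₚ.+-identityˡ _ ⟩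
          lap R′ (χ S) w                       ∎
          where open ≡-Reasoning

    -- When c v > s v the base can be raised at `v`; this replaces the edge to `u` that `v` loses
    -- from its count of edges leaving `S`.
    shift-case : ∀ {c} → Admissible R burnt s c → c v ≢ s v → Admissible R′ burnt s′ c
    shift-case {c} (lower , stable) cv≢sv = lower′ , stable′
      where
      lower′ : ∀ w → burnt w ≡ false → s′ w ≤ c w
      lower′ w w-unburnt with w ≟ v
      ... | yes refl = subst (_≤ c w) (ℤₚ.+-comm 1ℤ (s w)) (ℤₚ.i<j⇒suc[i]≤j (ℤₚ.≤∧≢⇒< (lower w w-unburnt) (cv≢sv ∘ sym)))
      ... | no _ = subst (_≤ c w) (sym (ℤₚ.+-identityʳ (s w))) (lower w w-unburnt)
      stable′ : ∀ S → ∃ (λ w → lookup S w ≡ true) → (∀ w → lookup S w ≡ true → burnt w ≡ false) →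
        ∃ λ w → lookup S w ≡ true × c w < s′ w + lap R′ (χ S) w
      stable′ S ne S-unburnt with stable S ne S-unburnt
      ... | w , w∈S , c<s = w , w∈S , subst (c w <_) same c<s
        where
        δχ : δ w v * χ S v ≡ δ w v
        δχ with w ≟ v
        ... | yes refl = trans (ℤₚ.*-identityˡ (χ S w)) (cong ind w∈S)
        ... | no _ = ℤₚ.*-zeroˡ (χ S v)
        same : s w + lap R (χ S) w ≡ s′ w + lap R′ (χ S) w
        same = begin
          s w + lap R (χ S) w                        ≡⟨ cong (s w +_) (lap-remove S w S-unburnt (S-unburnt w w∈S)) ⟩
          s w + (δ w v * χ S v + lap R′ (χ S) w)     ≡⟨ cong (λ z → s w + (z + lap R′ (χ S) w)) δχ ⟩
          s w + (δ w v + lap R′ (χ S) w)             ≡⟨ ℤₚ.+-assoc (s w) (δ w v) (lap R′ (χ S) w) ⟨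
          s′ w + lap R′ (χ S) w                      ∎
          where open ≡-Reasoning

  -- Dhar's burning algorithm as deletion–contraction: an edge from the burnt set to an
  -- unburnt vertex v is deleted, and v is burnt by those configurations with c v = s v.
  admissible-bound : ∀ {n} m (R : Edges (Fin n) m) burnt s cs → All (Admissible R burnt s) cs →
    AllPairs (λ c c′ → ¬ Agree burnt c c′) cs → length cs ℕ.≤ 2 ^ m
  admissible-bound {n} m R burnt s cs adm dis with any? (λ e → ¬? (burnt (proj₁ (R e)) Boolₚ.≟ burnt (proj₂ (R e))))
  admissible-bound {n} (suc m) R burnt s cs adm dis | yes (e , crossing) = step e crossing
    where
    go : ∀ e u v → burnt u ≡ true → burnt v ≡ false → (R e ≡ (u , v) ⊎ R e ≡ (v , u)) → length cs ℕ.≤ 2 ^ suc m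
    go e u v bu bv re = begin
      length cs                                                ≡⟨ length-split P? cs ⟩
      length (filter P? cs) ℕ.+ length (filter (¬? ∘ P?) cs)   ≤⟨ ℕₚ.+-mono-≤ burnt-part shifted-part ⟩
      2 ^ m ℕ.+ 2 ^ m                                          ≡⟨ cong (2 ^ m ℕ.+_) (ℕₚ.+-identityʳ (2 ^ m)) ⟨
      2 ^ suc m                                                ∎
      where
      open ℕₚ.≤-Reasoning
      open Removal R burnt s e u v bu bv re
      P? : ∀ c → Dec (c v ≡ s v)
      P? c = c v ℤₚ.≟ s v
      -- Both configurations take the value `s v` at `v`, so they must differ at a vertex that is
      -- still unburnt.
      disagree : ∀ {c c′} → c v ≡ s v → c′ v ≡ s v → ¬ Agree burnt c c′ → ¬ Agree (burn burnt v) c c′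
      disagree {c} {c′} cv c′v ¬agree agree = ¬agree λ w w-unburnt → case w w-unburnt (v ≟ w)
        where
        case : ∀ w → burnt w ≡ false → Dec (v ≡ w) → c w ≡ c′ w
        case w _ (yes refl) = trans cv (sym c′v)
        case w w-unburnt (no v≢w) = agree w (burn-unburnt burnt v≢w w-unburnt)
      burnt-part : length (filter P? cs) ℕ.≤ 2 ^ m
      burnt-part = admissible-bound m R′ (burn burnt v) s _ (All.map burn-case (Allₚ.filter⁺ P? adm))
        (AllPairs-weaken (λ {c} {c′} → disagree {c} {c′}) (Allₚ.all-filter P? cs) (AllPairsₚ.filter⁺ P? dis))
      shifted-part : length (filter (¬? ∘ P?) cs) ℕ.≤ 2 ^ m
      shifted-part = admissible-bound m R′ burnt s′ _
        (All.zipWith (λ (a , ne) → shift-case a ne) (Allₚ.filter⁺ (¬? ∘ P?) adm , Allₚ.all-filter (¬? ∘ P?) cs))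
        (AllPairsₚ.filter⁺ (¬? ∘ P?) dis)
    step : ∀ e → burnt (proj₁ (R e)) ≢ burnt (proj₂ (R e)) → length cs ℕ.≤ 2 ^ suc m
    step e ne with burnt (proj₁ (R e)) in b₁ | burnt (proj₂ (R e)) in b₂
    ... | true | true = contradiction refl ne
    ... | true | false = go e _ _ b₁ b₂ (inj₁ refl)
    ... | false | true = go e _ _ b₂ b₁ (inj₂ refl)
    ... | false | false = contradiction refl ne
  -- No edge leaves the burnt set. If an unburnt vertex exists, the whole unburnt set `U` has zero
  -- Laplacian, and superstability on `U` contradicts c ≥ s: there is no admissible configuration.
  admissible-bound {n} m R burnt s cs adm dis | no none with any? (λ v → burnt v Boolₚ.≟ false)
  admissible-bound {n} m R burnt s [] adm dis | no none | yes _ = ℕ.z≤n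
  admissible-bound {n} m R burnt s (c ∷ cs) ((lower , stable) ∷ _) dis | no none | yes (v , v-unburnt) =
    ⊥-elim (impossible (stable U (v , trans (lookup∘tabulate (not ∘ burnt) v) (cong not v-unburnt)) U-unburnt))
    where
    U : Subset n
    U = tabulate (not ∘ burnt)
    U-unburnt : ∀ w → lookup U w ≡ true → burnt w ≡ false
    U-unburnt w w∈U = Boolₚ.not-injective (trans (sym (lookup∘tabulate (not ∘ burnt) w)) w∈U)
    flat : ∀ e → diff (χ U) (R e) ≡ 0ℤ
    flat e = ℤₚ.i≡j⇒i-j≡0 (cong ind (begin
      lookup U (proj₁ (R e))      ≡⟨ lookup∘tabulate (not ∘ burnt) _ ⟩
      not (burnt (proj₁ (R e)))   ≡⟨ cong not (same e) ⟩
      not (burnt (proj₂ (R e)))   ≡⟨ lookup∘tabulate (not ∘ burnt) _ ⟨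
      lookup U (proj₂ (R e))      ∎))
      where
      open ≡-Reasoning
      same : ∀ e → burnt (proj₁ (R e)) ≡ burnt (proj₂ (R e))
      same e with burnt (proj₁ (R e)) Boolₚ.≟ burnt (proj₂ (R e))
      ... | yes eq = eq
      ... | no ne = contradiction (e , ne) none
    lap≡0 : ∀ w → lap R (χ U) w ≡ 0ℤ
    lap≡0 w = trans (sum-cong-≗ λ e → trans (cong (diff (δ w) (R e) *_) (flat e)) (ℤₚ.*-zeroʳ (diff (δ w) (R e)))) (sum-replicate-zero m)
    impossible : ¬ ∃ λ w → lookup U w ≡ true × c w < s w + lap R (χ U) w
    impossible (w , w∈U , c<s) = ℤₚ.<⇒≱ c<s (subst (_≤ c w) (sym (trans (cong (s w +_) (lap≡0 w)) (ℤₚ.+-identityʳ (s w)))) (lower w (U-unburnt w w∈U)))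
  -- With every vertex burnt any two configurations agree, so at most one occurs, and 1 ≤ 2 ^ m.
  admissible-bound m R burnt s [] adm dis | no none | no _ = ℕ.z≤n
  admissible-bound m R burnt s (c ∷ []) adm dis | no none | no _ = ℕₚ.m^n>0 2 m
  admissible-bound m R burnt s (c ∷ c′ ∷ cs) adm ((d ∷ _) ∷ _) | no none | no all-burnt =
    ⊥-elim (d λ v v-unburnt → contradiction (v , v-unburnt) all-burnt)

-- Lower bounds: level sets, energy and integral harmonic functions

module LowerBound where

  open Forms
  open Burning
  open import Defs
  open import Data.Nat as ℕ using (ℕ; zero; suc; _^_; NonZero)
  import Data.Nat.Properties as ℕₚ
  open import Data.Nat.Coprimality as Coprimality using (Coprime)
  open import Data.Nat.Divisibility using (_∣_; divides; ∣⇒≤)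
  open import Data.Fin as Fin using (Fin; zero; suc; toℕ)
  import Data.Fin.Properties as Finₚ
  open import Data.Fin.Properties using (_≟_; any?; all?; ¬∀⟶∃¬)
  open import Data.Bool as Bool using (Bool; true; false)
  import Data.Bool.Properties as Boolₚ
  open import Data.Empty using (⊥)
  open import Data.List as List using (List)
  import Data.List.Properties as Listₚ
  import Data.List.Relation.Unary.All.Properties as Allₚ
  import Data.List.Relation.Unary.AllPairs.Properties as AllPairsₚ
  open import Data.Product
  open import Data.Sum using (inj₁; inj₂)
  open import Data.Vec using (lookup; tabulate)
  open import Data.Fin.Subset using (Subset)
  open import Data.Fin.Subset.Properties using (anySubset?)
  open import Data.Integer as ℤ using (ℤ; 0ℤ; 1ℤ; _+_; _-_; _*_; -_; _≤_; _<_; +≤+) renaming (+_ to pos)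
  import Data.Integer.Properties as ℤₚ
  open import Data.Integer.Tactic.RingSolver using (solve-∀)
  open import Data.Rational as ℚ using (ℚ; _/_)
  open import Algebra.Properties.Semiring.Sum ℤₚ.+-*-semiring using (sum; sum-cong-≗; ∑-distrib-+; sum-remove; sum-replicate-zero)
  open import Relation.Binary.PropositionalEquality hiding (J)
  open import Relation.Nullary using (Dec; does; yes; no; ¬_; contradiction; ¬?; _→-dec_; _×-dec_; decidable-stable)
  open import Function using (_∘_)

  sum-mono : ∀ {n} {f g : Fin n → ℤ} → (∀ i → f i ≤ g i) → sum f ≤ sum g
  sum-mono {zero} f≤g = ℤₚ.≤-refl
  sum-mono {suc n} f≤g = ℤₚ.+-mono-≤ (f≤g zero) (sum-mono (f≤g ∘ suc))

  sum-nonpos : ∀ {n} {f : Fin n → ℤ} → (∀ i → f i ≤ 0ℤ) → sum f ≤ 0ℤ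
  sum-nonpos {n} {f} f≤0 = subst (sum f ≤_) (sum-replicate-zero n) (sum-mono f≤0)

  sum-nonneg : ∀ {n} {f : Fin n → ℤ} → (∀ i → 0ℤ ≤ f i) → 0ℤ ≤ sum f
  sum-nonneg {n} {f} 0≤f = subst (_≤ sum f) (sum-replicate-zero n) (sum-mono 0≤f)

  term≤sum : ∀ {n} {f : Fin n → ℤ} → (∀ i → 0ℤ ≤ f i) → ∀ i → f i ≤ sum f
  term≤sum {suc n} {f} 0≤f i = subst (f i ≤_) (sym (sum-remove {i = i} f))
    (subst (_≤ f i + sum (f ∘ Fin.punchIn i)) (ℤₚ.+-identityʳ (f i)) (ℤₚ.+-monoʳ-≤ (f i) (sum-nonneg (0≤f ∘ Fin.punchIn i))))

  sum-const : ∀ n c → sum {n} (λ _ → c) ≡ pos n * c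
  sum-const zero c = sym (ℤₚ.*-zeroˡ c)
  sum-const (suc n) c = trans (cong (c +_) (sum-const n c)) (sym (ℤₚ.suc-* (pos n) c))

  *-nonneg : ∀ {x y} → 0ℤ ≤ x → 0ℤ ≤ y → 0ℤ ≤ x * y
  *-nonneg {pos m} {pos n} _ _ = subst (0ℤ ≤_) (ℤₚ.pos-* m n) (+≤+ ℕ.z≤n)

  square-nonneg : ∀ x → 0ℤ ≤ x * x
  square-nonneg x with ℤₚ.≤-total 0ℤ x
  ... | inj₁ 0≤x = *-nonneg 0≤x 0≤x
  ... | inj₂ x≤0 = subst (0ℤ ≤_) (ring x) (*-nonneg (ℤₚ.neg-mono-≤ x≤0) (ℤₚ.neg-mono-≤ x≤0))
    where
    ring : ∀ x → (- x) * (- x) ≡ x * x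
    ring = solve-∀

  form-const : ∀ {V m} (R : Edges V m) f g c → form R (λ v → f v - c) g ≡ form R f g
  form-const R f g c = sum-cong-≗ λ e → cong (_* diff g (R e)) (ring (f (proj₁ (R e))) (f (proj₂ (R e))) c)
    where
    ring : ∀ x y c → (x - c) - (y - c) ≡ x - y
    ring = solve-∀

  module Flow {n m} (R : Edges (Fin n) m) {a b : Fin n} (Φ : Fin n → ℤ) (Φb≡0 : Φ b ≡ 0ℤ) (0<Φa : 0ℤ < Φ a)
    (harm : ∀ v → v ≢ a → v ≢ b → lap R Φ v ≡ 0ℤ) where

    J : ℤ
    J = lap R Φ a

    -- Subtracting the constant `f b` does not change the form, so any test function measures the
    -- flux of `Φ`; for the indicator of a level set this is the flux through the cut.
    form-Φ : ∀ f → form R f Φ ≡ (f a - f b) * J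
    form-Φ f = trans (sym (form-const R f Φ (f b))) (form-harmonic R (λ v → f v - f b) Φ (ℤₚ.+-inverseʳ (f b)) harm)

    energy : form R Φ Φ ≡ Φ a * J
    energy = form-harmonic R Φ Φ Φb≡0 harm

    0≤J : 0ℤ ≤ J
    0≤J with ℤₚ.≤-total 0ℤ J
    ... | inj₁ 0≤J = 0≤J
    ... | inj₂ J≤0 = ℤₚ.*-cancelˡ-≤-pos 0ℤ J (Φ a) {{ℤ.positive 0<Φa}}
      (subst₂ _≤_ (sym (ℤₚ.*-zeroʳ (Φ a))) energy (sum-nonneg λ e → square-nonneg (diff Φ (R e))))

    -- The edges crossing a level of Φ carry the total current J, all in the same direction.
    diff≤J : ∀ e → diff Φ (R e) ≤ J × - diff Φ (R e) ≤ J
    diff≤J e = bound , subst (_≤ J) (ring (Φ x) (Φ y)) bound′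
      where
      x = proj₁ (R e)
      y = proj₂ (R e)
      ring : ∀ x y → y - x ≡ - (x - y)
      ring = solve-∀
      above : ℤ → Fin n → ℤ
      above t v = ind (does (t ℤₚ.≤? Φ v))
      monotone : ∀ t u v → 0ℤ ≤ (above t u - above t v) * (Φ u - Φ v)
      monotone t u v with t ℤₚ.≤? Φ u | t ℤₚ.≤? Φ v
      ... | yes _ | yes _ = ℤₚ.≤-reflexive (sym (ℤₚ.*-zeroˡ (Φ u - Φ v)))
      ... | no _ | no _ = ℤₚ.≤-reflexive (sym (ℤₚ.*-zeroˡ (Φ u - Φ v)))
      ... | yes t≤u | no t≰v = subst (0ℤ ≤_) (sym (ℤₚ.*-identityˡ (Φ u - Φ v))) (ℤₚ.i≤j⇒0≤j-i (ℤₚ.≤-trans (ℤₚ.<⇒≤ (ℤₚ.≰⇒> t≰v)) t≤u))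
      ... | no t≰u | yes t≤v = subst (0ℤ ≤_) (flip (Φ u) (Φ v)) (ℤₚ.i≤j⇒0≤j-i (ℤₚ.≤-trans (ℤₚ.<⇒≤ (ℤₚ.≰⇒> t≰u)) t≤v))
        where
        flip : ∀ u v → v - u ≡ (0ℤ - 1ℤ) * (u - v)
        flip = solve-∀
      above-ab : ∀ t → (above t a - above t b) * J ≤ J
      above-ab t with t ℤₚ.≤? Φ a | t ℤₚ.≤? Φ b
      ... | yes _ | yes _ = subst (_≤ J) (sym (ℤₚ.*-zeroˡ J)) 0≤J
      ... | no _ | no _ = subst (_≤ J) (sym (ℤₚ.*-zeroˡ J)) 0≤J
      ... | yes _ | no _ = ℤₚ.≤-reflexive (ℤₚ.*-identityˡ J)
      ... | no _ | yes _ = ℤₚ.≤-trans (subst (_≤ 0ℤ) (flip J) (ℤₚ.neg-mono-≤ 0≤J)) 0≤J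
        where
        flip : ∀ j → - j ≡ (0ℤ - 1ℤ) * j
        flip = solve-∀
      -- `above t` increases with `Φ`, so every edge has a nonnegative term, and a single term is at
      -- most the total flux.
      crossing : ∀ t → (above t x - above t y) * (Φ x - Φ y) ≤ J
      crossing t = ℤₚ.≤-trans (term≤sum (λ e → monotone t (proj₁ (R e)) (proj₂ (R e))) e)
        (subst (_≤ J) (sym (form-Φ (above t))) (above-ab t))
      -- The level through the higher end, t = Φ x, separates the two ends.
      bound : Φ x - Φ y ≤ J
      bound with Φ x ℤₚ.≤? Φ y
      ... | yes x≤y = ℤₚ.≤-trans (ℤₚ.i≤j⇒i-j≤0 x≤y) 0≤J
      ... | no x≰y with Φ x ℤₚ.≤? Φ x | Φ x ℤₚ.≤? Φ y | crossing (Φ x)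
      ...   | yes _ | no _ | c = subst (_≤ J) (ℤₚ.*-identityˡ (Φ x - Φ y)) c
      ...   | no x≰x | _ | _ = contradiction ℤₚ.≤-refl x≰x
      ...   | yes _ | yes x≤y | _ = contradiction x≤y x≰y
      bound′ : Φ y - Φ x ≤ J
      bound′ with Φ y ℤₚ.≤? Φ x
      ... | yes y≤x = ℤₚ.≤-trans (ℤₚ.i≤j⇒i-j≤0 y≤x) 0≤J
      ... | no y≰x with Φ y ℤₚ.≤? Φ x | Φ y ℤₚ.≤? Φ y | crossing (Φ y)
      ...   | no _ | yes _ | c = subst (_≤ J) (flip (Φ x) (Φ y)) c
        where
        flip : ∀ u v → (0ℤ - 1ℤ) * (u - v) ≡ v - u
        flip = solve-∀
      ...   | _ | no y≰y | _ = contradiction ℤₚ.≤-refl y≰y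
      ...   | yes y≤x | yes _ | _ = contradiction y≤x y≰x

    drop≤m*current : 0ℤ < J → Φ a ≤ pos m * J
    drop≤m*current 0<J = ℤₚ.*-cancelʳ-≤-pos (Φ a) (pos m * J) J {{ℤ.positive 0<J}} (begin
      Φ a * J                    ≡⟨ energy ⟨
      form R Φ Φ                 ≤⟨ sum-mono (λ e → square-bound (diff Φ (R e)) (diff≤J e)) ⟩
      sum {m} (λ _ → J * J)      ≡⟨ sum-const m (J * J) ⟩
      pos m * (J * J)            ≡⟨ ℤₚ.*-assoc (pos m) J J ⟨
      pos m * J * J              ∎)
      where
      open ℤₚ.≤-Reasoning
      square-bound : ∀ d → d ≤ J × - d ≤ J → d * d ≤ J * J
      square-bound d (d≤J , -d≤J) = ℤₚ.0≤i-j⇒j≤i (subst (0ℤ ≤_) (ring J d)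
        (*-nonneg (ℤₚ.i≤j⇒0≤j-i d≤J) (ℤₚ.i≤j⇒0≤j-i -d≤J)))
        where
        ring : ∀ j d → (j - d) * (j - (- d)) ≡ j * j - d * d
        ring = solve-∀

  module Stabilise {n m} (G : Graph n m) (conn : Connected G) (a b : Fin n) (a≢b : a ≢ b) where

    R : Edges (Fin n) m
    R = ends G

    -- The bound by `k` is carried along so that the total deficit below `k` can measure the
    -- progress of the firings.
    record Subharmonic (k : ℕ) (F : Fin n → ℤ) : Set where
      field
        at-a  : F a ≡ pos k
        at-b  : F b ≡ 0ℤ
        F≤k   : ∀ v → F v ≤ pos k
        lap≤0 : ∀ v → v ≢ a → v ≢ b → lap R F v ≤ 0ℤ
    open Subharmonic

    -- For the configuration -lap F this is the firing of the set `S`: each vertex of `S` loses one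
    -- chip along every edge leaving `S`.
    fire : Subset n → (Fin n → ℤ) → Fin n → ℤ
    fire S F v = F v + χ S v

    -- After the firing the configuration is still nonnegative on `S`; the terminals are sinks and
    -- never fire.
    Legal : (Fin n → ℤ) → Subset n → Set
    Legal F S = ∃ (λ v → lookup S v ≡ true) ×
      (∀ v → lookup S v ≡ true → v ≢ a × v ≢ b × lap R (fire S F) v ≤ 0ℤ)

    legal? : ∀ F S → Dec (Legal F S)
    legal? F S = any? (λ v → lookup S v Boolₚ.≟ true) ×-dec
      all? (λ v → (lookup S v Boolₚ.≟ true) →-dec ((¬? (v ≟ a)) ×-dec ((¬? (v ≟ b)) ×-dec (lap R (fire S F) v ℤₚ.≤? 0ℤ))))

    χ≤1 : ∀ (S : Subset n) v → χ S v ≤ 1ℤ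
    χ≤1 S v with lookup S v
    ... | true = ℤₚ.≤-refl
    ... | false = +≤+ ℕ.z≤n

    0≤χ : ∀ (S : Subset n) v → 0ℤ ≤ χ S v
    0≤χ S v with lookup S v
    ... | true = +≤+ ℕ.z≤n
    ... | false = ℤₚ.≤-refl

    χ-outside : ∀ (S : Subset n) {v} → lookup S v ≢ true → χ S v ≡ 0ℤ
    χ-outside S {v} v∉S with lookup S v
    ... | true = contradiction refl v∉S
    ... | false = refl

    -- Maximum principle: the set where F attains its upper bound is closed under neighbours.
    neighbour-max : ∀ F M v → (∀ w → F w ≤ M) → F v ≡ M → lap R F v ≤ 0ℤ →
      ∀ e → (proj₁ (R e) ≡ v → F (proj₂ (R e)) ≡ M) × (proj₂ (R e) ≡ v → F (proj₁ (R e)) ≡ M)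
    neighbour-max F M v F≤M Fv≡M lap≤0 e = from₁ (R e) refl , from₂ (R e) refl
      where
      gap : ∀ w → 0ℤ ≤ F v - F w
      gap w = ℤₚ.i≤j⇒0≤j-i (subst (F w ≤_) (sym Fv≡M) (F≤M w))
      term-nonneg : ∀ x y → 0ℤ ≤ (δ v x - δ v y) * (F x - F y)
      term-nonneg x y with v ≟ x | v ≟ y
      ... | yes refl | yes refl = ℤₚ.≤-reflexive (sym (ℤₚ.*-zeroˡ (F v - F v)))
      ... | yes refl | no _ = subst (0ℤ ≤_) (sym (ℤₚ.*-identityˡ (F x - F y))) (gap y)
      ... | no _ | yes refl = subst (0ℤ ≤_) (ring (F x) (F y)) (gap x)
        where
        ring : ∀ p q → q - p ≡ (0ℤ - 1ℤ) * (p - q)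
        ring = solve-∀
      ... | no _ | no _ = ℤₚ.≤-reflexive (sym (ℤₚ.*-zeroˡ (F x - F y)))
      term≤0 : diff (δ v) (R e) * diff F (R e) ≤ 0ℤ
      term≤0 = ℤₚ.≤-trans (term≤sum (λ i → term-nonneg (proj₁ (R i)) (proj₂ (R i))) e) lap≤0
      closed : ∀ w → v ≢ w → (1ℤ - δ v w) * (F v - F w) ≤ 0ℤ → F w ≡ M
      closed w v≢w h = trans (ℤₚ.≤-antisym (subst (F w ≤_) (sym Fv≡M) (F≤M w))
        (ℤₚ.i-j≤0⇒i≤j (subst (_≤ 0ℤ) (trans (cong (λ z → (1ℤ - z) * (F v - F w)) (δ-≢ v≢w)) (ℤₚ.*-identityˡ (F v - F w))) h))) Fv≡M
      from₁ : ∀ p → R e ≡ p → proj₁ p ≡ v → F (proj₂ p) ≡ M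
      from₁ (.v , y) eq refl = closed y v≢y (subst (λ z → (z - δ v y) * (F v - F y) ≤ 0ℤ) (δ-refl v) (subst (λ p → diff (δ v) p * diff F p ≤ 0ℤ) eq term≤0))
        where
        v≢y : v ≢ y
        v≢y v≡y = noLoop G e (trans (cong proj₁ eq) (trans v≡y (sym (cong proj₂ eq))))
      from₂ : ∀ p → R e ≡ p → proj₂ p ≡ v → F (proj₁ p) ≡ M
      from₂ (x , .v) eq refl = closed x v≢x (subst (_≤ 0ℤ) (ring (δ v x) (F x) (F v))
        (subst (λ z → (δ v x - z) * (F x - F v) ≤ 0ℤ) (δ-refl v) (subst (λ p → diff (δ v) p * diff F p ≤ 0ℤ) eq term≤0)))
        where
        ring : ∀ d p q → (d - 1ℤ) * (p - q) ≡ (1ℤ - d) * (q - p)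
        ring = solve-∀
        v≢x : v ≢ x
        v≢x v≡x = noLoop G e (trans (cong proj₁ eq) (trans (sym v≡x) (sym (cong proj₂ eq))))

    -- A value above `k` would be k + 1, the largest possible, and is attained only on `S`. There
    -- the fired function is subharmonic, so the value spreads to all neighbours and along a path to
    -- `a`, which does not fire.
    fire-bound : ∀ k F S → Subharmonic k F → Legal F S → ∀ v → fire S F v ≤ pos k
    fire-bound k F S sub (_ , legal) v = decidable-stable (fire S F v ℤₚ.≤? pos k) λ v≰k → escape v (conn v a) (top v (ℤₚ.≰⇒> v≰k))
      where
      M : ℤ
      M = pos k + 1ℤ
      fire≤M : ∀ w → fire S F w ≤ M
      fire≤M w = ℤₚ.+-mono-≤ (F≤k sub w) (χ≤1 S w)
      top : ∀ w → pos k < fire S F w → fire S F w ≡ M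
      top w k<w = ℤₚ.≤-antisym (fire≤M w) (subst (_≤ fire S F w) (ℤₚ.+-comm 1ℤ (pos k)) (ℤₚ.i<j⇒suc[i]≤j k<w))
      k<M : pos k < M
      k<M = ℤₚ.suc[i]≤j⇒i<j (ℤₚ.≤-reflexive (ℤₚ.+-comm 1ℤ (pos k)))
      fired : ∀ w → fire S F w ≡ M → lookup S w ≡ true
      fired w w≡M with lookup S w in eq
      ... | true = refl
      ... | false = contradiction (subst (_≤ pos k) (trans (sym (ℤₚ.+-identityʳ (F w))) w≡M) (F≤k sub w)) (ℤₚ.<⇒≱ k<M)
      next : ∀ w → fire S F w ≡ M → ∀ e → (proj₁ (R e) ≡ w → fire S F (proj₂ (R e)) ≡ M) × (proj₂ (R e) ≡ w → fire S F (proj₁ (R e)) ≡ M)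
      next w w≡M = neighbour-max (fire S F) M w fire≤M w≡M (proj₂ (proj₂ (legal w (fired w w≡M))))
      escape : ∀ w → Reach G w a → fire S F w ≡ M → ⊥
      escape w here w≡M = proj₁ (legal w (fired w w≡M)) refl
      escape w (fwd e eq r) w≡M = escape _ r (proj₁ (next w w≡M e) eq)
      escape w (bwd e eq r) w≡M = escape _ r (proj₂ (next w w≡M e) eq)

    lap-at-minimum : ∀ f v → f v ≡ 0ℤ → (∀ w → 0ℤ ≤ f w) → lap R f v ≤ 0ℤ
    lap-at-minimum f v fv≡0 0≤f = sum-nonpos λ e → term (proj₁ (R e)) (proj₂ (R e))
      where
      term : ∀ x y → (δ v x - δ v y) * (f x - f y) ≤ 0ℤ
      term x y with v ≟ x | v ≟ y
      ... | yes refl | yes refl = ℤₚ.≤-reflexive (ℤₚ.*-zeroˡ (f v - f v))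
      ... | yes refl | no _ = subst (_≤ 0ℤ) (trans (cong (_- f y) (sym fv≡0)) (sym (ℤₚ.*-identityˡ (f v - f y)))) (ℤₚ.i≤j⇒i-j≤0 (0≤f y))
      ... | no _ | yes refl = subst (_≤ 0ℤ) (trans (ring (f x)) (cong (λ z → (0ℤ - 1ℤ) * (f x - z)) (sym fv≡0))) (ℤₚ.i≤j⇒i-j≤0 (0≤f x))
        where
        ring : ∀ p → 0ℤ - p ≡ (0ℤ - 1ℤ) * (p - 0ℤ)
        ring = solve-∀
      ... | no _ | no _ = ℤₚ.≤-reflexive (ℤₚ.*-zeroˡ (f x - f y))

    fire-subharmonic : ∀ k F S → Subharmonic k F → Legal F S → Subharmonic k (fire S F)
    fire-subharmonic k F S sub legal@(_ , inside) = record
      { at-a = trans (cong (F a +_) (χ-outside S {a} λ a∈S → proj₁ (inside a a∈S) refl)) (trans (ℤₚ.+-identityʳ (F a)) (at-a sub))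
      ; at-b = trans (cong (F b +_) (χ-outside S {b} λ b∈S → proj₁ (proj₂ (inside b b∈S)) refl)) (trans (ℤₚ.+-identityʳ (F b)) (at-b sub))
      ; F≤k = fire-bound k F S sub legal
      ; lap≤0 = lap≤0′
      }
      where
      lap≤0′ : ∀ v → v ≢ a → v ≢ b → lap R (fire S F) v ≤ 0ℤ
      lap≤0′ v v≢a v≢b with lookup S v Boolₚ.≟ true
      ... | yes v∈S = proj₂ (proj₂ (inside v v∈S))
      -- Outside `S` the indicator is at its minimum, so adding it can only lower the Laplacian.
      ... | no v∉S = subst (_≤ 0ℤ) (sym (form-+ʳ R (δ v) F (χ S))) (ℤₚ.+-mono-≤ (lap≤0 sub v v≢a v≢b) (lap-at-minimum (χ S) v (χ-outside S v∉S) (0≤χ S)))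

    deficit : ℕ → (Fin n → ℤ) → ℤ
    deficit k F = sum λ v → pos k - F v

    0≤deficit : ∀ k F → Subharmonic k F → 0ℤ ≤ deficit k F
    0≤deficit k F sub = sum-nonneg λ v → ℤₚ.i≤j⇒0≤j-i (F≤k sub v)

    deficit-fire : ∀ k F S → ∃ (λ v → lookup S v ≡ true) → deficit k (fire S F) + 1ℤ ≤ deficit k F
    deficit-fire k F S (v , v∈S) = begin
      deficit k (fire S F) + 1ℤ                 ≤⟨ ℤₚ.+-monoʳ-≤ (deficit k (fire S F)) (subst (_≤ sum (χ S)) (cong ind v∈S) (term≤sum (0≤χ S) v)) ⟩
      deficit k (fire S F) + sum (χ S)          ≡⟨ ∑-distrib-+ (λ w → pos k - fire S F w) (χ S) ⟨
      sum (λ w → (pos k - fire S F w) + χ S w)  ≡⟨ sum-cong-≗ (λ w → ring (pos k) (F w) (χ S w)) ⟩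
      deficit k F                               ∎
      where
      open ℤₚ.≤-Reasoning
      ring : ∀ k f c → (k - (f + c)) + c ≡ k - f
      ring = solve-∀

    -- Maximality is recorded as the absence of legal firings, which is the form in which
    -- superstability uses it.
    Maximal : ℕ → Set
    Maximal k = ∃ λ F → Subharmonic k F × (∀ S → ¬ Legal F S)

    -- Each legal firing lowers the nonnegative deficit by at least 1, so a bound `t` for the
    -- deficit serves as fuel.
    stabilise : ∀ t k F → Subharmonic k F → deficit k F ≤ pos t → Maximal k
    stabilise t k F sub d≤t with anySubset? (legal? F)
    ... | no none = F , sub , λ S legal → none (S , legal)
    stabilise zero k F sub d≤t | yes (S , legal) =
      contradiction (ℤₚ.≤-trans (ℤₚ.+-monoˡ-≤ 1ℤ (0≤deficit k (fire S F) (fire-subharmonic k F S sub legal)))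
        (ℤₚ.≤-trans (deficit-fire k F S (proj₁ legal)) d≤t)) λ { (+≤+ ()) }
    stabilise (suc t) k F sub d≤t | yes (S , legal) =
      stabilise t k (fire S F) (fire-subharmonic k F S sub legal)
        (subst₂ _≤_ (cancel (deficit k (fire S F))) refl
          (ℤₚ.+-monoˡ-≤ (- 1ℤ) (ℤₚ.≤-trans (deficit-fire k F S (proj₁ legal)) d≤t)))
      where
      cancel : ∀ x → (x + 1ℤ) + - 1ℤ ≡ x
      cancel = solve-∀

    initial : ∀ k → Subharmonic k (λ v → pos k * δ v a)
    initial k = record
      { at-a = trans (cong (pos k *_) (δ-refl a)) (ℤₚ.*-identityʳ (pos k))
      ; at-b = trans (cong (pos k *_) (δ-≢ (a≢b ∘ sym))) (ℤₚ.*-zeroʳ (pos k))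
      ; F≤k = bound
      ; lap≤0 = λ v v≢a _ → subst (_≤ 0ℤ) (sym (form-*ʳ R (δ v) (pos k) (λ w → δ w a)))
          (subst (pos k * lap R (λ w → δ w a) v ≤_) (ℤₚ.*-zeroʳ (pos k)) (ℤₚ.*-monoˡ-≤-nonNeg (pos k) (lap-at-minimum (λ w → δ w a) v (δ-≢ v≢a) 0≤δ)))
      }
      where
      bound : ∀ v → pos k * δ v a ≤ pos k
      bound v with v ≟ a
      ... | yes _ = ℤₚ.≤-reflexive (ℤₚ.*-identityʳ (pos k))
      ... | no _ = subst (_≤ pos k) (sym (ℤₚ.*-zeroʳ (pos k))) (+≤+ ℕ.z≤n)
      0≤δ : ∀ w → 0ℤ ≤ δ w a
      0≤δ w with w ≟ a
      ... | yes _ = +≤+ ℕ.z≤n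
      ... | no _ = ℤₚ.≤-refl

    maximal : ∀ k → Maximal k
    maximal k = stabilise ℤ.∣ deficit k (λ v → pos k * δ v a) ∣ k _ (initial k)
      (ℤₚ.≤-reflexive (sym (ℤₚ.0≤i⇒+∣i∣≡i (0≤deficit k _ (initial k)))))

    terminal : Fin n → Bool
    terminal v = does (v ≟ a) Bool.∨ does (v ≟ b)

    interior : ∀ {v} → v ≢ a → v ≢ b → terminal v ≡ false
    interior {v} v≢a v≢b with v ≟ a | v ≟ b
    ... | yes v≡a | _ = contradiction v≡a v≢a
    ... | no _ | yes v≡b = contradiction v≡b v≢b
    ... | no _ | no _ = refl

    interior⁻¹ : ∀ v → terminal v ≡ false → v ≢ a × v ≢ b
    interior⁻¹ v eq with v ≟ a | v ≟ b
    ... | no v≢a | no v≢b = v≢a , v≢b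

    approx : ℕ → Fin n → ℤ
    approx k = proj₁ (maximal k)

    config : ℕ → Fin n → ℤ
    config k v = - lap R (approx k) v

    -- Nonnegativity is subharmonicity. Since `S` is not legal for the maximal function, some v in
    -- `S` has positive Laplacian after firing, which rearranges to -lap F v < lap (χ S) v.
    config-admissible : ∀ k → Admissible R terminal (λ _ → 0ℤ) (config k)
    config-admissible k = lower , stable
      where
      F = approx k
      sub = proj₁ (proj₂ (maximal k))
      lower : ∀ v → terminal v ≡ false → 0ℤ ≤ config k v
      lower v int = ℤₚ.neg-mono-≤ (lap≤0 sub v (proj₁ (interior⁻¹ v int)) (proj₂ (interior⁻¹ v int)))
      stable : ∀ S → ∃ (λ v → lookup S v ≡ true) → (∀ v → lookup S v ≡ true → terminal v ≡ false) →
        ∃ λ v → lookup S v ≡ true × config k v < 0ℤ + lap R (χ S) v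
      stable S ne S-int with ¬∀⟶∃¬ n (λ v → lookup S v ≡ true → lap R (fire S F) v ≤ 0ℤ)
        (λ v → (lookup S v Boolₚ.≟ true) →-dec (lap R (fire S F) v ℤₚ.≤? 0ℤ))
        (λ all → proj₂ (proj₂ (maximal k)) S (ne , λ v v∈S → proj₁ (interior⁻¹ v (S-int v v∈S)) , proj₂ (interior⁻¹ v (S-int v v∈S)) , all v v∈S))
      ... | v , ¬ok with lookup S v in eq
      ...   | false = contradiction (λ ()) ¬ok
      ...   | true = v , eq , subst₂ _<_ (left (lap R F v)) (right (lap R F v) (lap R (χ S) v))
                (ℤₚ.+-monoʳ-< (- lap R F v) (subst (0ℤ <_) (form-+ʳ R (δ v) F (χ S)) (ℤₚ.≰⇒> λ h → ¬ok λ _ → h)))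
        where
        left : ∀ x → - x + 0ℤ ≡ - x
        left = solve-∀
        right : ∀ x y → - x + (x + y) ≡ 0ℤ + y
        right = solve-∀

    -- Two of the 2 ^ m + 1 configurations agree, and the difference of their potentials is harmonic.
    integral-harmonic : ∃ λ N → (1 ℕ.≤ N) × (N ℕ.≤ 2 ^ m) × ∃ λ H →
      H a ≡ pos N × H b ≡ 0ℤ × (∀ v → v ≢ a → v ≢ b → lap R H v ≡ 0ℤ)
    integral-harmonic with any? (λ (i : Fin (suc (2 ^ m))) → any? (λ j → (i Finₚ.<? j) ×-dec agree? (toℕ i) (toℕ j)))
      where
      agree? : ∀ i j → Dec (Agree terminal (config i) (config j))
      agree? i j = all? (λ v → (terminal v Boolₚ.≟ false) →-dec (config i v ℤₚ.≟ config j v))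
    ... | no none = contradiction (subst (ℕ._≤ 2 ^ m) (Listₚ.length-tabulate configs)
        (admissible-bound m R terminal (λ _ → 0ℤ) (List.tabulate configs) (Allₚ.tabulate⁺ (λ i → config-admissible (toℕ i)))
          (AllPairsₚ.tabulate⁺-< λ {i} {j} i<j agree → none (i , j , i<j , agree)))) (ℕₚ.<⇒≱ (ℕₚ.n<1+n (2 ^ m)))
      where
      configs : Fin (suc (2 ^ m)) → Fin n → ℤ
      configs i = config (toℕ i)
    ... | yes (i , j , i<j , agree) = toℕ j ℕ.∸ toℕ i , ℕₚ.m<n⇒0<n∸m i<j ,
        ℕₚ.≤-trans (ℕₚ.m∸n≤m (toℕ j) (toℕ i)) (ℕₚ.≤-pred (Finₚ.toℕ<n j)) , H , H-a , H-b , harm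
      where
      Fi = approx (toℕ i)
      Fj = approx (toℕ j)
      subᵢ = proj₁ (proj₂ (maximal (toℕ i)))
      subⱼ = proj₁ (proj₂ (maximal (toℕ j)))
      H : Fin n → ℤ
      H v = Fj v + (- 1ℤ) * Fi v
      ring : ∀ x y → x + (- 1ℤ) * y ≡ x - y
      ring = solve-∀
      H-a : H a ≡ pos (toℕ j ℕ.∸ toℕ i)
      H-a = begin
        Fj a + (- 1ℤ) * Fi a                  ≡⟨ cong₂ (λ x y → x + (- 1ℤ) * y) (at-a subⱼ) (at-a subᵢ) ⟩
        pos (toℕ j) + (- 1ℤ) * pos (toℕ i)    ≡⟨ ring (pos (toℕ j)) (pos (toℕ i)) ⟩
        pos (toℕ j) - pos (toℕ i)             ≡⟨ ℤₚ.m-n≡m⊖n (toℕ j) (toℕ i) ⟩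
        toℕ j ℤ.⊖ toℕ i                       ≡⟨ ℤₚ.⊖-≥ (ℕₚ.<⇒≤ i<j) ⟩
        pos (toℕ j ℕ.∸ toℕ i)                 ∎
        where open ≡-Reasoning
      H-b : H b ≡ 0ℤ
      H-b = cong₂ (λ x y → x + (- 1ℤ) * y) (at-b subⱼ) (at-b subᵢ)
      harm : ∀ v → v ≢ a → v ≢ b → lap R H v ≡ 0ℤ
      harm v v≢a v≢b = begin
        lap R H v                                        ≡⟨ form-+ʳ R (δ v) Fj (λ w → (- 1ℤ) * Fi w) ⟩
        lap R Fj v + lap R (λ w → (- 1ℤ) * Fi w) v       ≡⟨ cong (lap R Fj v +_) (form-*ʳ R (δ v) (- 1ℤ) Fi) ⟩
        lap R Fj v + (- 1ℤ) * lap R Fi v                 ≡⟨ ring (lap R Fj v) (lap R Fi v) ⟩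
        lap R Fj v - lap R Fi v                          ≡⟨ ℤₚ.i≡j⇒i-j≡0 (sym (ℤₚ.neg-injective (agree v (interior v≢a v≢b)))) ⟩
        0ℤ                                               ∎
        where open ≡-Reasoning

  pos-cancel : ∀ {x y} d → x * pos (suc d) ≡ y * pos (suc d) → x ≡ y
  pos-cancel {x} {y} d = ℤₚ.*-cancelʳ-≡ x y (pos (suc d))

  -- Cleared of the denominator and of the logarithm, the bounds read m ≥ q / p and m ≥ log2 q. With
  -- drop D and current J of the integral potential, the resistance hypothesis is q J = p D.
  lower-bound : ∀ {n m} (G : Graph n m) → Connected G → (a b : Fin n) → a ≢ b →
    (p q : ℕ) → {{_ : NonZero p}} → Coprime p q → p ℕ.< q →
    EffRes G a b (pos q / p) → (q ℕ.≤ p ℕ.* m) × (q ℕ.≤ 2 ^ m)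
  lower-bound {n} {m} G conn a b a≢b (suc p) q cop p<q (φ , (φa , φb , φ-harm) , rI≡1) = bound₁ , bound₂
    where
    cd = common-denominator φ
    d = proj₁ cd
    Φ = proj₁ (proj₂ cd)
    φ≡Φ = proj₂ (proj₂ cd)
    R = ends G
    D = pos (suc d)
    current : ∀ v → currentOut G φ v ≡ lap R Φ v / suc d
    current = currentOut-/ G φ Φ d φ≡Φ
    Φa : Φ a ≡ D
    Φa = trans (sym (ℤₚ.*-identityʳ (Φ a))) (trans (/-cross⁻¹ (Φ a) 1ℤ d 0 (trans (sym (φ≡Φ a)) φa)) (ℤₚ.*-identityˡ D))
    Φb : Φ b ≡ 0ℤ
    Φb = trans (sym (ℤₚ.*-identityʳ (Φ b))) (/-cross⁻¹ (Φ b) 0ℤ d 0 (trans (sym (φ≡Φ b)) φb))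
    harm : ∀ v → v ≢ a → v ≢ b → lap R Φ v ≡ 0ℤ
    harm v v≢a v≢b = trans (sym (ℤₚ.*-identityʳ (lap R Φ v))) (/-cross⁻¹ (lap R Φ v) 0ℤ d 0 (trans (sym (current v)) (φ-harm v v≢a v≢b)))
    0<Φa : 0ℤ < Φ a
    0<Φa = subst (0ℤ <_) (sym Φa) (ℤ.+<+ ℕ.z<s)
    open Flow R Φ Φb 0<Φa harm
    qJ≡pD : pos q * J ≡ pos (suc p) * D
    qJ≡pD = begin
      pos q * J                   ≡⟨ ℤₚ.*-identityʳ (pos q * J) ⟨
      pos q * J * 1ℤ              ≡⟨ /-cross⁻¹ (pos q * J) 1ℤ (ℕ.pred (suc p ℕ.* suc d)) 0 (trans (sym (/-* (pos q) J p d)) (trans (cong (pos q / suc p ℚ.*_) (sym (current a))) rI≡1)) ⟩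
      1ℤ * pos (suc p ℕ.* suc d)  ≡⟨ ℤₚ.*-identityˡ (pos (suc p ℕ.* suc d)) ⟩
      pos (suc p ℕ.* suc d)       ≡⟨ ℤₚ.pos-* (suc p) (suc d) ⟩
      pos (suc p) * D             ∎
      where open ≡-Reasoning
    0<J : 0ℤ < J
    0<J = ℤₚ.≤∧≢⇒< 0≤J λ 0≡J → contradiction (trans (sym qJ≡pD) (trans (cong (pos q *_) (sym 0≡J)) (ℤₚ.*-zeroʳ (pos q)))) λ ()
    bound₁ : q ℕ.≤ suc p ℕ.* m
    bound₁ = ℤₚ.drop‿+≤+ (ℤₚ.*-cancelʳ-≤-pos (pos q) (pos (suc p ℕ.* m)) D (begin
      pos q * D                       ≡⟨ cong (pos q *_) Φa ⟨
      pos q * Φ a                     ≤⟨ ℤₚ.*-monoˡ-≤-nonNeg (pos q) (drop≤m*current 0<J) ⟩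
      pos q * (pos m * J)             ≡⟨ ring (pos q) (pos m) J ⟩
      pos m * (pos q * J)             ≡⟨ cong (pos m *_) qJ≡pD ⟩
      pos m * (pos (suc p) * D)       ≡⟨ ring′ (pos m) (pos (suc p)) D ⟩
      pos (suc p) * pos m * D         ≡⟨ cong (_* D) (ℤₚ.pos-* (suc p) m) ⟨
      pos (suc p ℕ.* m) * D           ∎))
      where
      open ℤₚ.≤-Reasoning
      ring : ∀ q m j → q * (m * j) ≡ m * (q * j)
      ring = solve-∀
      ring′ : ∀ m p d → m * (p * d) ≡ p * m * d
      ring′ = solve-∀
    bound₂ : q ℕ.≤ 2 ^ m
    bound₂ with Stabilise.integral-harmonic G conn a b a≢b
    ... | N , 1≤N , N≤2^m , H , Ha , Hb , H-harm = ℕₚ.≤-trans (∣⇒≤ {{ℕ.>-nonZero 1≤N}} q∣N) N≤2^m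
      where
      NJ≡DJ′ : pos N * J ≡ D * lap R H a
      NJ≡DJ′ = begin
        pos N * J          ≡⟨ cong (_* J) Ha ⟨
        H a * J            ≡⟨ form-harmonic R H Φ Hb harm ⟨
        form R H Φ         ≡⟨ form-sym R H Φ ⟩
        form R Φ H         ≡⟨ form-harmonic R Φ H Φb H-harm ⟩
        Φ a * lap R H a    ≡⟨ cong (_* lap R H a) Φa ⟩
        D * lap R H a      ∎
        where open ≡-Reasoning
      -- Reciprocity is multiplied by q, q J is replaced by p D, and D cancels: the current of `H`,
      -- an integer, is p N / q.
      qJ′≡pN : pos q * lap R H a ≡ pos (suc p) * pos N
      qJ′≡pN = pos-cancel d (begin
        pos q * lap R H a * D     ≡⟨ ring₁ (pos q) (lap R H a) D ⟩
        pos q * (D * lap R H a)   ≡⟨ cong (pos q *_) NJ≡DJ′ ⟨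
        pos q * (pos N * J)       ≡⟨ ring₂ (pos q) (pos N) J ⟩
        pos N * (pos q * J)       ≡⟨ cong (pos N *_) qJ≡pD ⟩
        pos N * (pos (suc p) * D) ≡⟨ ring₃ (pos N) (pos (suc p)) D ⟩
        pos (suc p) * pos N * D   ∎)
        where
        open ≡-Reasoning
        ring₁ : ∀ q j d → q * j * d ≡ q * (d * j)
        ring₁ = solve-∀
        ring₂ : ∀ q n j → q * (n * j) ≡ n * (q * j)
        ring₂ = solve-∀
        ring₃ : ∀ n p d → n * (p * d) ≡ p * n * d
        ring₃ = solve-∀
      q∣N : q ∣ N
      q∣N = Coprimality.coprime-divisor (Coprimality.sym cop) (divides ℤ.∣ lap R H a ∣ (begin
        suc p ℕ.* N                      ≡⟨ cong ℤ.∣_∣ (ℤₚ.pos-* (suc p) N) ⟩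
        ℤ.∣ pos (suc p) * pos N ∣        ≡⟨ cong ℤ.∣_∣ qJ′≡pN ⟨
        ℤ.∣ pos q * lap R H a ∣          ≡⟨ ℤₚ.abs-* (pos q) (lap R H a) ⟩
        q ℕ.* ℤ.∣ lap R H a ∣            ≡⟨ ℕₚ.*-comm q _ ⟩
        ℤ.∣ lap R H a ∣ ℕ.* q            ∎))
        where open ≡-Reasoning

-- Labelled cycles of darts and their substitution

module Orbits where

  open import Data.Nat using (ℕ)
  open import Data.Fin using (Fin)
  open import Data.Bool using (Bool)
  open import Data.Empty using (⊥)
  open import Data.Product
  open import Data.Sum using (_⊎_; inj₁; inj₂; [_,_])
  open import Relation.Binary.PropositionalEquality hiding (J; [_])
  open import Relation.Nullary using (contradiction)

  Dart : Set → Set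
  Dart E = E × Bool

  data Orbit {A : Set} (f : A → A) : A → A → Set where
    stay : ∀ {x} → Orbit f x x
    step : ∀ {x y} → Orbit f (f x) y → Orbit f x y

  _▸_ : ∀ {A : Set} {f : A → A} {x y z} → Orbit f x y → Orbit f y z → Orbit f x z
  stay ▸ q = q
  step p ▸ q = step (p ▸ q)

  -- The elements of W are the virtual darts: a map with W = Bool is a two-terminal network
  -- closed by a virtual edge, one with W = ⊥ is an honest map.
  record Cycles (E L W : Set) : Set where
    field
      π       : Dart E ⊎ W → Dart E ⊎ W
      lab     : Dart E → L ⊎ W
      first   : W → Dart E
      π-first : ∀ w → π (inj₂ w) ≡ inj₁ (first w)

    label : Dart E ⊎ W → L ⊎ W
    label = [ lab , inj₂ ]

    field
      invariant  : ∀ x → label (π x) ≡ label x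
      transitive : ∀ x y → label x ≡ label y → Orbit π x y
      inhabited  : ∀ l → ∃ λ d → lab d ≡ inj₁ l

    lab-first : ∀ w → lab (first w) ≡ inj₂ w
    lab-first w = trans (cong label (sym (π-first w))) (invariant (inj₂ w))

  open Cycles

  module Compose {K : ℕ} {W LB : Set} (B : Cycles (Fin K) LB W) (E L : Fin K → Set)
    (N : ∀ k → Cycles (E k) (L k) Bool) where

    E* L* : Set
    E* = Σ (Fin K) E
    L* = LB ⊎ Σ (Fin K) L

    tag : ∀ k → Dart (E k) → Dart E*
    tag k (e , s) = (k , e) , s

    enter : Dart (Fin K) ⊎ W → Dart E* ⊎ W
    enter (inj₁ (k , t)) = inj₁ (tag k (first (N k) t))
    enter (inj₂ w) = inj₂ w

    exit : ∀ k → Dart (E k) ⊎ Bool → Dart E* ⊎ W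
    exit k (inj₁ d) = inj₁ (tag k d)
    exit k (inj₂ t) = enter (π B (inj₁ (k , t)))

    -- `N k` replaces the edge `k` of `B`, terminal `t` being glued to the end `t`. Where a walk
    -- would meet the virtual dart of a part, it takes one step in the base and resumes in the next
    -- part just after the corresponding virtual dart. So only the virtual darts of the base remain.
    π* : Dart E* ⊎ W → Dart E* ⊎ W
    π* (inj₁ ((k , e) , s)) = exit k (π (N k) (inj₁ (e , s)))
    π* (inj₂ w) = enter (π B (inj₂ w))

    base : LB ⊎ W → L* ⊎ W
    base (inj₁ l) = inj₁ (inj₁ l)
    base (inj₂ w) = inj₂ w

    emb : ∀ k → L k ⊎ Bool → L* ⊎ W
    emb k (inj₁ l) = inj₁ (inj₂ (k , l))
    emb k (inj₂ t) = base (lab B (k , t))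

    lab* : Dart E* → L* ⊎ W
    lab* ((k , e) , s) = emb k (lab (N k) (e , s))

    label* : Dart E* ⊎ W → L* ⊎ W
    label* = [ lab* , inj₂ ]

    base-injective : ∀ {x y} → base x ≡ base y → x ≡ y
    base-injective {inj₁ _} {inj₁ _} refl = refl
    base-injective {inj₂ _} {inj₂ _} refl = refl

    label-enter : ∀ y → label* (enter y) ≡ base (label B y)
    label-enter (inj₁ (k , t)) = cong (emb k) (lab-first (N k) t)
    label-enter (inj₂ w) = refl

    label-exit : ∀ k x → label* (exit k x) ≡ emb k (label (N k) x)
    label-exit k (inj₁ d) = refl
    label-exit k (inj₂ t) = trans (label-enter (π B (inj₁ (k , t)))) (cong base (invariant B (inj₁ (k , t))))

    invariant* : ∀ x → label* (π* x) ≡ label* x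
    invariant* (inj₁ ((k , e) , s)) = trans (label-exit k (π (N k) (inj₁ (e , s)))) (cong (emb k) (invariant (N k) (inj₁ (e , s))))
    invariant* (inj₂ w) = trans (label-enter (π B (inj₂ w))) (cong base (invariant B (inj₂ w)))

    inside : ∀ k {l d} x → Orbit (π (N k)) x (inj₁ d) → label (N k) x ≡ inj₁ l → Orbit π* (exit k x) (inj₁ (tag k d))
    inside k (inj₁ d) stay _ = stay
    inside k (inj₁ d) (step p) eq = step (inside k _ p (trans (invariant (N k) (inj₁ d)) eq))

    leave : ∀ k t x → Orbit (π (N k)) x (inj₂ t) → label (N k) x ≡ inj₂ t → Orbit π* (exit k x) (enter (π B (inj₁ (k , t))))
    leave k t (inj₁ d) (step p) eq = step (leave k t _ p (trans (invariant (N k) (inj₁ d)) eq))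
    leave k t (inj₂ .t) _ refl = stay

    mutual
      -- The given orbit inside the part may wind through the virtual dart, where the composed walk
      -- leaves the part. The walk accumulated so far is then discarded and restarted at `first`,
      -- which is where `enter` lands.
      arrive : ∀ k t d₀ {d} → Orbit (π (N k)) (inj₁ d₀) (inj₁ d) → lab (N k) d₀ ≡ inj₂ t →
        Orbit π* (enter (inj₁ (k , t))) (inj₁ (tag k d₀)) → Orbit π* (enter (inj₁ (k , t))) (inj₁ (tag k d))
      arrive k t d₀ stay _ acc = acc
      arrive k t d₀ {d} (step p) eq acc = arrive′ k t _ p (trans (invariant (N k) (inj₁ d₀)) eq) (acc ▸ step stay)

      arrive′ : ∀ k t x {d} → Orbit (π (N k)) x (inj₁ d) → label (N k) x ≡ inj₂ t →
        Orbit π* (enter (inj₁ (k , t))) (exit k x) → Orbit π* (enter (inj₁ (k , t))) (inj₁ (tag k d))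
      arrive′ k t (inj₁ d₀) p eq acc = arrive k t d₀ p eq acc
      arrive′ k t (inj₂ .t) (step p) refl acc = again (π (N k) (inj₂ t)) (π-first (N k) t) p
        where
        again : ∀ x {d} → x ≡ inj₁ (first (N k) t) → Orbit (π (N k)) x (inj₁ d) → Orbit π* (enter (inj₁ (k , t))) (inj₁ (tag k d))
        again _ refl p = arrive k t _ p (lab-first (N k) t) stay

    -- One base step is the traversal of all darts of the part at terminal `t`, from `first` until
    -- the virtual dart is met.
    hop : ∀ y → Orbit π* (enter y) (enter (π B y))
    hop (inj₁ (k , t)) = leave k t (inj₁ (first (N k) t)) (transitive (N k) _ _ (lab-first (N k) t)) (lab-first (N k) t)
    hop (inj₂ w) = step stay

    lift : ∀ {y z} → Orbit (π B) y z → Orbit π* (enter y) (enter z)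
    lift stay = stay
    lift {y} (step p) = hop y ▸ lift p

    -- A dart either lies on a cycle interior to one part or belongs to the sector of a base dart
    -- `y`; in the second case it can be reached on entering at `y` and leads on to the successor of
    -- `y`.
    data View : Dart E* ⊎ W → Set where
      internal : ∀ k d l → lab (N k) d ≡ inj₁ l → View (inj₁ (tag k d))
      atBase   : ∀ {x} y → Orbit π* x (enter (π B y)) → Orbit π* (enter y) x → label* x ≡ base (label B y) → View x

    view : ∀ x → View x
    view (inj₁ ((k , e) , s)) with lab (N k) (e , s) in eq
    ... | inj₁ l = internal k (e , s) l eq
    ... | inj₂ t = atBase (inj₁ (k , t))
      (leave k t (inj₁ (e , s)) (transitive (N k) _ _ eq) eq)
      (arrive k t (first (N k) t) (transitive (N k) _ _ (trans (lab-first (N k) t) (sym eq))) (lab-first (N k) t) stay)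
      (cong (emb k) eq)
    view (inj₂ w) = atBase (inj₂ w) (step stay) stay refl

    internal≢base : ∀ {k l y} → emb k (inj₁ l) ≢ base y
    internal≢base {y = inj₁ _} ()
    internal≢base {y = inj₂ _} ()

    -- Interior labels inherit transitivity from their part. Between two sectors one leaves the
    -- first, follows the lifted base orbit, and walks into the second.
    transitive* : ∀ x y → label* x ≡ label* y → Orbit π* x y
    transitive* x y eq with view x | view y
    ... | internal k d l h | internal k′ d′ l′ h′ = same k k′ d d′ h h′ (trans (sym (cong (emb k) h)) (trans eq (cong (emb k′) h′)))
      where
      same : ∀ k k′ d d′ {l l′} → lab (N k) d ≡ inj₁ l → lab (N k′) d′ ≡ inj₁ l′ → emb k (inj₁ l) ≡ emb k′ (inj₁ l′) →
        Orbit π* (inj₁ (tag k d)) (inj₁ (tag k′ d′))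
      same k .k d d′ h h′ refl = inside k (inj₁ d) (transitive (N k) _ _ (trans h (sym h′))) h
    ... | internal k d l h | atBase z _ _ lz = contradiction (trans (sym (cong (emb k) h)) (trans eq lz)) internal≢base
    ... | atBase z _ _ lz | internal k d l h = contradiction (trans (sym (cong (emb k) h)) (trans (sym eq) lz)) internal≢base
    ... | atBase y₁ out _ l₁ | atBase y₂ _ inn l₂ = out ▸ (lift (transitive B (π B y₁) y₂
            (trans (invariant B y₁) (base-injective (trans (sym l₁) (trans eq l₂))))) ▸ inn)

    inhabited* : ∀ l → ∃ λ d → lab* d ≡ inj₁ l
    inhabited* (inj₁ l) with (k , t) , eq ← inhabited B l = tag k (first (N k) t) , trans (cong (emb k) (lab-first (N k) t)) (cong base eq)
    inhabited* (inj₂ (k , l)) with d , eq ← inhabited (N k) l = tag k d , cong (emb k) eq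

    compose : Cycles E* L* W
    compose = record
      { π = π*
      ; lab = lab*
      ; first = λ w → tag (proj₁ (first B w)) (first (N (proj₁ (first B w))) (proj₂ (first B w)))
      ; π-first = λ w → cong enter (π-first B w)
      ; invariant = invariant*
      ; transitive = transitive*
      ; inhabited = inhabited*
      }

-- Plane maps, duality and the elementary networks

module PlaneMaps where

  open Orbits
  open import Data.Nat using (ℕ)
  open import Data.Fin using (Fin)
  open import Data.Fin.Patterns
  open import Data.Bool using (Bool; true; false; not)
  import Data.Bool.Properties as Boolₚ
  open import Data.Empty using (⊥)
  open import Data.Product
  open import Data.Sum using (_⊎_; inj₁; inj₂; [_,_])
  open import Data.Sum.Properties using (inj₁-injective)
  open import Relation.Binary.PropositionalEquality hiding (J; [_])
  open import Relation.Nullary using (contradiction)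
  open import Function using (_∘_; id)
  open Cycles

  flipReal : ∀ {E W : Set} → Dart E ⊎ W → Dart E ⊎ W
  flipReal (inj₁ (e , s)) = inj₁ (e , not s)
  flipReal (inj₂ w) = inj₂ w

  flipVirtual : ∀ {E W : Set} → (W → W) → Dart E ⊎ W → Dart E ⊎ W
  flipVirtual flip (inj₁ d) = inj₁ d
  flipVirtual flip (inj₂ w) = inj₂ (flip w)

  -- The face permutation is σ ∘ reversal conjugated by the swap of the two virtual darts. With
  -- this convention substitution of networks for edges acts on vertices and faces alike.
  record PlaneMap {W : Set} (flip : W → W) (E LV LF : Set) : Set₁ where
    field
      vert   : Cycles E LV W
      face   : Cycles E LF W
      dual   : ∀ x → π face x ≡ flipVirtual flip (π vert (flipReal x))
      noLoop : ∀ e → lab vert (e , true) ≢ lab vert (e , false)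
      linked : ∀ (P : LV ⊎ W → Set) → (∀ e s → P (lab vert (e , s)) → P (lab vert (e , not s))) → ∀ u v → P u → P v
  open PlaneMap

  module Substitute {K : ℕ} {W : Set} {flip : W → W} {LVB LFB : Set} (B : PlaneMap flip (Fin K) LVB LFB)
    (E LV LF : Fin K → Set) (N : ∀ k → PlaneMap not (E k) (LV k) (LF k)) where

    module V = Compose (vert B) E LV (vert ∘ N)
    module F = Compose (face B) E LF (face ∘ N)

    first-dual : ∀ k t → first (face (N k)) t ≡ first (vert (N k)) t
    first-dual k t = inj₁-injective (begin
      inj₁ (first (face (N k)) t)                       ≡⟨ π-first (face (N k)) t ⟨
      π (face (N k)) (inj₂ t)                           ≡⟨ dual (N k) (inj₂ t) ⟩
      flipVirtual not (π (vert (N k)) (inj₂ t))         ≡⟨ cong (flipVirtual not) (π-first (vert (N k)) t) ⟩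
      inj₁ (first (vert (N k)) t)                       ∎)
      where open ≡-Reasoning

    enter-dual : ∀ z → F.enter (flipVirtual flip z) ≡ flipVirtual flip (V.enter z)
    enter-dual (inj₁ (k , t)) = cong (inj₁ ∘ V.tag k) (first-dual k t)
    enter-dual (inj₂ w) = refl

    -- At a virtual dart the part swaps its two ends and the base passes to the other end of edge
    -- `k`; the two reversals cancel. This is the purpose of the virtual swap in `dual`.
    exit-dual : ∀ k y → F.exit k (flipVirtual not y) ≡ flipVirtual flip (V.exit k y)
    exit-dual k (inj₁ d) = refl
    exit-dual k (inj₂ t) = begin
      F.enter (π (face B) (inj₁ (k , not t)))                              ≡⟨ cong F.enter (dual B (inj₁ (k , not t))) ⟩
      F.enter (flipVirtual flip (π (vert B) (inj₁ (k , not (not t)))))     ≡⟨ enter-dual (π (vert B) (inj₁ (k , not (not t)))) ⟩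
      flipVirtual flip (V.enter (π (vert B) (inj₁ (k , not (not t)))))     ≡⟨ cong (λ s → flipVirtual flip (V.enter (π (vert B) (inj₁ (k , s))))) (Boolₚ.not-involutive t) ⟩
      flipVirtual flip (V.enter (π (vert B) (inj₁ (k , t))))               ∎
      where open ≡-Reasoning

    dual* : ∀ x → F.π* x ≡ flipVirtual flip (V.π* (flipReal x))
    dual* (inj₁ ((k , e) , s)) = trans (cong (F.exit k) (dual (N k) (inj₁ (e , s)))) (exit-dual k (π (vert (N k)) (inj₁ (e , not s))))
    dual* (inj₂ w) = trans (cong F.enter (dual B (inj₂ w))) (enter-dual (π (vert B) (inj₂ w)))

    -- The two terminals of a part stay distinct because edge `k` of the base is not a loop.
    emb-injective : ∀ k {x y} → V.emb k x ≡ V.emb k y → x ≡ y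
    emb-injective k {inj₁ _} {inj₁ _} refl = refl
    emb-injective k {inj₁ _} {inj₂ _} eq = contradiction eq V.internal≢base
    emb-injective k {inj₂ _} {inj₁ _} eq = contradiction (sym eq) V.internal≢base
    emb-injective k {inj₂ true} {inj₂ true} eq = refl
    emb-injective k {inj₂ true} {inj₂ false} eq = contradiction (V.base-injective eq) (noLoop B k)
    emb-injective k {inj₂ false} {inj₂ true} eq = contradiction (V.base-injective (sym eq)) (noLoop B k)
    emb-injective k {inj₂ false} {inj₂ false} eq = refl

    -- Connectivity is phrased as induction over predicates closed along edges. Restricted to a
    -- part, `P` passes between all its vertices, in particular between its terminals, and so
    -- becomes closed along the edges of the base.
    linked* : ∀ (P : V.L* ⊎ W → Set) → (∀ e s → P (V.lab* (e , s)) → P (V.lab* (e , not s))) → ∀ u v → P u → P v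
    linked* P closed u v = fromBase v ∘ linked B (P ∘ V.base) (λ k s → within k (inj₂ s) (inj₂ (not s))) (anchor u) (anchor v) ∘ toBase u
      where
      within : ∀ k x y → P (V.emb k x) → P (V.emb k y)
      within k = linked (N k) (P ∘ V.emb k) (λ e s → closed (k , e) s)
      anchor : V.L* ⊎ W → LVB ⊎ W
      anchor (inj₁ (inj₁ l)) = inj₁ l
      anchor (inj₁ (inj₂ (k , l))) = lab (vert B) (k , true)
      anchor (inj₂ w) = inj₂ w
      toBase : ∀ u → P u → P (V.base (anchor u))
      toBase (inj₁ (inj₁ l)) p = p
      toBase (inj₁ (inj₂ (k , l))) p = within k (inj₁ l) (inj₂ true) p
      toBase (inj₂ w) p = p
      fromBase : ∀ u → P (V.base (anchor u)) → P u
      fromBase (inj₁ (inj₁ l)) p = p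
      fromBase (inj₁ (inj₂ (k , l))) p = within k (inj₂ true) (inj₁ l) p
      fromBase (inj₂ w) p = p

    substitute : PlaneMap flip (Σ (Fin K) E) (LVB ⊎ Σ (Fin K) LV) (LFB ⊎ Σ (Fin K) LF)
    substitute = record
      { vert = V.compose
      ; face = F.compose
      ; dual = dual*
      ; noLoop = λ (k , e) eq → noLoop (N k) e (emb-injective k eq)
      ; linked = linked*
      }

  orbit-sym : ∀ {A : Set} {f : A → A} → (∀ x → Orbit f (f x) x) → ∀ {x y} → Orbit f x y → Orbit f y x
  orbit-sym return stay = stay
  orbit-sym return (step {x} p) = orbit-sym return p ▸ return x

  -- For an explicit map it is enough to lead every dart to a representative of its label, because
  -- every step can be undone by further steps.
  connect : ∀ {A B : Set} {f : A → A} (lb : A → B) (rep : B → A) → (∀ x → Orbit f (f x) x) →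
    (∀ x → Orbit f x (rep (lb x))) → ∀ x y → lb x ≡ lb y → Orbit f x y
  connect {f = f} lb rep return toRep x y eq = toRep x ▸ subst (λ b → Orbit f (rep b) y) (sym eq) (orbit-sym return (toRep y))

  edgeCycles : Cycles (Fin 1) (Fin 0) Bool
  edgeCycles = record
    { π = σ
    ; lab = inj₂ ∘ proj₂
    ; first = 0F ,_
    ; π-first = λ _ → refl
    ; invariant = λ { (inj₁ (0F , s)) → refl ; (inj₂ t) → refl }
    ; transitive = λ { (inj₁ (0F , s)) (inj₁ (0F , .s)) refl → stay
                     ; (inj₁ (0F , s)) (inj₂ .s) refl → step stay
                     ; (inj₂ t) (inj₁ (0F , .t)) refl → step stay
                     ; (inj₂ t) (inj₂ .t) refl → stay }
    ; inhabited = λ ()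
    }
    where
    σ : Dart (Fin 1) ⊎ Bool → Dart (Fin 1) ⊎ Bool
    σ (inj₁ (0F , s)) = inj₂ s
    σ (inj₂ t) = inj₁ (0F , t)

  -- An edge and its virtual edge form a digon on the sphere, which is self-dual; one set of cycles
  -- serves vertices and faces.
  edgeMap : PlaneMap not (Fin 1) (Fin 0) (Fin 0)
  edgeMap = record
    { vert = edgeCycles
    ; face = edgeCycles
    ; dual = λ { (inj₁ (0F , s)) → cong inj₂ (sym (Boolₚ.not-involutive s)) ; (inj₂ t) → refl }
    ; noLoop = λ _ ()
    ; linked = λ { P closed (inj₂ true) (inj₂ true) → id
                 ; P closed (inj₂ true) (inj₂ false) → closed 0F true
                 ; P closed (inj₂ false) (inj₂ true) → closed 0F false
                 ; P closed (inj₂ false) (inj₂ false) → id }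
    }

  -- Edge 0 joins the terminal true to the middle vertex, edge 1 joins it to the terminal false.
  pathCycles : Cycles (Fin 2) (Fin 1) Bool
  pathCycles = record
    { π = σ
    ; lab = lb
    ; first = λ { true → 0F , true ; false → 1F , false }
    ; π-first = λ { true → refl ; false → refl }
    ; invariant = λ { (inj₁ (0F , true)) → refl ; (inj₁ (0F , false)) → refl ; (inj₁ (1F , true)) → refl
                    ; (inj₁ (1F , false)) → refl ; (inj₂ true) → refl ; (inj₂ false) → refl }
    ; transitive = connect [ lb , inj₂ ] rep return toRep
    ; inhabited = λ { 0F → (0F , false) , refl }
    }
    where
    σ : Dart (Fin 2) ⊎ Bool → Dart (Fin 2) ⊎ Bool
    σ (inj₁ (0F , true)) = inj₂ true
    σ (inj₂ true) = inj₁ (0F , true)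
    σ (inj₁ (0F , false)) = inj₁ (1F , true)
    σ (inj₁ (1F , true)) = inj₁ (0F , false)
    σ (inj₁ (1F , false)) = inj₂ false
    σ (inj₂ false) = inj₁ (1F , false)
    lb : Dart (Fin 2) → Fin 1 ⊎ Bool
    lb (0F , true) = inj₂ true
    lb (0F , false) = inj₁ 0F
    lb (1F , true) = inj₁ 0F
    lb (1F , false) = inj₂ false
    rep : Fin 1 ⊎ Bool → Dart (Fin 2) ⊎ Bool
    rep (inj₁ 0F) = inj₁ (0F , false)
    rep (inj₂ t) = inj₂ t
    return : ∀ x → Orbit σ (σ x) x
    return (inj₁ (0F , true)) = step stay
    return (inj₁ (0F , false)) = step stay
    return (inj₁ (1F , true)) = step stay
    return (inj₁ (1F , false)) = step stay
    return (inj₂ true) = step stay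
    return (inj₂ false) = step stay
    toRep : ∀ x → Orbit σ x (rep ([ lb , inj₂ ] x))
    toRep (inj₁ (0F , true)) = step stay
    toRep (inj₁ (0F , false)) = stay
    toRep (inj₁ (1F , true)) = step stay
    toRep (inj₁ (1F , false)) = step stay
    toRep (inj₂ true) = stay
    toRep (inj₂ false) = stay

  bondCycles : Cycles (Fin 2) (Fin 0) Bool
  bondCycles = record
    { π = σ
    ; lab = inj₂ ∘ proj₂
    ; first = λ { true → 0F , true ; false → 1F , false }
    ; π-first = λ { true → refl ; false → refl }
    ; invariant = λ { (inj₁ (0F , true)) → refl ; (inj₁ (0F , false)) → refl ; (inj₁ (1F , true)) → refl
                    ; (inj₁ (1F , false)) → refl ; (inj₂ true) → refl ; (inj₂ false) → refl }
    ; transitive = connect [ inj₂ ∘ proj₂ , inj₂ ] rep return toRep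
    ; inhabited = λ ()
    }
    where
    σ : Dart (Fin 2) ⊎ Bool → Dart (Fin 2) ⊎ Bool
    σ (inj₂ true) = inj₁ (0F , true)
    σ (inj₁ (0F , true)) = inj₁ (1F , true)
    σ (inj₁ (1F , true)) = inj₂ true
    σ (inj₂ false) = inj₁ (1F , false)
    σ (inj₁ (1F , false)) = inj₁ (0F , false)
    σ (inj₁ (0F , false)) = inj₂ false
    rep : Fin 0 ⊎ Bool → Dart (Fin 2) ⊎ Bool
    rep (inj₂ t) = inj₂ t
    return : ∀ x → Orbit σ (σ x) x
    return (inj₁ (0F , true)) = step (step stay)
    return (inj₁ (0F , false)) = step (step stay)
    return (inj₁ (1F , true)) = step (step stay)
    return (inj₁ (1F , false)) = step (step stay)
    return (inj₂ true) = step (step stay)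
    return (inj₂ false) = step (step stay)
    toRep : ∀ x → Orbit σ x (rep ([ inj₂ ∘ proj₂ , inj₂ ] x))
    toRep (inj₁ (0F , true)) = step (step stay)
    toRep (inj₁ (0F , false)) = step stay
    toRep (inj₁ (1F , true)) = step stay
    toRep (inj₁ (1F , false)) = step (step stay)
    toRep (inj₂ true) = stay
    toRep (inj₂ false) = stay

  pathMap : PlaneMap not (Fin 2) (Fin 1) (Fin 0)
  pathMap = record
    { vert = pathCycles
    ; face = bondCycles
    ; dual = λ { (inj₁ (0F , true)) → refl ; (inj₁ (0F , false)) → refl ; (inj₁ (1F , true)) → refl
               ; (inj₁ (1F , false)) → refl ; (inj₂ true) → refl ; (inj₂ false) → refl }
    ; noLoop = λ { 0F () ; 1F () }
    ; linked = λ P closed u v → from P closed v ∘ to P closed u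
    }
    where
    to : ∀ P → (∀ e s → P (lab pathCycles (e , s)) → P (lab pathCycles (e , not s))) → ∀ u → P u → P (inj₁ 0F)
    to P closed (inj₁ 0F) = id
    to P closed (inj₂ true) = closed 0F true
    to P closed (inj₂ false) = closed 1F false
    from : ∀ P → (∀ e s → P (lab pathCycles (e , s)) → P (lab pathCycles (e , not s))) → ∀ u → P (inj₁ 0F) → P u
    from P closed (inj₁ 0F) = id
    from P closed (inj₂ true) = closed 0F false
    from P closed (inj₂ false) = closed 1F true

  -- The planar dual of the path: vertex and face cycles are exchanged.
  bondMap : PlaneMap not (Fin 2) (Fin 0) (Fin 1)
  bondMap = record
    { vert = bondCycles
    ; face = pathCycles
    ; dual = λ { (inj₁ (0F , true)) → refl ; (inj₁ (0F , false)) → refl ; (inj₁ (1F , true)) → refl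
               ; (inj₁ (1F , false)) → refl ; (inj₂ true) → refl ; (inj₂ false) → refl }
    ; noLoop = λ _ ()
    ; linked = λ { P closed (inj₂ true) (inj₂ true) → id
                 ; P closed (inj₂ true) (inj₂ false) → closed 0F true
                 ; P closed (inj₂ false) (inj₂ true) → closed 0F false
                 ; P closed (inj₂ false) (inj₂ false) → id }
    }

  pattern T = true
  pattern F = false

  -- The Wheatstone bridge with terminals x = true, g = false and inner vertices s = 0, z = 1:
  -- edges 0 = xs, 1 = xz, 2 = zg, 3 = sz, 4 = sg, each directed from its end true to its end false.
  bridgeVert : Cycles (Fin 5) (Fin 2) Bool
  bridgeVert = record
    { π = σ
    ; lab = lb
    ; first = λ { T → 0F , T ; F → 2F , F }
    ; π-first = λ { T → refl ; F → refl }
    ; invariant = λ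
        { (inj₁ (0F , T)) → refl ; (inj₁ (1F , T)) → refl ; (inj₁ (2F , T)) → refl ; (inj₁ (3F , T)) → refl ; (inj₁ (4F , T)) → refl
        ; (inj₁ (0F , F)) → refl ; (inj₁ (1F , F)) → refl ; (inj₁ (2F , F)) → refl ; (inj₁ (3F , F)) → refl ; (inj₁ (4F , F)) → refl
        ; (inj₂ T) → refl ; (inj₂ F) → refl }
    ; transitive = connect [ lb , inj₂ ] rep return toRep
    ; inhabited = λ { 0F → (4F , T) , refl ; 1F → (1F , F) , refl }
    }
    where
    σ : Dart (Fin 5) ⊎ Bool → Dart (Fin 5) ⊎ Bool
    σ (inj₂ T) = inj₁ (0F , T)
    σ (inj₁ (0F , T)) = inj₁ (1F , T)
    σ (inj₁ (1F , T)) = inj₂ T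
    σ (inj₂ F) = inj₁ (2F , F)
    σ (inj₁ (2F , F)) = inj₁ (4F , F)
    σ (inj₁ (4F , F)) = inj₂ F
    σ (inj₁ (4F , T)) = inj₁ (3F , T)
    σ (inj₁ (3F , T)) = inj₁ (0F , F)
    σ (inj₁ (0F , F)) = inj₁ (4F , T)
    σ (inj₁ (1F , F)) = inj₁ (3F , F)
    σ (inj₁ (3F , F)) = inj₁ (2F , T)
    σ (inj₁ (2F , T)) = inj₁ (1F , F)
    lb : Dart (Fin 5) → Fin 2 ⊎ Bool
    lb (0F , T) = inj₂ T
    lb (1F , T) = inj₂ T
    lb (2F , F) = inj₂ F
    lb (4F , F) = inj₂ F
    lb (4F , T) = inj₁ 0F
    lb (3F , T) = inj₁ 0F
    lb (0F , F) = inj₁ 0F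
    lb (1F , F) = inj₁ 1F
    lb (3F , F) = inj₁ 1F
    lb (2F , T) = inj₁ 1F
    rep : Fin 2 ⊎ Bool → Dart (Fin 5) ⊎ Bool
    rep (inj₁ 0F) = inj₁ (4F , T)
    rep (inj₁ 1F) = inj₁ (1F , F)
    rep (inj₂ t) = inj₂ t
    return : ∀ x → Orbit σ (σ x) x
    return (inj₁ (0F , T)) = step (step stay)
    return (inj₁ (1F , T)) = step (step stay)
    return (inj₁ (2F , T)) = step (step stay)
    return (inj₁ (3F , T)) = step (step stay)
    return (inj₁ (4F , T)) = step (step stay)
    return (inj₁ (0F , F)) = step (step stay)
    return (inj₁ (1F , F)) = step (step stay)
    return (inj₁ (2F , F)) = step (step stay)
    return (inj₁ (3F , F)) = step (step stay)
    return (inj₁ (4F , F)) = step (step stay)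
    return (inj₂ T) = step (step stay)
    return (inj₂ F) = step (step stay)
    toRep : ∀ x → Orbit σ x (rep ([ lb , inj₂ ] x))
    toRep (inj₂ T) = stay
    toRep (inj₁ (0F , T)) = step (step stay)
    toRep (inj₁ (1F , T)) = step stay
    toRep (inj₂ F) = stay
    toRep (inj₁ (2F , F)) = step (step stay)
    toRep (inj₁ (4F , F)) = step stay
    toRep (inj₁ (4F , T)) = stay
    toRep (inj₁ (3F , T)) = step (step stay)
    toRep (inj₁ (0F , F)) = step stay
    toRep (inj₁ (1F , F)) = stay
    toRep (inj₁ (3F , F)) = step (step stay)
    toRep (inj₁ (2F , T)) = step stay

  -- Closed by its virtual edge the bridge is K4, which is self-dual. The duality exchanges edges 1
  -- and 4 and reverses edge 3, and turns these cycles into those of `bridgeVert`.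
  bridgeFace : Cycles (Fin 5) (Fin 2) Bool
  bridgeFace = record
    { π = σ
    ; lab = lb
    ; first = λ { T → 0F , T ; F → 2F , F }
    ; π-first = λ { T → refl ; F → refl }
    ; invariant = λ
        { (inj₁ (0F , T)) → refl ; (inj₁ (1F , T)) → refl ; (inj₁ (2F , T)) → refl ; (inj₁ (3F , T)) → refl ; (inj₁ (4F , T)) → refl
        ; (inj₁ (0F , F)) → refl ; (inj₁ (1F , F)) → refl ; (inj₁ (2F , F)) → refl ; (inj₁ (3F , F)) → refl ; (inj₁ (4F , F)) → refl
        ; (inj₂ T) → refl ; (inj₂ F) → refl }
    ; transitive = connect [ lb , inj₂ ] rep return toRep
    ; inhabited = λ { 0F → (0F , F) , refl ; 1F → (2F , T) , refl }
    }
    where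
    σ : Dart (Fin 5) ⊎ Bool → Dart (Fin 5) ⊎ Bool
    σ (inj₂ T) = inj₁ (0F , T)
    σ (inj₁ (0F , T)) = inj₁ (4F , T)
    σ (inj₁ (4F , T)) = inj₂ T
    σ (inj₂ F) = inj₁ (2F , F)
    σ (inj₁ (2F , F)) = inj₁ (1F , F)
    σ (inj₁ (1F , F)) = inj₂ F
    σ (inj₁ (0F , F)) = inj₁ (1F , T)
    σ (inj₁ (1F , T)) = inj₁ (3F , F)
    σ (inj₁ (3F , F)) = inj₁ (0F , F)
    σ (inj₁ (2F , T)) = inj₁ (4F , F)
    σ (inj₁ (4F , F)) = inj₁ (3F , T)
    σ (inj₁ (3F , T)) = inj₁ (2F , T)
    lb : Dart (Fin 5) → Fin 2 ⊎ Bool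
    lb (0F , T) = inj₂ T
    lb (4F , T) = inj₂ T
    lb (2F , F) = inj₂ F
    lb (1F , F) = inj₂ F
    lb (0F , F) = inj₁ 0F
    lb (1F , T) = inj₁ 0F
    lb (3F , F) = inj₁ 0F
    lb (2F , T) = inj₁ 1F
    lb (4F , F) = inj₁ 1F
    lb (3F , T) = inj₁ 1F
    rep : Fin 2 ⊎ Bool → Dart (Fin 5) ⊎ Bool
    rep (inj₁ 0F) = inj₁ (0F , F)
    rep (inj₁ 1F) = inj₁ (2F , T)
    rep (inj₂ t) = inj₂ t
    return : ∀ x → Orbit σ (σ x) x
    return (inj₁ (0F , T)) = step (step stay)
    return (inj₁ (1F , T)) = step (step stay)
    return (inj₁ (2F , T)) = step (step stay)
    return (inj₁ (3F , T)) = step (step stay)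
    return (inj₁ (4F , T)) = step (step stay)
    return (inj₁ (0F , F)) = step (step stay)
    return (inj₁ (1F , F)) = step (step stay)
    return (inj₁ (2F , F)) = step (step stay)
    return (inj₁ (3F , F)) = step (step stay)
    return (inj₁ (4F , F)) = step (step stay)
    return (inj₂ T) = step (step stay)
    return (inj₂ F) = step (step stay)
    toRep : ∀ x → Orbit σ x (rep ([ lb , inj₂ ] x))
    toRep (inj₂ T) = stay
    toRep (inj₁ (0F , T)) = step (step stay)
    toRep (inj₁ (4F , T)) = step stay
    toRep (inj₂ F) = stay
    toRep (inj₁ (2F , F)) = step (step stay)
    toRep (inj₁ (1F , F)) = step stay
    toRep (inj₁ (0F , F)) = stay
    toRep (inj₁ (1F , T)) = step (step stay)
    toRep (inj₁ (3F , F)) = step stay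
    toRep (inj₁ (2F , T)) = stay
    toRep (inj₁ (4F , F)) = step (step stay)
    toRep (inj₁ (3F , T)) = step stay

  bridgeMap : PlaneMap not (Fin 5) (Fin 2) (Fin 2)
  bridgeMap = record
    { vert = bridgeVert
    ; face = bridgeFace
    ; dual = λ
        { (inj₁ (0F , T)) → refl ; (inj₁ (1F , T)) → refl ; (inj₁ (2F , T)) → refl ; (inj₁ (3F , T)) → refl ; (inj₁ (4F , T)) → refl
        ; (inj₁ (0F , F)) → refl ; (inj₁ (1F , F)) → refl ; (inj₁ (2F , F)) → refl ; (inj₁ (3F , F)) → refl ; (inj₁ (4F , F)) → refl
        ; (inj₂ T) → refl ; (inj₂ F) → refl }
    ; noLoop = λ { 0F () ; 1F () ; 2F () ; 3F () ; 4F () }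
    ; linked = λ P closed u v → from P closed v ∘ to P closed u
    }
    where
    to : ∀ P → (∀ e s → P (lab bridgeVert (e , s)) → P (lab bridgeVert (e , not s))) → ∀ u → P u → P (inj₁ 0F)
    to P closed (inj₁ 0F) = id
    to P closed (inj₁ 1F) = closed 3F F
    to P closed (inj₂ T) = closed 0F T
    to P closed (inj₂ F) = closed 4F F
    from : ∀ P → (∀ e s → P (lab bridgeVert (e , s)) → P (lab bridgeVert (e , not s))) → ∀ u → P (inj₁ 0F) → P u
    from P closed (inj₁ 0F) = id
    from P closed (inj₁ 1F) = closed 3F T
    from P closed (inj₂ T) = closed 0F F
    from P closed (inj₂ F) = closed 4F T

  -- Substituting a network for the edge of this map forgets its virtual edge.
  segmentMap : PlaneMap {⊥} id (Fin 1) Bool (Fin 1)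
  segmentMap = record
    { vert = record
        { π = id
        ; lab = inj₁ ∘ proj₂
        ; first = λ ()
        ; π-first = λ ()
        ; invariant = λ _ → refl
        ; transitive = λ { (inj₁ (0F , s)) (inj₁ (0F , .s)) refl → stay }
        ; inhabited = λ s → (0F , s) , refl
        }
    ; face = record
        { π = flipReal
        ; lab = λ _ → inj₁ 0F
        ; first = λ ()
        ; π-first = λ ()
        ; invariant = λ { (inj₁ _) → refl }
        ; transitive = λ { (inj₁ (0F , T)) (inj₁ (0F , T)) _ → stay
                         ; (inj₁ (0F , T)) (inj₁ (0F , F)) _ → step stay
                         ; (inj₁ (0F , F)) (inj₁ (0F , T)) _ → step stay
                         ; (inj₁ (0F , F)) (inj₁ (0F , F)) _ → stay }
        ; inhabited = λ { 0F → (0F , T) , refl }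
        }
    ; dual = λ { (inj₁ _) → refl }
    ; noLoop = λ _ ()
    ; linked = λ { P closed (inj₁ T) (inj₁ T) → id
                 ; P closed (inj₁ T) (inj₁ F) → closed 0F T
                 ; P closed (inj₁ F) (inj₁ T) → closed 0F F
                 ; P closed (inj₁ F) (inj₁ F) → id }
    }

-- Two-terminal networks and their weak solutions

module Networks where

  open Forms
  open Orbits
  open PlaneMaps
  open import Data.Nat as ℕ using (ℕ; zero; suc)
  import Data.Nat.Properties as ℕₚ
  import Data.Nat.Tactic.RingSolver as ℕ-Ring
  open import Data.Fin using (Fin; zero; suc; splitAt; join; _↑ˡ_; _↑ʳ_)
  open import Data.Fin.Patterns
  import Data.Fin.Properties as Finₚ
  open import Data.Bool using (Bool; true; false; not)
  open import Data.Empty using (⊥)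
  open import Data.Product
  open import Data.Sum as Sum using (_⊎_; inj₁; inj₂)
  open import Data.Integer using (ℤ; 0ℤ; _+_; _-_; _*_; -_) renaming (+_ to pos)
  import Data.Integer.Properties as ℤₚ
  open import Data.Integer.Tactic.RingSolver using (solve-∀)
  open import Algebra.Properties.Semiring.Sum ℤₚ.+-*-semiring using (sum; sum-cong-≗)
  open import Relation.Binary.PropositionalEquality hiding (J; [_])
  open import Function using (_∘_; id)
  open Cycles
  open PlaneMap

  -- Substitution produces nested sums of label sets; they have to be counted for Euler's relation
  -- and summed over for the form.
  record Enum (A : Set) : Set where
    field
      card       : ℕ
      elem       : Fin card → A
      index      : A → Fin card
      elem-index : ∀ a → elem (index a) ≡ a
      index-elem : ∀ i → index (elem i) ≡ i
  open Enum

  enumFin : ∀ k → Enum (Fin k)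
  enumFin k = record { card = k ; elem = id ; index = id ; elem-index = λ _ → refl ; index-elem = λ _ → refl }

  enum⊥ : Enum ⊥
  enum⊥ = record { card = 0 ; elem = λ () ; index = λ () ; elem-index = λ () ; index-elem = λ () }

  enumBool : Enum Bool
  enumBool = record
    { card = 2
    ; elem = λ { 0F → true ; 1F → false }
    ; index = λ { true → 0F ; false → 1F }
    ; elem-index = λ { true → refl ; false → refl }
    ; index-elem = λ { 0F → refl ; 1F → refl }
    }

  enum⊎ : ∀ {A B} → Enum A → Enum B → Enum (A ⊎ B)
  enum⊎ {A} {B} a b = record
    { card = card a ℕ.+ card b
    ; elem = Sum.map (elem a) (elem b) ∘ splitAt (card a)
    ; index = join (card a) (card b) ∘ Sum.map (index a) (index b)
    ; elem-index = λ x → trans (cong (Sum.map (elem a) (elem b)) (Finₚ.splitAt-join (card a) (card b) (Sum.map (index a) (index b) x))) (there-and-back x)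
    ; index-elem = λ i → trans (cong (join (card a) (card b)) (back-and-there (splitAt (card a) i))) (Finₚ.join-splitAt (card a) (card b) i)
    }
    where
    there-and-back : ∀ x → Sum.map (elem a) (elem b) (Sum.map (index a) (index b) x) ≡ x
    there-and-back (inj₁ x) = cong inj₁ (elem-index a x)
    there-and-back (inj₂ y) = cong inj₂ (elem-index b y)
    back-and-there : ∀ x → Sum.map (index a) (index b) (Sum.map (elem a) (elem b) x) ≡ x
    back-and-there (inj₁ i) = cong inj₁ (index-elem a i)
    back-and-there (inj₂ j) = cong inj₂ (index-elem b j)

  module _ {K : ℕ} {A : Fin (suc K) → Set} where
    consΣ : A zero ⊎ Σ (Fin K) (A ∘ suc) → Σ (Fin (suc K)) A
    consΣ (inj₁ x) = zero , x
    consΣ (inj₂ (k , x)) = suc k , x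

    unconsΣ : Σ (Fin (suc K)) A → A zero ⊎ Σ (Fin K) (A ∘ suc)
    unconsΣ (zero , x) = inj₁ x
    unconsΣ (suc k , x) = inj₂ (k , x)

    cons-uncons : ∀ x → consΣ (unconsΣ x) ≡ x
    cons-uncons (zero , x) = refl
    cons-uncons (suc k , x) = refl

    uncons-cons : ∀ x → unconsΣ (consΣ x) ≡ x
    uncons-cons (inj₁ x) = refl
    uncons-cons (inj₂ (k , x)) = refl

  enumΣ : ∀ {K} {A : Fin K → Set} → (∀ k → Enum (A k)) → Enum (Σ (Fin K) A)
  enumΣ {zero} en = record { card = 0 ; elem = λ () ; index = λ () ; elem-index = λ () ; index-elem = λ () }
  enumΣ {suc K} {A} en = record
    { card = card both
    ; elem = consΣ ∘ elem both
    ; index = index both ∘ unconsΣ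
    ; elem-index = λ x → trans (cong consΣ (elem-index both (unconsΣ x))) (cons-uncons x)
    ; index-elem = λ i → trans (cong (index both) (uncons-cons {A = A} (elem both i))) (index-elem both i)
    }
    where
    both = enum⊎ (en zero) (enumΣ (en ∘ suc))

  sumOver : ∀ {A} → Enum A → (A → ℤ) → ℤ
  sumOver en f = sum (f ∘ elem en)

  sum-++ : ∀ m {n} (f : Fin (m ℕ.+ n) → ℤ) → sum f ≡ sum (λ i → f (i ↑ˡ n)) + sum (λ j → f (m ↑ʳ j))
  sum-++ zero f = sym (ℤₚ.+-identityˡ (sum f))
  sum-++ (suc m) {n} f = trans (cong (f zero +_) (sum-++ m (f ∘ suc)))
    (sym (ℤₚ.+-assoc (f zero) (sum (λ i → f (suc i ↑ˡ n))) (sum (λ j → f (suc m ↑ʳ j)))))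

  sumOver-⊎ : ∀ {A B} (a : Enum A) (b : Enum B) f → sumOver (enum⊎ a b) f ≡ sumOver a (f ∘ inj₁) + sumOver b (f ∘ inj₂)
  sumOver-⊎ a b f = trans (sum-++ (card a) (f ∘ elem (enum⊎ a b))) (cong₂ _+_
    (sum-cong-≗ λ i → cong (f ∘ Sum.map (elem a) (elem b)) (Finₚ.splitAt-↑ˡ (card a) i (card b)))
    (sum-cong-≗ λ j → cong (f ∘ Sum.map (elem a) (elem b)) (Finₚ.splitAt-↑ʳ (card a) (card b) j)))

  sumOver-Σ : ∀ {K} {A : Fin K → Set} (en : ∀ k → Enum (A k)) f → sumOver (enumΣ en) f ≡ sum (λ k → sumOver (en k) (λ x → f (k , x)))
  sumOver-Σ {zero} en f = refl
  sumOver-Σ {suc K} en f = trans (sumOver-⊎ (en zero) (enumΣ (en ∘ suc)) (f ∘ consΣ))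
    (cong (sumOver (en zero) (λ x → f (zero , x)) +_) (sumOver-Σ (en ∘ suc) (λ (k , x) → f (suc k , x))))

  module _ {E L W : Set} (en : Enum E) (c : Cycles E L W) where
    ends* : E → (L ⊎ W) × (L ⊎ W)
    ends* e = lab c (e , true) , lab c (e , false)

    power : (L ⊎ W → ℤ) → (L ⊎ W → ℤ) → ℤ
    power f φ = form (ends* ∘ elem en) f φ

  module Superpose {K : ℕ} {W LB : Set} (B : Cycles (Fin K) LB W) (E L : Fin K → Set)
    (N : ∀ k → Cycles (E k) (L k) Bool) (en : ∀ k → Enum (E k))
    (ψ : LB ⊎ W → ℤ) (I : Fin K → ℤ) (φ : ∀ k → L k ⊎ Bool → ℤ)
    (at-true : ∀ k → φ k (inj₂ true) ≡ ψ (lab B (k , true)) - ψ (lab B (k , false)))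
    (at-false : ∀ k → φ k (inj₂ false) ≡ 0ℤ)
    (weak : ∀ k f → power (en k) (N k) f (φ k) ≡ I k * (f (inj₂ true) - f (inj₂ false))) where

    open Compose B E L N

    φ* : L* ⊎ W → ℤ
    φ* (inj₁ (inj₁ l)) = ψ (inj₁ l)
    φ* (inj₁ (inj₂ (k , l))) = φ k (inj₁ l) + ψ (lab B (k , false))
    φ* (inj₂ w) = ψ (inj₂ w)

    φ*-base : ∀ y → φ* (base y) ≡ ψ y
    φ*-base (inj₁ _) = refl
    φ*-base (inj₂ _) = refl

    φ*-emb : ∀ k x → φ* (emb k x) ≡ φ k x + ψ (lab B (k , false))
    φ*-emb k (inj₁ l) = refl
    φ*-emb k (inj₂ true) = trans (φ*-base (lab B (k , true))) (trans (ring (ψ (lab B (k , true))) (ψ (lab B (k , false)))) (cong (_+ ψ (lab B (k , false))) (sym (at-true k))))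
      where
      ring : ∀ x y → x ≡ (x - y) + y
      ring = solve-∀
    φ*-emb k (inj₂ false) = trans (φ*-base (lab B (k , false))) (trans (sym (ℤₚ.+-identityˡ (ψ (lab B (k , false))))) (cong (_+ ψ (lab B (k , false))) (sym (at-false k))))

    -- Shifting the potential of a part by a constant keeps its differences, and by `weak` a test
    -- function sees the part only through its terminals. To the base, part `k` is therefore an edge
    -- carrying the current `I k`.
    weak* : ∀ f → power (enumΣ en) compose f φ* ≡ sum (λ k → I k * (f (base (lab B (k , true))) - f (base (lab B (k , false)))))
    weak* f = trans (sumOver-Σ en (λ e → diff f (ends* (enumΣ en) compose e) * diff φ* (ends* (enumΣ en) compose e)))
      (sum-cong-≗ λ k → trans (sum-cong-≗ λ i → cong (diff f (ends* (enumΣ en) compose (k , elem (en k) i)) *_) (local k (elem (en k) i))) (weak k (f ∘ emb k)))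
      where
      ring : ∀ x y c → (x + c) - (y + c) ≡ x - y
      ring = solve-∀
      local : ∀ k e → diff φ* (ends* (enumΣ en) compose (k , e)) ≡ diff (φ k) (ends* (en k) (N k) e)
      local k e = trans (cong₂ _-_ (φ*-emb k (lab (N k) (e , true))) (φ*-emb k (lab (N k) (e , false))))
        (ring (φ k (lab (N k) (e , true))) (φ k (lab (N k) (e , false))) (ψ (lab B (k , false))))

  -- `LV` and `LF` omit the two terminals and the two faces along the virtual edge, so V - E + F = 2
  -- reads (v + 2) - (e + 1) + (f + 2) = 2, which is `euler`.
  record Net : Set₁ where
    no-eta-equality
    field
      E LV LF : Set
      enE     : Enum E
      enV     : Enum LV
      enF     : Enum LF
      plane   : PlaneMap not E LV LF
      euler   : card enV ℕ.+ card enF ℕ.+ 1 ≡ card enE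

    size : ℕ
    size = card enE
  open Net

  -- Quantifying over all test functions states Kirchhoff's law at the inner vertices and the
  -- current `I` at both terminals in one identity. No signs are imposed on `V` and `I`.
  record Solution (N : Net) (V I : ℤ) : Set where
    field
      φ        : LV N ⊎ Bool → ℤ
      at-true  : φ (inj₂ true) ≡ V
      at-false : φ (inj₂ false) ≡ 0ℤ
      weak     : ∀ f → power (enE N) (vert (plane N)) f φ ≡ I * (f (inj₂ true) - f (inj₂ false))
  open Solution

  scale : ∀ {N V I} c → Solution N V I → Solution N (c * V) (c * I)
  scale {N} {V} {I} c s = record
    { φ = λ x → c * φ s x
    ; at-true = cong (c *_) (at-true s)
    ; at-false = trans (cong (c *_) (at-false s)) (ℤₚ.*-zeroʳ c)
    ; weak = λ f → trans (form-*ʳ (ends* (enE N) (vert (plane N)) ∘ elem (enE N)) f c (φ s)) (trans (cong (c *_) (weak s f)) (sym (ℤₚ.*-assoc c I _)))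
    }

  -- The `K` units collected from the parts are what the Euler relation of the base supplies.
  enumΣ-euler : ∀ {K} {A B C : Fin K → Set} (a : ∀ k → Enum (A k)) (b : ∀ k → Enum (B k)) (c : ∀ k → Enum (C k)) →
    (∀ k → card (a k) ℕ.+ card (b k) ℕ.+ 1 ≡ card (c k)) → card (enumΣ a) ℕ.+ card (enumΣ b) ℕ.+ K ≡ card (enumΣ c)
  enumΣ-euler {zero} a b c eq = refl
  enumΣ-euler {suc K} a b c eq = trans (ring (card (a zero)) (card (b zero)) (card (enumΣ (a ∘ suc))) (card (enumΣ (b ∘ suc))) K)
    (cong₂ ℕ._+_ (eq zero) (enumΣ-euler (a ∘ suc) (b ∘ suc) (c ∘ suc) (eq ∘ suc)))
    where
    ring : ∀ a b a′ b′ k → a ℕ.+ a′ ℕ.+ (b ℕ.+ b′) ℕ.+ suc k ≡ (a ℕ.+ b ℕ.+ 1) ℕ.+ (a′ ℕ.+ b′ ℕ.+ k)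
    ring = ℕ-Ring.solve-∀

  module _ {K v f : ℕ} (B : PlaneMap not (Fin K) (Fin v) (Fin f)) (eulerB : v ℕ.+ f ℕ.+ 1 ≡ K) (N : Fin K → Net) where

    substNet : Net
    substNet = record
      { enE = enumΣ (enE ∘ N)
      ; enV = enum⊎ (enumFin v) (enumΣ (enV ∘ N))
      ; enF = enum⊎ (enumFin f) (enumΣ (enF ∘ N))
      ; plane = Substitute.substitute B (E ∘ N) (LV ∘ N) (LF ∘ N) (plane ∘ N)
      ; euler = trans (ring v f (card (enumΣ (enV ∘ N))) (card (enumΣ (enF ∘ N))))
          (trans (cong (card (enumΣ (enV ∘ N)) ℕ.+ card (enumΣ (enF ∘ N)) ℕ.+_) eulerB) (enumΣ-euler (enV ∘ N) (enF ∘ N) (enE ∘ N) (euler ∘ N)))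
      }
      where
      ring : ∀ v f v′ f′ → (v ℕ.+ v′) ℕ.+ (f ℕ.+ f′) ℕ.+ 1 ≡ v′ ℕ.+ f′ ℕ.+ (v ℕ.+ f ℕ.+ 1)
      ring = ℕ-Ring.solve-∀

    substSolution : ∀ (ψ : Fin v ⊎ Bool → ℤ) (I : Fin K → ℤ) → ψ (inj₂ false) ≡ 0ℤ →
      (∀ k → Solution (N k) (ψ (lab (vert B) (k , true)) - ψ (lab (vert B) (k , false))) (I k)) → ∀ I* →
      (∀ (f : Fin v ⊎ Bool → ℤ) → sum (λ k → I k * (f (lab (vert B) (k , true)) - f (lab (vert B) (k , false)))) ≡ I* * (f (inj₂ true) - f (inj₂ false))) →
      Solution substNet (ψ (inj₂ true)) I*
    substSolution ψ I ψ-false sol I* kirchhoff = record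
      { φ = S.φ*
      ; at-true = refl
      ; at-false = ψ-false
      ; weak = λ f → trans (S.weak* f) (kirchhoff (f ∘ base))
      }
      where
      module S = Superpose (vert B) (E ∘ N) (LV ∘ N) (vert ∘ plane ∘ N) (enE ∘ N) ψ I (φ ∘ sol) (at-true ∘ sol) (at-false ∘ sol) (weak ∘ sol)
      open Compose (vert B) (E ∘ N) (LV ∘ N) (vert ∘ plane ∘ N) using (base)

  edge : Net
  edge = record { E = Fin 1 ; LV = Fin 0 ; LF = Fin 0 ; enE = enumFin 1 ; enV = enumFin 0 ; enF = enumFin 0 ; plane = edgeMap ; euler = refl }

  pair : Net → Fin 2 → Net
  pair N 0F = edge
  pair N 1F = N

  series parallel : Net → Net
  series N = substNet pathMap refl (pair N)
  parallel N = substNet bondMap refl (pair N)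

  bridgeParts : Net → Net → Fin 5 → Net
  bridgeParts M N 0F = edge
  bridgeParts M N 1F = edge
  bridgeParts M N 2F = edge
  bridgeParts M N 3F = M
  bridgeParts M N 4F = N

  bridge : Net → Net → Net
  bridge M N = substNet bridgeMap refl (bridgeParts M N)

  solution-cast : ∀ {N V V′ I I′} → V ≡ V′ → I ≡ I′ → Solution N V I → Solution N V′ I′
  solution-cast refl refl s = s

  edge-solution : ∀ c → Solution edge c c
  edge-solution c = record
    { φ = λ { (inj₂ true) → c ; (inj₂ false) → 0ℤ }
    ; at-true = refl
    ; at-false = refl
    ; weak = λ f → ring (f (inj₂ true)) (f (inj₂ false)) c
    }
    where
    ring : ∀ x y c → (x - y) * (c - 0ℤ) + 0ℤ ≡ c * (x - y)
    ring = solve-∀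

  series-solution : ∀ {N V I} → Solution N V I → Solution (series N) (V + I) I
  series-solution {N} {V} {I} s = substSolution pathMap refl (pair N) ψ (λ _ → I) refl
    (λ { 0F → solution-cast (ring₀ V I) refl (edge-solution I) ; 1F → solution-cast (ring₁ V) refl s }) I
    (λ f → kirchhoff (f (inj₂ true)) (f (inj₁ 0F)) (f (inj₂ false)) I)
    where
    ψ : Fin 1 ⊎ Bool → ℤ
    ψ (inj₁ 0F) = V
    ψ (inj₂ true) = V + I
    ψ (inj₂ false) = 0ℤ
    ring₀ : ∀ v i → i ≡ (v + i) - v
    ring₀ = solve-∀
    ring₁ : ∀ v → v ≡ v - 0ℤ
    ring₁ = solve-∀
    kirchhoff : ∀ a m b i → i * (a - m) + (i * (m - b) + 0ℤ) ≡ i * (a - b)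
    kirchhoff = solve-∀

  parallel-solution : ∀ {N V I} → Solution N V I → Solution (parallel N) V (V + I)
  parallel-solution {N} {V} {I} s = substSolution bondMap refl (pair N) ψ (λ { 0F → V ; 1F → I }) refl
    (λ { 0F → solution-cast (ring V) refl (edge-solution V) ; 1F → solution-cast (ring V) refl s }) (V + I)
    (λ f → kirchhoff (f (inj₂ true)) (f (inj₂ false)) V I)
    where
    ψ : Fin 0 ⊎ Bool → ℤ
    ψ (inj₂ true) = V
    ψ (inj₂ false) = 0ℤ
    ring : ∀ v → v ≡ v - 0ℤ
    ring = solve-∀
    kirchhoff : ∀ a b v i → v * (a - b) + (i * (a - b) + 0ℤ) ≡ (v + i) * (a - b)
    kirchhoff = solve-∀

  -- Given drop v and current i in the bridging part and current y in the fourth arm, Ohm's law in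
  -- the three unit arms determines the potential of z as y + v + 2 i and everything else. With v +
  -- i = 1 and i = c the fourth arm is 1 + 2 / y and the whole is 1 + 1 / (2 y + 1 + c).
  bridge-solution : ∀ {M N} v i y → Solution M v i → Solution N (y + pos 2 * (v + i)) y →
    Solution (bridge M N) (pos 2 * y + pos 2 * v + pos 3 * i) (pos 2 * y + v + pos 2 * i)
  bridge-solution {M} {N} v i y sM sN = substSolution bridgeMap refl (bridgeParts M N) ψ current refl
    (λ { 0F → solution-cast (ring₀ v i y) refl (edge-solution (y + i))
       ; 1F → solution-cast (ring₁ v i y) refl (edge-solution (y + i + v))
       ; 2F → solution-cast (ring₂ v i y) refl (edge-solution (y + v + pos 2 * i))
       ; 3F → solution-cast (ring₃ v i y) refl sM
       ; 4F → solution-cast (ring₄ v i y) refl sN })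
    (pos 2 * y + v + pos 2 * i)
    (λ f → kirchhoff (f (inj₂ true)) (f (inj₁ 0F)) (f (inj₁ 1F)) (f (inj₂ false)) v i y)
    where
    ψ : Fin 2 ⊎ Bool → ℤ
    ψ (inj₁ 0F) = y + pos 2 * (v + i)
    ψ (inj₁ 1F) = y + v + pos 2 * i
    ψ (inj₂ true) = pos 2 * y + pos 2 * v + pos 3 * i
    ψ (inj₂ false) = 0ℤ
    current : Fin 5 → ℤ
    current 0F = y + i
    current 1F = y + i + v
    current 2F = y + v + pos 2 * i
    current 3F = i
    current 4F = y
    ring₀ : ∀ v i y → y + i ≡ (pos 2 * y + pos 2 * v + pos 3 * i) - (y + pos 2 * (v + i))
    ring₀ = solve-∀
    ring₁ : ∀ v i y → y + i + v ≡ (pos 2 * y + pos 2 * v + pos 3 * i) - (y + v + pos 2 * i)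
    ring₁ = solve-∀
    ring₂ : ∀ v i y → y + v + pos 2 * i ≡ (y + v + pos 2 * i) - 0ℤ
    ring₂ = solve-∀
    ring₃ : ∀ v i y → v ≡ (y + pos 2 * (v + i)) - (y + v + pos 2 * i)
    ring₃ = solve-∀
    ring₄ : ∀ v i y → y + pos 2 * (v + i) ≡ (y + pos 2 * (v + i)) - 0ℤ
    ring₄ = solve-∀
    kirchhoff : ∀ x s z g v i y → (y + i) * (x - s) + ((y + i + v) * (x - z) + ((y + v + pos 2 * i) * (z - g) + (i * (s - z) + (y * (s - g) + 0ℤ))))
      ≡ (pos 2 * y + v + pos 2 * i) * (x - g)
    kirchhoff = solve-∀

  size-series : ∀ N → size (series N) ≡ suc (size N)
  size-series N = cong suc (ℕₚ.+-identityʳ (size N))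

  size-parallel : ∀ N → size (parallel N) ≡ suc (size N)
  size-parallel N = cong suc (ℕₚ.+-identityʳ (size N))

  size-bridge : ∀ M N → size (bridge M N) ≡ 3 ℕ.+ (size M ℕ.+ size N)
  size-bridge M N = cong (λ k → 3 ℕ.+ (size M ℕ.+ k)) (ℕₚ.+-identityʳ (size N))

-- From closed networks to graphs with rotation systems

module Graphs where

  open import Defs
  open Forms
  open Orbits
  open PlaneMaps
  open Networks
  open import Data.Nat as ℕ using (ℕ; zero; suc; _≤ᵇ_; _≤_; _<_; z≤n; s≤s)
  import Data.Nat.Properties as ℕₚ
  open import Data.Nat.Induction using (<-rec)
  import Data.Nat.Tactic.RingSolver as ℕ-Ring
  open import Data.Fin using (Fin; zero; suc; toℕ; splitAt; _↑ˡ_; _↑ʳ_)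
  open import Data.Fin.Patterns
  import Data.Fin.Properties as Finₚ
  open import Data.Bool using (Bool; true; false; not; _∧_)
  import Data.Bool.Properties as Boolₚ
  open import Data.Empty using (⊥)
  open import Data.Product
  open import Data.Sum using (_⊎_; inj₁; inj₂; [_,_])
  open import Data.Integer as ℤ using (ℤ; 0ℤ; 1ℤ) renaming (+_ to pos)
  import Data.Integer.Properties as ℤₚ
  open import Data.Rational as ℚ using (ℚ; 1ℚ; _/_)
  open import Algebra.Properties.Semiring.Sum ℤₚ.+-*-semiring using (sum-cong-≗)
  open import Relation.Binary.PropositionalEquality hiding (J; [_])
  open import Relation.Nullary using (contradiction; Dec; yes; no)
  open import Function using (_∘_; id; Equivalence)
  open Cycles
  open PlaneMap hiding (noLoop)
  open Enum
  open Net
  open Solution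

  module _ {A : Set} (f : A → A) where

    iter-shift : ∀ k x → iter f k (f x) ≡ f (iter f k x)
    iter-shift zero x = refl
    iter-shift (suc k) x = cong f (iter-shift k x)

    iter-+ : ∀ i j x → iter f (i ℕ.+ j) x ≡ iter f i (iter f j x)
    iter-+ zero j x = refl
    iter-+ (suc i) j x = cong f (iter-+ i j x)

    iter-period : ∀ p c {x} → iter f p x ≡ x → iter f (c ℕ.* p) x ≡ x
    iter-period p zero eq = refl
    iter-period p (suc c) {x} eq = trans (iter-+ p (c ℕ.* p) x) (trans (cong (iter f p) (iter-period p c eq)) eq)

    -- The common image u has periods k + 1 and j + 1. Adding multiples of these periods, k + j (k +
    -- 1) = j + k (j + 1) iterations take u both to x and to y.
    cyclic⇒injective : (∀ x → ∃ λ k → iter f k (f x) ≡ x) → ∀ {x y} → f x ≡ f y → x ≡ y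
    cyclic⇒injective cyc {x} {y} fx≡fy with cyc x | cyc y
    ... | k , eqx | j , eqy = begin
      x                                     ≡⟨ eqx ⟨
      iter f k u                            ≡⟨ cong (iter f k) (iter-period (suc k) j periodₖ) ⟨
      iter f k (iter f (j ℕ.* suc k) u)     ≡⟨ iter-+ k (j ℕ.* suc k) u ⟨
      iter f (k ℕ.+ j ℕ.* suc k) u          ≡⟨ cong (λ i → iter f i u) (ring k j) ⟩
      iter f (j ℕ.+ k ℕ.* suc j) u          ≡⟨ iter-+ j (k ℕ.* suc j) u ⟩
      iter f j (iter f (k ℕ.* suc j) u)     ≡⟨ cong (iter f j) (iter-period (suc j) k periodⱼ) ⟩
      iter f j u                            ≡⟨ cong (iter f j) fx≡fy ⟩
      iter f j (f y)                        ≡⟨ eqy ⟩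
      y                                     ∎
      where
      open ≡-Reasoning
      u = f x
      periodₖ : iter f (suc k) u ≡ u
      periodₖ = cong f eqx
      periodⱼ : iter f (suc j) u ≡ u
      periodⱼ = trans (cong (iter f (suc j)) fx≡fy) (trans (cong f eqy) (sym fx≡fy))
      ring : ∀ k j → k ℕ.+ j ℕ.* suc k ≡ j ℕ.+ k ℕ.* suc j
      ring = ℕ-Ring.solve-∀

  -- `numOrbits` inspects only k iterates. Two of the first k + 1 coincide, so a later iterate can
  -- be shortened by the difference of their positions.
  iter-bounded : ∀ {k} (f : Fin k → Fin k) d i → ∃ λ j → j < k × iter f j d ≡ iter f i d
  iter-bounded {k} f d with Finₚ.pigeonhole (ℕₚ.n<1+n k) (λ i → iter f (toℕ i) d)
  ... | a , b , a<b , eq = <-rec _ reduce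
    where
    reduce : ∀ i → (∀ {j} → j < i → ∃ λ j′ → j′ < k × iter f j′ d ≡ iter f j d) → ∃ λ j → j < k × iter f j d ≡ iter f i d
    reduce i rec with i ℕₚ.<? k
    ... | yes i<k = i , i<k , refl
    ... | no i≮k = proj₁ r , proj₁ (proj₂ r) , trans (proj₂ (proj₂ r)) shortcut
      where
      b≤i : toℕ b ≤ i
      b≤i = ℕₚ.≤-trans (ℕₚ.≤-pred (Finₚ.toℕ<n b)) (ℕₚ.≮⇒≥ i≮k)
      r = rec {i ℕ.∸ toℕ b ℕ.+ toℕ a} (ℕₚ.<-≤-trans (ℕₚ.+-monoʳ-< (i ℕ.∸ toℕ b) a<b) (ℕₚ.≤-reflexive (ℕₚ.m∸n+n≡m b≤i)))
      shortcut : iter f (i ℕ.∸ toℕ b ℕ.+ toℕ a) d ≡ iter f i d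
      shortcut = begin
        iter f (i ℕ.∸ toℕ b ℕ.+ toℕ a) d          ≡⟨ iter-+ f (i ℕ.∸ toℕ b) (toℕ a) d ⟩
        iter f (i ℕ.∸ toℕ b) (iter f (toℕ a) d)   ≡⟨ cong (iter f (i ℕ.∸ toℕ b)) eq ⟩
        iter f (i ℕ.∸ toℕ b) (iter f (toℕ b) d)   ≡⟨ iter-+ f (i ℕ.∸ toℕ b) (toℕ b) d ⟨
        iter f (i ℕ.∸ toℕ b ℕ.+ toℕ b) d          ≡⟨ cong (λ j → iter f j d) (ℕₚ.m∸n+n≡m b≤i) ⟩
        iter f i d                                ∎
        where open ≡-Reasoning

  allBelow⁻ : ∀ n Q → allBelow n Q ≡ true → ∀ i → i < n → Q i ≡ true
  allBelow⁻ (suc n) Q eq i i<1+n with allBelow n Q in h | Q n in Qn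
  allBelow⁻ (suc n) Q eq i i<1+n | true | true with ℕₚ.m≤n⇒m<n∨m≡n (ℕₚ.≤-pred i<1+n)
  ... | inj₁ i<n = allBelow⁻ n Q h i i<n
  ... | inj₂ refl = Qn

  allBelow⁺ : ∀ n Q → (∀ i → i < n → Q i ≡ true) → allBelow n Q ≡ true
  allBelow⁺ zero Q all = refl
  allBelow⁺ (suc n) Q all = cong₂ _∧_ (allBelow⁺ n Q λ i i<n → all i (ℕₚ.m<n⇒m<1+n i<n)) (all n (ℕₚ.n<1+n n))

  ≤⇒≤ᵇ : ∀ {m n} → m ≤ n → (m ≤ᵇ n) ≡ true
  ≤⇒≤ᵇ m≤n = Boolₚ.T-≡ .Equivalence.to (ℕₚ.≤⇒≤ᵇ m≤n)

  ≤ᵇ⇒≤ : ∀ {m n} → (m ≤ᵇ n) ≡ true → m ≤ n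
  ≤ᵇ⇒≤ {m} {n} eq = ℕₚ.≤ᵇ⇒≤ m n (Boolₚ.T-≡ .Equivalence.from eq)

  select : ∀ {k} (P : Fin k → Bool) → Fin (countFin P) → Fin k
  select {suc k} P i with P zero
  select {suc k} P zero | true = zero
  select {suc k} P (suc i) | true = suc (select (P ∘ suc) i)
  select {suc k} P i | false = suc (select (P ∘ suc) i)

  select-true : ∀ {k} (P : Fin k → Bool) i → P (select P i) ≡ true
  select-true {suc k} P i with P zero in eq
  select-true {suc k} P zero | true = eq
  select-true {suc k} P (suc i) | true = select-true (P ∘ suc) i
  select-true {suc k} P i | false = select-true (P ∘ suc) i

  select-injective : ∀ {k} (P : Fin k → Bool) {i j} → select P i ≡ select P j → i ≡ j
  select-injective {suc k} P {i} {j} eq with P zero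
  select-injective {suc k} P {zero} {zero} eq | true = refl
  select-injective {suc k} P {suc i} {suc j} eq | true = cong suc (select-injective (P ∘ suc) (Finₚ.suc-injective eq))
  select-injective {suc k} P {i} {j} eq | false = select-injective (P ∘ suc) (Finₚ.suc-injective eq)

  locate : ∀ {k} (P : Fin k → Bool) d → P d ≡ true → ∃ λ i → select P i ≡ d
  locate {suc k} P zero Pd with P zero
  ... | true = zero , refl
  locate {suc k} P (suc d) Pd with P zero | locate (P ∘ suc) d Pd
  ... | true | i , eq = suc i , cong suc eq
  ... | false | i , eq = i , cong suc eq

  least : ∀ {k} (Q : Fin k → Set) → (∀ d → Dec (Q d)) → ∃ Q → ∃ λ d → Q d × (∀ d′ → Q d′ → toℕ d ≤ toℕ d′)
  least {suc k} Q Q? (d , q) with Q? zero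
  ... | yes q₀ = zero , q₀ , λ _ _ → z≤n
  least {suc k} Q Q? (zero , q) | no ¬q₀ = contradiction q ¬q₀
  least {suc k} Q Q? (suc d , q) | no ¬q₀ with least (Q ∘ suc) (Q? ∘ suc) (d , q)
  ... | d₀ , q′ , below = suc d₀ , q′ , λ { zero q₀ → contradiction q₀ ¬q₀ ; (suc d′) q → s≤s (below d′ q) }

  module _ {k F} (f : Fin k → Fin k) (lb : Fin k → Fin F)
    (inv : ∀ d → lb (f d) ≡ lb d)
    (trans* : ∀ d d′ → lb d ≡ lb d′ → ∃ λ i → iter f i d ≡ d′)
    (surj : ∀ j → ∃ λ d → lb d ≡ j) where

    private
      P : Fin k → Bool
      P d = allBelow k λ i → toℕ d ≤ᵇ toℕ (iter f i d)

      lb-iter : ∀ i d → lb (iter f i d) ≡ lb d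
      lb-iter zero d = refl
      lb-iter (suc i) d = trans (inv (iter f i d)) (lb-iter i d)

      P⇒min : ∀ d → P d ≡ true → ∀ d′ → lb d′ ≡ lb d → toℕ d ≤ toℕ d′
      P⇒min d Pd d′ eq with trans* d d′ (sym eq)
      ... | i , reach with iter-bounded f d i
      ... | j , j<k , same = subst (λ x → toℕ d ≤ toℕ x) (trans same reach)
              (≤ᵇ⇒≤ (allBelow⁻ k (λ i → toℕ d ≤ᵇ toℕ (iter f i d)) Pd j j<k))

      min⇒P : ∀ d → (∀ d′ → lb d′ ≡ lb d → toℕ d ≤ toℕ d′) → P d ≡ true
      min⇒P d min = allBelow⁺ k (λ i → toℕ d ≤ᵇ toℕ (iter f i d)) λ i _ → ≤⇒≤ᵇ (min (iter f i d) (lb-iter i d))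

      minimum : ∀ j → ∃ λ i → lb (select P i) ≡ j
      minimum j with least (λ d → lb d ≡ j) (λ d → lb d Finₚ.≟ j) (surj j)
      ... | d , refl , below with locate P d (min⇒P d below)
      ... | i , eq = i , cong lb eq

    -- Orbits are the fibres of `lb`, and `numOrbits` counts their minima. Each fibre has exactly
    -- one, so labels and counted elements inject into each other.
    numOrbits-labels : numOrbits f ≡ F
    numOrbits-labels = ℕₚ.≤-antisym
      (Finₚ.injective⇒≤ {f = lb ∘ select P} λ {i} {j} eq → select-injective P (Finₚ.toℕ-injective (ℕₚ.≤-antisym
        (P⇒min (select P i) (select-true P i) (select P j) (sym eq))
        (P⇒min (select P j) (select-true P j) (select P i) eq))))
      (Finₚ.injective⇒≤ {f = proj₁ ∘ minimum} λ {i} {j} eq → trans (sym (proj₂ (minimum i))) (trans (cong (lb ∘ select P) eq) (proj₂ (minimum j))))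

  module ToGraph {E LV LF : Set} (M : PlaneMap {⊥} id E LV LF) (enE : Enum E) (enX : Enum (LV ⊎ ⊥)) (enF : Enum LF) where

    n m : ℕ
    n = card enX
    m = card enE

    graph : Graph n m
    graph = record
      { ends = λ i → let (x , y) = ends* enE (vert M) (elem enE i) in index enX x , index enX y
      ; noLoop = λ i eq → PlaneMap.noLoop M (elem enE i) (trans (sym (elem-index enX _)) (trans (cong (elem enX) eq) (elem-index enX _)))
      }

    decode : Fin (m ℕ.+ m) → Dart E
    decode d = [ (λ e → elem enE e , true) , (λ e → elem enE e , false) ] (splitAt m d)

    code : Dart E → Fin (m ℕ.+ m)
    code (e , true) = index enE e ↑ˡ m
    code (e , false) = m ↑ʳ index enE e

    decode-code : ∀ d → decode (code d) ≡ d
    decode-code (e , true) rewrite Finₚ.splitAt-↑ˡ m (index enE e) m = cong (_, true) (elem-index enE e)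
    decode-code (e , false) rewrite Finₚ.splitAt-↑ʳ m m (index enE e) = cong (_, false) (elem-index enE e)

    code-decode : ∀ d → code (decode d) ≡ d
    code-decode d with splitAt m d in eq
    ... | inj₁ e = trans (cong (_↑ˡ m) (index-elem enE e)) (Finₚ.splitAt⁻¹-↑ˡ eq)
    ... | inj₂ e = trans (cong (m ↑ʳ_) (index-elem enE e)) (Finₚ.splitAt⁻¹-↑ʳ eq)

    real : ∀ {A : Set} → A ⊎ ⊥ → A
    real (inj₁ x) = x

    real-inj₁ : ∀ {A : Set} (x : A ⊎ ⊥) → inj₁ (real x) ≡ x
    real-inj₁ (inj₁ x) = refl

    transport : ∀ (f : Dart E ⊎ ⊥ → Dart E ⊎ ⊥) (h : Fin (m ℕ.+ m) → Fin (m ℕ.+ m)) →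
      (∀ x → h (code (real x)) ≡ code (real (f x))) → ∀ {x y} → Orbit f x y → ∃ λ k → iter h k (code (real x)) ≡ code (real y)
    transport f h step-eq stay = 0 , refl
    transport f h step-eq (step {x} p) with transport f h step-eq p
    ... | k , eq = suc k , trans (sym (iter-shift h k (code (real x)))) (trans (cong (iter h k) (step-eq x)) eq)

    σ* : Fin (m ℕ.+ m) → Fin (m ℕ.+ m)
    σ* d = code (real (π (vert M) (inj₁ (decode d))))

    σ*-code : ∀ x → σ* (code (real x)) ≡ code (real (π (vert M) x))
    σ*-code (inj₁ d) = cong (λ d → code (real (π (vert M) (inj₁ d)))) (decode-code d)

    tail-lab : ∀ d → tailD graph d ≡ index enX (lab (vert M) (decode d))
    tail-lab d with splitAt m d
    ... | inj₁ e = refl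
    ... | inj₂ e = refl

    index-injective : ∀ {x y} → index enX x ≡ index enX y → x ≡ y
    index-injective {x} {y} eq = trans (sym (elem-index enX x)) (trans (cong (elem enX) eq) (elem-index enX y))

    σ*-invariant : ∀ d → tailD graph (σ* d) ≡ tailD graph d
    σ*-invariant d = begin
      tailD graph (σ* d)                                                       ≡⟨ tail-lab (σ* d) ⟩
      index enX (lab (vert M) (decode (σ* d)))                                 ≡⟨ cong (index enX ∘ lab (vert M)) (decode-code _) ⟩
      index enX (label (vert M) (inj₁ (real (π (vert M) (inj₁ (decode d))))))  ≡⟨ cong (index enX ∘ label (vert M)) (real-inj₁ (π (vert M) (inj₁ (decode d)))) ⟩
      index enX (label (vert M) (π (vert M) (inj₁ (decode d))))                ≡⟨ cong (index enX) (invariant (vert M) (inj₁ (decode d))) ⟩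
      index enX (lab (vert M) (decode d))                                      ≡⟨ tail-lab d ⟨
      tailD graph d                                                            ∎
      where open ≡-Reasoning

    σ*-cyclic : ∀ d d′ → tailD graph d ≡ tailD graph d′ → ∃ λ k → iter σ* k d ≡ d′
    σ*-cyclic d d′ eq with transport (π (vert M)) σ* σ*-code (transitive (vert M) (inj₁ (decode d)) (inj₁ (decode d′))
      (index-injective (trans (sym (tail-lab d)) (trans eq (tail-lab d′)))))
    ... | k , h = k , trans (cong (iter σ* k) (sym (code-decode d))) (trans h (code-decode d′))

    back : ∀ d → ∃ λ k → iter σ* k (σ* d) ≡ d
    back d = σ*-cyclic (σ* d) d (σ*-invariant d)

    -- The inverse is an iterate of `σ*` itself: transitivity at a vertex leads from `σ* d` back to
    -- `d`, and the same number of steps started at `d` ends at its preimage.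
    σ*⁻¹ : Fin (m ℕ.+ m) → Fin (m ℕ.+ m)
    σ*⁻¹ d = iter σ* (proj₁ (back d)) d

    σ*-σ*⁻¹ : ∀ d → σ* (σ*⁻¹ d) ≡ d
    σ*-σ*⁻¹ d = trans (sym (iter-shift σ* (proj₁ (back d)) d)) (proj₂ (back d))

    rotation : RotationSystem graph
    rotation = record
      { σ = σ*
      ; σ⁻¹ = σ*⁻¹
      ; inv₁ = λ d → cyclic⇒injective σ* back (σ*-σ*⁻¹ (σ* d))
      ; inv₂ = σ*-σ*⁻¹
      ; atVert = σ*-invariant
      ; cyclic = σ*-cyclic
      }

    φ* : Fin (m ℕ.+ m) → Fin (m ℕ.+ m)
    φ* d = σ* (revD {m} d)

    decode-rev : ∀ d → inj₁ (decode (revD {m} d)) ≡ flipReal {W = ⊥} (inj₁ (decode d))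
    decode-rev d with splitAt m d
    ... | inj₁ e rewrite Finₚ.splitAt-↑ʳ m m e = refl
    ... | inj₂ e rewrite Finₚ.splitAt-↑ˡ m e m = refl

    flipVirtual-id : ∀ (x : Dart E ⊎ ⊥) → flipVirtual id x ≡ x
    flipVirtual-id (inj₁ _) = refl

    -- Without virtual darts the swap in `dual` is the identity, so the face cycles are those of
    -- rotation after reversal, as `numFaces` requires.
    φ*-decode : ∀ d → φ* d ≡ code (real (π (face M) (inj₁ (decode d))))
    φ*-decode d = cong (code ∘ real) (trans (cong (π (vert M)) (decode-rev d)) (trans (sym (flipVirtual-id _)) (sym (dual M (inj₁ (decode d))))))

    φ*-code : ∀ x → φ* (code (real x)) ≡ code (real (π (face M) x))
    φ*-code (inj₁ d) = trans (φ*-decode (code d)) (cong (λ d → code (real (π (face M) (inj₁ d)))) (decode-code d))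

    faceLab : Fin (m ℕ.+ m) → Fin (card enF)
    faceLab d = index enF (real (lab (face M) (decode d)))

    faceLab-injective : ∀ {d d′} → faceLab d ≡ faceLab d′ → lab (face M) (decode d) ≡ lab (face M) (decode d′)
    faceLab-injective {d} {d′} eq = begin
      lab (face M) (decode d)               ≡⟨ real-inj₁ _ ⟨
      inj₁ (real (lab (face M) (decode d)))   ≡⟨ cong inj₁ (trans (sym (elem-index enF _)) (trans (cong (elem enF) eq) (elem-index enF _))) ⟩
      inj₁ (real (lab (face M) (decode d′)))  ≡⟨ real-inj₁ _ ⟩
      lab (face M) (decode d′)              ∎
      where open ≡-Reasoning

    faces : numFaces rotation ≡ card enF
    faces = numOrbits-labels φ* faceLab inv tr surj
      where
      inv : ∀ d → faceLab (φ* d) ≡ faceLab d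
      inv d = begin
        faceLab (φ* d)                                                               ≡⟨ cong faceLab (φ*-decode d) ⟩
        index enF (real (lab (face M) (decode (code (real (π (face M) (inj₁ (decode d))))))))  ≡⟨ cong (index enF ∘ real ∘ lab (face M)) (decode-code _) ⟩
        index enF (real (label (face M) (inj₁ (real (π (face M) (inj₁ (decode d)))))))  ≡⟨ cong (index enF ∘ real ∘ label (face M)) (real-inj₁ (π (face M) (inj₁ (decode d)))) ⟩
        index enF (real (label (face M) (π (face M) (inj₁ (decode d)))))               ≡⟨ cong (index enF ∘ real) (invariant (face M) (inj₁ (decode d))) ⟩
        faceLab d                                                                    ∎
        where open ≡-Reasoning
      tr : ∀ d d′ → faceLab d ≡ faceLab d′ → ∃ λ i → iter φ* i d ≡ d′
      tr d d′ eq with transport (π (face M)) φ* φ*-code (transitive (face M) (inj₁ (decode d)) (inj₁ (decode d′)) (faceLab-injective eq))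
      ... | k , h = k , trans (cong (iter φ* k) (sym (code-decode d))) (trans h (code-decode d′))
      surj : ∀ j → ∃ λ d → faceLab d ≡ j
      surj j with inhabited (face M) (elem enF j)
      ... | d , eq = code d , trans (cong (index enF ∘ real) (trans (cong (lab (face M)) (decode-code d)) eq)) (index-elem enF j)

    connected : Connected graph
    connected u v = subst (Reach graph u) (index-elem enX v)
      (linked M (λ x → Reach graph u (index enX x)) closed (elem enX u) (elem enX v) (subst (Reach graph u) (sym (index-elem enX u)) here))
      where
      _++_ : ∀ {u v w} → Reach graph u v → Reach graph v w → Reach graph u w
      here ++ q = q
      fwd e eq p ++ q = fwd e eq (p ++ q)
      bwd e eq p ++ q = bwd e eq (p ++ q)
      closed : ∀ e s → Reach graph u (index enX (lab (vert M) (e , s))) → Reach graph u (index enX (lab (vert M) (e , not s)))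
      closed e true p = p ++ fwd (index enE e) (cong (λ e → index enX (lab (vert M) (e , true))) (elem-index enE e))
        (subst (λ e′ → Reach graph (index enX (lab (vert M) (elem enE (index enE e) , false))) (index enX (lab (vert M) (e′ , false)))) (elem-index enE e) here)
      closed e false p = p ++ bwd (index enE e) (cong (λ e → index enX (lab (vert M) (e , false))) (elem-index enE e))
        (subst (λ e′ → Reach graph (index enX (lab (vert M) (elem enE (index enE e) , true))) (index enX (lab (vert M) (e′ , true)))) (elem-index enE e) here)

  planar : ∀ {n m} {G : Graph n m} (R : RotationSystem G) → m ≢ 0 → n ℕ.+ numFaces R ≡ m ℕ.+ 2 → Planar G
  planar {m = zero} R m≢0 eq = contradiction refl m≢0
  planar {m = suc m} R m≢0 eq = R , eq

  module Close (N : Net) where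

    M : PlaneMap {⊥} id (Σ (Fin 1) (λ _ → E N)) (Bool ⊎ Σ (Fin 1) (λ _ → LV N)) (Fin 1 ⊎ Σ (Fin 1) (λ _ → LF N))
    M = Substitute.substitute segmentMap (λ _ → E N) (λ _ → LV N) (λ _ → LF N) (λ _ → plane N)

    enX : Enum ((Bool ⊎ Σ (Fin 1) (λ _ → LV N)) ⊎ ⊥)
    enX = enum⊎ (enum⊎ enumBool (enumΣ λ _ → enV N)) enum⊥

    open ToGraph M (enumΣ λ _ → enE N) enX (enum⊎ (enumFin 1) (enumΣ λ _ → enF N)) public

    m≡size : m ≡ size N
    m≡size = ℕₚ.+-identityʳ (size N)

    -- Removing the virtual edge merges its two faces: there are v + 2 vertices, f + 1 faces and e =
    -- v + f + 1 edges. The same relation shows that there is at least one edge.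
    graph-planar : Planar graph
    graph-planar = planar rotation
      (λ m≡0 → ℕₚ.1+n≢0 (trans (ℕₚ.+-comm 1 (card (enV N) ℕ.+ card (enF N))) (trans (euler N) (trans (sym m≡size) m≡0))))
      (trans (cong (n ℕ.+_) faces) (trans (ring (card (enV N)) (card (enF N))) (cong (λ e → e ℕ.+ 0 ℕ.+ 2) (euler N))))
      where
      ring : ∀ v f → (2 ℕ.+ (v ℕ.+ 0) ℕ.+ 0) ℕ.+ (1 ℕ.+ (f ℕ.+ 0)) ≡ (v ℕ.+ f ℕ.+ 1) ℕ.+ 0 ℕ.+ 2
      ring = ℕ-Ring.solve-∀

    module Potential {V I : ℤ} (sol : Solution N V I) where
      ψ : Bool ⊎ ⊥ → ℤ
      ψ (inj₁ true) = V
      ψ (inj₁ false) = 0ℤ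

      drop : ∀ k → φ sol (inj₂ true) ≡ ψ (lab (vert segmentMap) (k , true)) ℤ.- ψ (lab (vert segmentMap) (k , false))
      drop 0F = trans (at-true sol) (sym (ℤₚ.+-identityʳ V))

      open Superpose (vert segmentMap) (λ _ → E N) (λ _ → LV N) (λ _ → vert (plane N)) (λ _ → enE N) ψ (λ _ → I) (λ _ → φ sol)
        drop (λ _ → at-false sol) (λ _ → weak sol)
        renaming (φ* to potential; weak* to potential-weak) public

      Φ : Fin n → ℤ
      Φ v = potential (elem enX v)

      a b : Fin n
      a = index enX (inj₁ (inj₁ true))
      b = index enX (inj₁ (inj₁ false))

      -- The weak solution is tested on `δ v`: current `I` enters at `a`, leaves at `b`, and is
      -- conserved elsewhere.
      lap-Φ : ∀ v → lap (ends graph) Φ v ≡ I ℤ.* (δ v a ℤ.- δ v b)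
      lap-Φ v = trans (sum-cong-≗ λ i → cong₂ (λ p q → diff (δ v) (ends graph i) ℤ.* (p ℤ.- q)) (Φ-index (lab (vert M) (elem (enumΣ λ _ → enE N) i , true))) (Φ-index (lab (vert M) (elem (enumΣ λ _ → enE N) i , false))))
        (trans (potential-weak (δ v ∘ index enX)) (ℤₚ.+-identityʳ (I ℤ.* (δ v a ℤ.- δ v b))))
        where
        Φ-index : ∀ x → Φ (index enX x) ≡ potential x
        Φ-index x = cong potential (elem-index enX x)

  -- Division by the drop v + 1 normalises the potential; the current becomes i / (v + 1), and the
  -- cross-multiplied hypothesis makes q / p its inverse.
  effRes : ∀ N (v i : ℕ) p q {{_ : ℕ.NonZero p}} → Solution N (pos (suc v)) (pos i) → q ℕ.* i ≡ p ℕ.* suc v →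
    let open Close N in Σ (Fin n) λ a → Σ (Fin n) λ b → EffRes graph a b (pos q / p)
  effRes N v i (suc p) q sol cross = a , b , (λ x → Φ x / suc v) ,
      (trans (cong (_/ suc v) (cong potential (elem-index enX (inj₁ (inj₁ true))))) (V/V) ,
       trans (cong (_/ suc v) (cong potential (elem-index enX (inj₁ (inj₁ false))))) (0/ v) ,
       λ x x≢a x≢b → trans (current x) (trans (cong (_/ suc v) (trans (lap-Φ x) (zero-at x x≢a x≢b))) (0/ v))) ,
      trans (cong (pos q / suc p ℚ.*_) (trans (current a) (cong (_/ suc v) (trans (lap-Φ a) one-at)))) ratio
    where
    open Close N
    open Potential sol
    V/V : pos (suc v) / suc v ≡ 1ℚ
    V/V = /-cross (pos (suc v)) 1ℤ v 0 (ℤₚ.*-comm (pos (suc v)) 1ℤ)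
    current : ∀ x → currentOut graph (λ x → Φ x / suc v) x ≡ lap (ends graph) Φ x / suc v
    current = currentOut-/ graph (λ x → Φ x / suc v) Φ v (λ _ → refl)
    zero-at : ∀ x → x ≢ a → x ≢ b → pos i ℤ.* (δ x a ℤ.- δ x b) ≡ 0ℤ
    zero-at x x≢a x≢b = trans (cong₂ (λ s t → pos i ℤ.* (s ℤ.- t)) (δ-≢ {v = x} {a} x≢a) (δ-≢ {v = x} {b} x≢b)) (ℤₚ.*-zeroʳ (pos i))
    one-at : pos i ℤ.* (δ a a ℤ.- δ a b) ≡ pos i
    one-at = trans (cong₂ (λ s t → pos i ℤ.* (s ℤ.- t)) (δ-refl a) (δ-≢ {v = a} {b} λ ())) (ℤₚ.*-identityʳ (pos i))
    ratio : (pos q / suc p) ℚ.* (pos i / suc v) ≡ 1ℚ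
    ratio = trans (/-* (pos q) (pos i) p v) (/-cross (pos q ℤ.* pos i) 1ℤ (ℕ.pred (suc p ℕ.* suc v)) 0
      (trans (ℤₚ.*-identityʳ (pos q ℤ.* pos i)) (trans (sym (ℤₚ.pos-* q i)) (trans (cong pos cross) (sym (ℤₚ.*-identityˡ (pos (suc p ℕ.* suc v))))))))

-- Arithmetic of realisable resistances

module Ratios where

  open Networks
  open import Data.Nat
  open import Data.Nat.Properties
  open import Data.Nat.Tactic.RingSolver using (solve-∀)
  open import Data.Integer as ℤ using (ℤ; -1ℤ) renaming (+_ to pos)
  import Data.Integer.Properties as ℤₚ
  import Data.Integer.Tactic.RingSolver as ℤ-Ring
  open import Data.Product
  open import Relation.Binary.PropositionalEquality hiding (J; [_])
  open Net

  -- Gluing brings the parts to a common integral scale, so a ratio is realised up to a positive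
  -- factor. Integers are used because the dual bridge needs negative drops and currents.
  record Realises (V I : ℤ) (m : ℕ) : Set₁ where
    constructor realises
    field
      net      : Net
      factor   : ℕ
      size≡m   : size net ≡ m
      solution : Solution net (pos (suc factor) ℤ.* V) (pos (suc factor) ℤ.* I)

  realises-cast : ∀ {V V′ I I′ m m′} → V ≡ V′ → I ≡ I′ → m ≡ m′ → Realises V I m → Realises V′ I′ m′
  realises-cast refl refl refl r = r

  realises-scale : ∀ c {V I m} → Realises V I m → Realises (c ℤ.* V) (c ℤ.* I) m
  realises-scale c {V} {I} (realises N k size sol) = realises N k size
    (solution-cast (ring c (pos (suc k)) V) (ring c (pos (suc k)) I) (scale c sol))
    where
    ring : ∀ c k v → c ℤ.* (k ℤ.* v) ≡ k ℤ.* (c ℤ.* v)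
    ring = ℤ-Ring.solve-∀

  realises-reduce : ∀ c {V I m} → Realises (pos (suc c) ℤ.* V) (pos (suc c) ℤ.* I) m → Realises V I m
  realises-reduce c {V} {I} (realises N k size sol) = realises N (c + k * suc c) size
    (solution-cast (assoc V) (assoc I) sol)
    where
    assoc : ∀ v → pos (suc k) ℤ.* (pos (suc c) ℤ.* v) ≡ pos (suc k * suc c) ℤ.* v
    assoc v = trans (sym (ℤₚ.*-assoc (pos (suc k)) (pos (suc c)) v)) (cong (ℤ._* v) (sym (ℤₚ.pos-* (suc k) (suc c))))

  realises-series : ∀ {V I m} → Realises V I m → Realises (V ℤ.+ I) I (suc m)
  realises-series {V} {I} (realises N k size sol) = realises (series N) k (trans (size-series N) (cong suc size))
    (solution-cast (sym (ℤₚ.*-distribˡ-+ (pos (suc k)) V I)) refl (series-solution sol))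

  realises-parallel : ∀ {V I m} → Realises V I m → Realises V (V ℤ.+ I) (suc m)
  realises-parallel {V} {I} (realises N k size sol) = realises (parallel N) k (trans (size-parallel N) (cong suc size))
    (solution-cast refl (sym (ℤₚ.*-distribˡ-+ (pos (suc k)) V I)) (parallel-solution sol))

  realises-bridge : ∀ v i y {m m′} → Realises v i m → Realises (y ℤ.+ pos 2 ℤ.* (v ℤ.+ i)) y m′ →
    Realises (pos 2 ℤ.* y ℤ.+ pos 2 ℤ.* v ℤ.+ pos 3 ℤ.* i) (pos 2 ℤ.* y ℤ.+ v ℤ.+ pos 2 ℤ.* i) (3 + (m + m′))
  realises-bridge v i y (realises M j sizeM solM) (realises N k sizeN solN) =
    realises (bridge M N) (k + j * suc k) (trans (size-bridge M N) (cong (3 +_) (cong₂ _+_ sizeM sizeN)))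
    (solution-cast (trans (ring₁ J K v i y) (cong (ℤ._* (pos 2 ℤ.* y ℤ.+ pos 2 ℤ.* v ℤ.+ pos 3 ℤ.* i)) (sym (ℤₚ.pos-* (suc j) (suc k)))))
                   (trans (ring₂ J K v i y) (cong (ℤ._* (pos 2 ℤ.* y ℤ.+ v ℤ.+ pos 2 ℤ.* i)) (sym (ℤₚ.pos-* (suc j) (suc k)))))
      (bridge-solution (K ℤ.* (J ℤ.* v)) (K ℤ.* (J ℤ.* i)) (J ℤ.* (K ℤ.* y)) (scale K solM)
        (solution-cast (ring₀ J K v i y) refl (scale J solN))))
    where
    J K : ℤ
    J = pos (suc j)
    K = pos (suc k)
    ring₀ : ∀ j k v i y → j ℤ.* (k ℤ.* (y ℤ.+ pos 2 ℤ.* (v ℤ.+ i))) ≡ j ℤ.* (k ℤ.* y) ℤ.+ pos 2 ℤ.* (k ℤ.* (j ℤ.* v) ℤ.+ k ℤ.* (j ℤ.* i))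
    ring₀ = ℤ-Ring.solve-∀
    ring₁ : ∀ j k v i y → pos 2 ℤ.* (j ℤ.* (k ℤ.* y)) ℤ.+ pos 2 ℤ.* (k ℤ.* (j ℤ.* v)) ℤ.+ pos 3 ℤ.* (k ℤ.* (j ℤ.* i))
      ≡ j ℤ.* k ℤ.* (pos 2 ℤ.* y ℤ.+ pos 2 ℤ.* v ℤ.+ pos 3 ℤ.* i)
    ring₁ = ℤ-Ring.solve-∀
    ring₂ : ∀ j k v i y → pos 2 ℤ.* (j ℤ.* (k ℤ.* y)) ℤ.+ k ℤ.* (j ℤ.* v) ℤ.+ pos 2 ℤ.* (k ℤ.* (j ℤ.* i))
      ≡ j ℤ.* k ℤ.* (pos 2 ℤ.* y ℤ.+ v ℤ.+ pos 2 ℤ.* i)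
    ring₂ = ℤ-Ring.solve-∀

  -- The dual resistance I / V is carried along because the recursion inverts ratios below 1.
  record Ratio (V I m : ℕ) : Set₁ where
    constructor ratio
    field
      direct : Realises (pos V) (pos I) m
      dual   : Realises (pos I) (pos V) m
  open Ratio

  ratio-cast : ∀ {V V′ I I′ m m′} → V ≡ V′ → I ≡ I′ → m ≡ m′ → Ratio V I m → Ratio V′ I′ m′
  ratio-cast refl refl refl r = r

  ratio-swap : ∀ {V I m} → Ratio V I m → Ratio I V m
  ratio-swap (ratio r r′) = ratio r′ r

  ratio-unit : Ratio 1 1 1
  ratio-unit = ratio unit unit
    where
    unit : Realises (pos 1) (pos 1) 1
    unit = realises edge 0 refl (edge-solution (pos 1))

  ratio-enlarge : ∀ c {V I m} → Ratio V I m → Ratio (c * V) (c * I) m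
  ratio-enlarge c {V} {I} (ratio r r′) = ratio
    (realises-cast (sym (ℤₚ.pos-* c V)) (sym (ℤₚ.pos-* c I)) refl (realises-scale (pos c) r))
    (realises-cast (sym (ℤₚ.pos-* c I)) (sym (ℤₚ.pos-* c V)) refl (realises-scale (pos c) r′))

  ratio-reduce : ∀ c .{{_ : NonZero c}} {V I m} → Ratio (c * V) (c * I) m → Ratio V I m
  ratio-reduce (suc c) {V} {I} (ratio r r′) = ratio
    (realises-reduce c (realises-cast (ℤₚ.pos-* (suc c) V) (ℤₚ.pos-* (suc c) I) refl r))
    (realises-reduce c (realises-cast (ℤₚ.pos-* (suc c) I) (ℤₚ.pos-* (suc c) V) refl r′))

  ratio-series : ∀ {V I m} → Ratio V I m → Ratio (V + I) I (suc m)
  ratio-series {V} {I} (ratio r r′) = ratio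
    (realises-cast (sym (ℤₚ.pos-+ V I)) refl refl (realises-series r))
    (realises-cast refl (trans (sym (ℤₚ.pos-+ I V)) (cong pos (+-comm I V))) refl (realises-parallel r′))

  ratio-series* : ∀ k {V I m} → Ratio V I m → Ratio (V + k * I) I (k + m)
  ratio-series* zero {V} r = ratio-cast (sym (+-identityʳ V)) refl refl r
  ratio-series* (suc k) {V} {I} r = ratio-cast (ring V I k) refl refl (ratio-series (ratio-series* k r))
    where
    ring : ∀ v i k → v + k * i + i ≡ v + (i + k * i)
    ring = solve-∀

  -- The inverse comes from the same bridge with inverted parts: y is replaced by y + 2 (v + i), and
  -- (v , i) by (-i , -v). The signs reflect that duality reverses the bridging edge.
  ratio-bridge : ∀ v i y {m m′} → Ratio v i m → Ratio (y + 2 * (v + i)) y m′ →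
    Ratio (2 * y + 2 * v + 3 * i) (2 * y + v + 2 * i) (3 + (m + m′))
  ratio-bridge v i y (ratio f f′) (ratio r r′) = ratio
    (realises-cast (sym pos-first) (sym pos-second) refl (realises-bridge (pos v) (pos i) (pos y) f (realises-cast pos-rest refl refl r)))
    (realises-cast (trans (ring₁ (pos v) (pos i) (pos y)) (sym pos-second)) (trans (ring₂ (pos v) (pos i) (pos y)) (sym pos-first)) refl
      (realises-bridge (-1ℤ ℤ.* pos i) (-1ℤ ℤ.* pos v) (pos y ℤ.+ pos 2 ℤ.* (pos v ℤ.+ pos i)) (realises-scale -1ℤ f′)
        (realises-cast (ring₀ (pos v) (pos i) (pos y)) pos-rest refl r′)))
    where
    pos-sum : ∀ a b c x y z → pos (a * x + b * y + c * z) ≡ pos a ℤ.* pos x ℤ.+ pos b ℤ.* pos y ℤ.+ pos c ℤ.* pos z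
    pos-sum a b c x y z = trans (ℤₚ.pos-+ (a * x + b * y) (c * z))
      (cong₂ ℤ._+_ (trans (ℤₚ.pos-+ (a * x) (b * y)) (cong₂ ℤ._+_ (ℤₚ.pos-* a x) (ℤₚ.pos-* b y))) (ℤₚ.pos-* c z))
    pos-first : pos (2 * y + 2 * v + 3 * i) ≡ pos 2 ℤ.* pos y ℤ.+ pos 2 ℤ.* pos v ℤ.+ pos 3 ℤ.* pos i
    pos-first = pos-sum 2 2 3 y v i
    pos-second : pos (2 * y + v + 2 * i) ≡ pos 2 ℤ.* pos y ℤ.+ pos v ℤ.+ pos 2 ℤ.* pos i
    pos-second = trans (cong (λ w → pos (2 * y + w + 2 * i)) (sym (*-identityˡ v)))
      (trans (pos-sum 2 1 2 y v i) (cong (λ w → pos 2 ℤ.* pos y ℤ.+ w ℤ.+ pos 2 ℤ.* pos i) (ℤₚ.*-identityˡ (pos v))))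
    pos-rest : pos (y + 2 * (v + i)) ≡ pos y ℤ.+ pos 2 ℤ.* (pos v ℤ.+ pos i)
    pos-rest = trans (ℤₚ.pos-+ y (2 * (v + i))) (cong (λ z → pos y ℤ.+ z) (trans (ℤₚ.pos-* 2 (v + i)) (cong (pos 2 ℤ.*_) (ℤₚ.pos-+ v i))))
    ring₀ : ∀ v i y → y ≡ (y ℤ.+ pos 2 ℤ.* (v ℤ.+ i)) ℤ.+ pos 2 ℤ.* (-1ℤ ℤ.* i ℤ.+ -1ℤ ℤ.* v)
    ring₀ = ℤ-Ring.solve-∀
    ring₁ : ∀ v i y → pos 2 ℤ.* (y ℤ.+ pos 2 ℤ.* (v ℤ.+ i)) ℤ.+ pos 2 ℤ.* (-1ℤ ℤ.* i) ℤ.+ pos 3 ℤ.* (-1ℤ ℤ.* v) ≡ pos 2 ℤ.* y ℤ.+ v ℤ.+ pos 2 ℤ.* i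
    ring₁ = ℤ-Ring.solve-∀
    ring₂ : ∀ v i y → pos 2 ℤ.* (y ℤ.+ pos 2 ℤ.* (v ℤ.+ i)) ℤ.+ (-1ℤ ℤ.* i) ℤ.+ pos 2 ℤ.* (-1ℤ ℤ.* v) ≡ pos 2 ℤ.* y ℤ.+ pos 2 ℤ.* v ℤ.+ pos 3 ℤ.* i
    ring₂ = ℤ-Ring.solve-∀

  Bounded : ℕ → ℕ → ℕ → Set₁
  Bounded c V I = Σ ℕ λ m → m ≤ c × Ratio V I m

  ratio-equal : ∀ c .{{_ : NonZero c}} → Ratio c c 1
  ratio-equal c = ratio-cast (*-identityʳ c) (*-identityʳ c) refl (ratio-enlarge c ratio-unit)

  -- The subtractive Euclidean algorithm, one edge for each subtraction. Its cost is linear, so it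
  -- is used only for ratios of bounded height.
  euclid : ∀ fuel v i → v + i < fuel → Bounded (suc v + suc i) (suc v) (suc i)
  euclid (suc fuel) v i v+i<f with compare v i
  ... | equal v = 1 , s≤s z≤n , ratio-equal (suc v)
  ... | less v k with euclid fuel k v (≤-trans (m≤n+m (suc (k + v)) v) (≤-trans (≤-reflexive (ring v k)) (≤-pred v+i<f)))
    where
    ring : ∀ v k → v + suc (k + v) ≡ v + suc (v + k)
    ring = solve-∀
  ... | m , m≤ , r = suc m , ≤-trans (s≤s m≤) (≤-trans (m≤m+n _ v) (≤-reflexive (ring₁ v k))) , ratio-cast refl (ring₂ v k) refl (ratio-swap (ratio-series r))
    where
    ring₁ : ∀ v k → suc (suc k + suc v) + v ≡ suc v + suc (suc (v + k))
    ring₁ = solve-∀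
    ring₂ : ∀ v k → suc k + suc v ≡ suc (suc (v + k))
    ring₂ = solve-∀
  euclid (suc fuel) v i v+i<f | greater i k with euclid fuel k i (≤-trans (m≤n+m (suc (k + i)) i) (≤-trans (≤-reflexive (ring i k)) (≤-pred v+i<f)))
    where
    ring : ∀ i k → i + suc (k + i) ≡ suc (i + k) + i
    ring = solve-∀
  ... | m , m≤ , r = suc m , ≤-trans (s≤s m≤) (≤-trans (m≤m+n _ i) (≤-reflexive (ring₁ i k))) , ratio-cast (ring₂ i k) refl refl (ratio-series r)
    where
    ring₁ : ∀ i k → suc (suc k + suc i) + i ≡ suc (suc (i + k)) + suc i
    ring₁ = solve-∀
    ring₂ : ∀ i k → suc k + suc i ≡ suc (suc (i + k))
    ring₂ = solve-∀

-- Logarithmic chains and reduction of the height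

module Reductions where

  open Ratios
  open import Data.Nat
  open import Data.Nat.Properties
  open import Data.Nat.DivMod
  open import Data.Nat.Tactic.RingSolver using (solve-∀)
  open import Data.Product
  open import Relation.Binary.PropositionalEquality hiding (J; [_])
  open import Relation.Nullary using (contradiction; Dec; yes; no)

  -- In terms of x = y / 8 this is the step x ↦ 4 x + c with c = 1 + e / 8 and e = 2 + r.
  chain-step : ∀ r y {c} → r < 4 → 1 ≤ y → Bounded c (y + 8) y → Bounded (11 + c) (10 + r + 4 * y + 8) (10 + r + 4 * y)
  chain-step r y {c} r<4 1≤y (m , m≤c , rest) = step r r<4
    where
    -- The filler is v / i with v = 8 - e and i = e. Applied to 2 y, the bridge has fourth arm (2 y
    -- + 16) / (2 y) = (y + 8) / y. The 11 edges are three unit arms and at most 8 for the filler.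
    build : ∀ v i {V I} → Bounded 8 v i → v + i ≡ 8 → 2 * (2 * y) + 2 * v + 3 * i ≡ V → 2 * (2 * y) + v + 2 * i ≡ I → Bounded (11 + c) V I
    build v i (m′ , m′≤8 , filler) v+i eqV eqI = 3 + (m′ + m) , +-monoʳ-≤ 3 (+-mono-≤ m′≤8 m≤c) ,
      ratio-cast eqV eqI refl (ratio-bridge v i (2 * y) filler (ratio-cast (trans (double y) (cong (λ s → 2 * y + 2 * s) (sym v+i))) refl refl (ratio-enlarge 2 rest)))
      where
      double : ∀ y → 2 * (y + 8) ≡ 2 * y + 2 * 8
      double = solve-∀
    step : ∀ r → r < 4 → Bounded (11 + c) (10 + r + 4 * y + 8) (10 + r + 4 * y)
    step 0 _ = build 6 2 (euclid 9 5 1 (m≤m+n 7 2)) refl (ring₁ y) (ring₂ y)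
      where
      ring₁ : ∀ y → 2 * (2 * y) + 2 * 6 + 3 * 2 ≡ 10 + 4 * y + 8
      ring₁ = solve-∀
      ring₂ : ∀ y → 2 * (2 * y) + 6 + 2 * 2 ≡ 10 + 4 * y
      ring₂ = solve-∀
    step 1 _ = build 5 3 (euclid 9 4 2 (m≤m+n 7 2)) refl (ring₁ y) (ring₂ y)
      where
      ring₁ : ∀ y → 2 * (2 * y) + 2 * 5 + 3 * 3 ≡ 11 + 4 * y + 8
      ring₁ = solve-∀
      ring₂ : ∀ y → 2 * (2 * y) + 5 + 2 * 3 ≡ 11 + 4 * y
      ring₂ = solve-∀
    step 2 _ = build 4 4 (euclid 9 3 3 (m≤m+n 7 2)) refl (ring₁ y) (ring₂ y)
      where
      ring₁ : ∀ y → 2 * (2 * y) + 2 * 4 + 3 * 4 ≡ 12 + 4 * y + 8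
      ring₁ = solve-∀
      ring₂ : ∀ y → 2 * (2 * y) + 4 + 2 * 4 ≡ 12 + 4 * y
      ring₂ = solve-∀
    step 3 _ = build 3 5 (euclid 9 2 4 (m≤m+n 7 2)) refl (ring₁ y) (ring₂ y)
      where
      ring₁ : ∀ y → 2 * (2 * y) + 2 * 3 + 3 * 5 ≡ 13 + 4 * y + 8
      ring₁ = solve-∀
      ring₂ : ∀ y → 2 * (2 * y) + 3 + 2 * 5 ≡ 13 + 4 * y
      ring₂ = solve-∀
    step (suc (suc (suc (suc _)))) (s≤s (s≤s (s≤s (s≤s ()))))

  bounded-weaken : ∀ {c c′ V I} → c ≤ c′ → Bounded c V I → Bounded c′ V I
  bounded-weaken c≤c′ (m , m≤c , r) = m , ≤-trans m≤c c≤c′ , r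

  -- A step passes from y to the quotient of y - 10 by 4, and the remainder selects one of four
  -- fillers. From y = 14 on the quotient is at least 1; below, the Euclidean cost 2 y + 8 is at
  -- most 34.
  chain : ∀ L y → 1 ≤ y → y < 2 ^ L → Bounded (34 + 11 * L) (y + 8) y
  chain L y 1≤y y<2^L with y <? 14
  chain L (suc y) 1≤y y<2^L | yes y<14 = bounded-weaken bound (euclid (suc (y + 8 + y)) (y + 8) y ≤-refl)
    where
    ring : ∀ y → suc (y + 8) + suc y ≡ 2 * suc y + 8
    ring = solve-∀
    bound : suc (y + 8) + suc y ≤ 34 + 11 * L
    bound = ≤-trans (≤-reflexive (ring y)) (≤-trans (+-monoˡ-≤ 8 (*-monoʳ-≤ 2 (≤-pred y<14))) (m≤m+n 34 (11 * L)))
  chain zero y 1≤y y<1 | no _ = contradiction 1≤y (<⇒≱ y<1)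
  chain (suc L) y 1≤y y<2^L | no y≮14 = subst₂ (Bounded (34 + 11 * suc L)) (cong (_+ 8) (sym y≡)) (sym y≡)
      (bounded-weaken (≤-reflexive (ring L)) (chain-step r y′ (m%n<n (y ∸ 10) 4) 1≤y′ (chain L y′ 1≤y′ y′<)))
    where
    r y′ : ℕ
    r = (y ∸ 10) % 4
    y′ = (y ∸ 10) / 4
    ring : ∀ L → 11 + (34 + 11 * L) ≡ 34 + 11 * suc L
    ring = solve-∀
    14≤y : 14 ≤ y
    14≤y = ≮⇒≥ y≮14
    y≡ : y ≡ 10 + r + 4 * y′
    y≡ = begin
      y                        ≡⟨ m+[n∸m]≡n (≤-trans (m≤m+n 10 4) 14≤y) ⟨
      10 + (y ∸ 10)            ≡⟨ cong (10 +_) (m≡m%n+[m/n]*n (y ∸ 10) 4) ⟩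
      10 + (r + y′ * 4)        ≡⟨ reorder r y′ ⟩
      10 + r + 4 * y′          ∎
      where
      open ≡-Reasoning
      reorder : ∀ r y → 10 + (r + y * 4) ≡ 10 + r + 4 * y
      reorder = solve-∀
    1≤y′ : 1 ≤ y′
    1≤y′ = m≥n⇒m/n>0 {y ∸ 10} {4} (∸-monoˡ-≤ 10 14≤y)
    y′< : y′ < 2 ^ L
    y′< = *-cancelˡ-< 2 y′ (2 ^ L) (≤-<-trans (≤-trans (*-monoˡ-≤ y′ (m≤m+n 2 2)) (≤-trans (m≤n+m (4 * y′) (10 + r)) (≤-reflexive (sym y≡)))) y<2^L)

  -- The height falls from `N` to at most `δ`, and δ₁ ≤ N₁ keeps the new ratio between 1 and 2, so
  -- that it can be reduced in turn; `c` is the cost of going back.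
  record Reduction (c N δ : ℕ) : Set₁ where
    constructor reduction
    field
      N₁ δ₁  : ℕ
      1≤N₁   : 1 ≤ N₁
      N₁≤δ   : N₁ ≤ δ
      δ₁≤N₁  : δ₁ ≤ N₁
      rebuild : ∀ {c₁} → Bounded c₁ (N₁ + δ₁) N₁ → Bounded (c₁ + c) (N + δ) N

  bounded-series* : ∀ k {c V I} → Bounded c V I → Bounded (k + c) (V + k * I) I
  bounded-series* k (m , m≤c , r) = k + m , +-monoʳ-≤ k m≤c , ratio-series* k r

  bounded-swap : ∀ {c V I} → Bounded c V I → Bounded c I V
  bounded-swap (m , m≤c , r) = m , m≤c , ratio-swap r

  bounded-cast : ∀ {c V V′ I I′} → V ≡ V′ → I ≡ I′ → Bounded c V I → Bounded c V′ I′
  bounded-cast refl refl b = b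

  -- The hypotheses put (2 δ - f) / f between 1 and 3. Up to 2 it is already 1 + δ₁ / f; above 2 one
  -- unit resistor in series is split off.
  reduce-filler : ∀ δ f → f ≤ δ → δ ≤ 2 * f → 1 ≤ f →
    Σ ℕ λ δ₁ → δ₁ ≤ f × (∀ {c₁} → Bounded c₁ (f + δ₁) f → Bounded (c₁ + 1) (2 * δ ∸ f) f)
  reduce-filler δ f f≤δ δ≤2f 1≤f with 2 * δ ≤? 3 * f
  ... | yes 2δ≤3f = 2 * δ ∸ f ∸ f , ≤-trans (∸-monoˡ-≤ f (∸-monoˡ-≤ f 2δ≤3f)) (≤-reflexive three) ,
      λ b → bounded-weaken (m≤m+n _ 1) (bounded-cast (m+[n∸m]≡n f≤2δ∸f) refl b)
    where
    three : 3 * f ∸ f ∸ f ≡ f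
    three = trans (cong (_∸ f) (trans (cong (_∸ f) (ring f)) (m+n∸n≡m (f + f) f))) (m+n∸n≡m f f)
      where
      ring : ∀ f → 3 * f ≡ f + f + f
      ring = solve-∀
    f≤2δ∸f : f ≤ 2 * δ ∸ f
    f≤2δ∸f = ≤-trans (≤-reflexive (sym (trans (cong (_∸ f) (ring f)) (m+n∸n≡m f f)))) (∸-monoˡ-≤ f (*-monoʳ-≤ 2 f≤δ))
      where
      ring : ∀ f → 2 * f ≡ f + f
      ring = solve-∀
  ... | no 2δ≰3f = 2 * δ ∸ 3 * f , ≤-trans (∸-monoˡ-≤ (3 * f) (*-monoʳ-≤ 2 δ≤2f)) (≤-reflexive (trans (cong (_∸ 3 * f) (ring f)) (m+n∸n≡m f (3 * f)))) ,
      λ {c₁} b → bounded-weaken (≤-reflexive (+-comm 1 c₁)) (bounded-cast shape refl (bounded-series* 1 b))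
    where
    ring : ∀ f → 2 * (2 * f) ≡ f + 3 * f
    ring = solve-∀
    shape : f + (2 * δ ∸ 3 * f) + 1 * f ≡ 2 * δ ∸ f
    shape = begin
      f + (2 * δ ∸ 3 * f) + 1 * f          ≡⟨ ring₁ f (2 * δ ∸ 3 * f) ⟩
      3 * f + (2 * δ ∸ 3 * f) ∸ f          ≡⟨ cong (_∸ f) (m+[n∸m]≡n (<⇒≤ (≰⇒> 2δ≰3f))) ⟩
      2 * δ ∸ f                            ∎
      where
      open ≡-Reasoning
      ring₂ : ∀ f d → 3 * f + d ≡ f + d + 1 * f + f
      ring₂ = solve-∀
      ring₁ : ∀ f d → f + d + 1 * f ≡ 3 * f + d ∸ f
      ring₁ f d = sym (trans (cong (_∸ f) (ring₂ f d)) (m+n∸n≡m (f + d + 1 * f) f))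

  -- Here N / δ has integral part a ≤ 3, and Euclid's algorithm suffices: one edge for the leading 1
  -- and, after inversion, a - 1 edges to come down to 1 + ρ / δ.
  small-reduction : ∀ N δ → .{{_ : NonZero δ}} → δ ≤ N → N < 4 * δ → Reduction 3 N δ
  small-reduction N δ δ≤N N<4δ = reduction δ ρ (>-nonZero⁻¹ δ) ≤-refl (<⇒≤ (m%n<n N δ)) rebuild
    where
    ρ a : ℕ
    ρ = N % δ
    a = N / δ
    1≤a : 1 ≤ a
    1≤a = m≥n⇒m/n>0 δ≤N
    a<4 : a < 4
    a<4 = m<n*o⇒m/o<n N<4δ
    shape : δ + ρ + (a ∸ 1) * δ ≡ N
    shape = begin
      δ + ρ + (a ∸ 1) * δ       ≡⟨ ring δ ρ (a ∸ 1) ⟩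
      ρ + (1 + (a ∸ 1)) * δ     ≡⟨ cong (λ k → ρ + k * δ) (m+[n∸m]≡n 1≤a) ⟩
      ρ + a * δ                 ≡⟨ m≡m%n+[m/n]*n N δ ⟨
      N                         ∎
      where
      open ≡-Reasoning
      ring : ∀ d r k → d + r + k * d ≡ r + (1 + k) * d
      ring = solve-∀
    rebuild : ∀ {c₁} → Bounded c₁ (δ + ρ) δ → Bounded (c₁ + 3) (N + δ) N
    rebuild {c₁} b = bounded-weaken (≤-trans (+-monoˡ-≤ c₁ (≤-trans (≤-reflexive (m+[n∸m]≡n 1≤a)) (≤-pred a<4))) (≤-reflexive (+-comm 3 c₁)))
      (bounded-cast (trans (cong (δ +_) (*-identityˡ N)) (+-comm δ N)) refl (bounded-series* 1 (bounded-swap (bounded-cast shape refl (bounded-series* (a ∸ 1) b)))))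

  -- The bridge separates the integral part of 2 N / δ, left to the ratio (j + 8) / j, from the
  -- fractional part, which the bridging resistor (2 δ − e) / e takes care of.
  bridge-reduction : ∀ N δ j e L → .{{_ : NonZero δ}} → 2 * N ≡ (j + 2) * δ + e → δ ≤ 2 * e → 2 * e ≤ 3 * δ → 1 ≤ j → j < 2 ^ L →
    Reduction (38 + 11 * L) N δ
  bridge-reduction N δ j e L 2N≡ δ≤2e 2e≤3δ 1≤j j<2^L = main (e ≤? δ)
    where
    1≤δ : 1 ≤ δ
    1≤δ = >-nonZero⁻¹ δ
    e≤2δ : e ≤ 2 * δ
    e≤2δ = *-cancelˡ-≤ 2 (≤-trans 2e≤3δ (≤-trans (*-monoˡ-≤ δ (m≤m+n 3 1)) (≤-reflexive (*-assoc 2 2 δ))))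
    assemble : ∀ {c₁} → Bounded c₁ (2 * δ ∸ e) e → Bounded (c₁ + (37 + 11 * L)) (N + δ) N
    assemble {c₁} (m′ , m′≤c₁ , filler) with chain L j 1≤j j<2^L
    ... | m , m≤ , rest = 3 + (m′ + m) , bound ,
      -- Since e + g = 2 δ, taking v = 2 g, i = 2 e and y = δ j makes the fourth arm δ (j + 8) over
      -- δ j, and the bridge yields 4 (N + δ) over 4 N.
      ratio-reduce 4 (ratio-cast shape₁ shape₂ refl (ratio-bridge (2 * g) (2 * e) (δ * j) (ratio-enlarge 2 filler)
        (ratio-cast shape₀ refl refl (ratio-enlarge δ rest))))
      where
      g = 2 * δ ∸ e
      e+g : e + g ≡ 2 * δ
      e+g = m+[n∸m]≡n e≤2δ
      bound : 3 + (m′ + m) ≤ c₁ + (37 + 11 * L)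
      bound = ≤-trans (+-monoʳ-≤ 3 (+-mono-≤ m′≤c₁ m≤)) (≤-reflexive (ring c₁ L))
        where
        ring : ∀ c L → 3 + (c + (34 + 11 * L)) ≡ c + (37 + 11 * L)
        ring = solve-∀
      open ≡-Reasoning
      shape₀ : δ * (j + 8) ≡ δ * j + 2 * (2 * g + 2 * e)
      shape₀ = begin
        δ * (j + 8)                         ≡⟨ ring₁ δ j ⟩
        δ * j + 4 * (2 * δ)                 ≡⟨ cong (λ s → δ * j + 4 * s) e+g ⟨
        δ * j + 4 * (e + g)                 ≡⟨ ring₂ δ j e g ⟩
        δ * j + 2 * (2 * g + 2 * e)         ∎
        where
        ring₁ : ∀ d j → d * (j + 8) ≡ d * j + 4 * (2 * d)
        ring₁ = solve-∀
        ring₂ : ∀ d j e g → d * j + 4 * (e + g) ≡ d * j + 2 * (2 * g + 2 * e)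
        ring₂ = solve-∀
      shape₂ : 2 * (δ * j) + 2 * g + 2 * (2 * e) ≡ 4 * N
      shape₂ = begin
        2 * (δ * j) + 2 * g + 2 * (2 * e)   ≡⟨ ring₁ δ j e g ⟩
        2 * (δ * j) + 2 * (e + g) + 2 * e   ≡⟨ cong (λ s → 2 * (δ * j) + 2 * s + 2 * e) e+g ⟩
        2 * (δ * j) + 2 * (2 * δ) + 2 * e   ≡⟨ ring₂ δ j e ⟩
        2 * ((j + 2) * δ + e)               ≡⟨ cong (2 *_) 2N≡ ⟨
        2 * (2 * N)                         ≡⟨ *-assoc 2 2 N ⟨
        4 * N                               ∎
        where
        ring₁ : ∀ d j e g → 2 * (d * j) + 2 * g + 2 * (2 * e) ≡ 2 * (d * j) + 2 * (e + g) + 2 * e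
        ring₁ = solve-∀
        ring₂ : ∀ d j e → 2 * (d * j) + 2 * (2 * d) + 2 * e ≡ 2 * ((j + 2) * d + e)
        ring₂ = solve-∀
      shape₁ : 2 * (δ * j) + 2 * (2 * g) + 3 * (2 * e) ≡ 4 * (N + δ)
      shape₁ = begin
        2 * (δ * j) + 2 * (2 * g) + 3 * (2 * e)              ≡⟨ ring₁ δ j e g ⟩
        2 * (δ * j) + 2 * g + 2 * (2 * e) + 2 * (e + g)      ≡⟨ cong₂ (λ s t → s + 2 * t) shape₂ e+g ⟩
        4 * N + 2 * (2 * δ)                                  ≡⟨ ring₂ N δ ⟩
        4 * (N + δ)                                          ∎
        where
        ring₁ : ∀ d j e g → 2 * (d * j) + 2 * (2 * g) + 3 * (2 * e) ≡ 2 * (d * j) + 2 * g + 2 * (2 * e) + 2 * (e + g)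
        ring₁ = solve-∀
        ring₂ : ∀ n d → 4 * n + 2 * (2 * d) ≡ 4 * (n + d)
        ring₂ = solve-∀
    cost : ∀ c → c + 1 + (37 + 11 * L) ≡ c + (38 + 11 * L)
    cost c = +-assoc c 1 (37 + 11 * L)
    positive : ∀ x → δ ≤ 2 * x → 1 ≤ x
    positive zero δ≤0 = contradiction (≤-trans 1≤δ δ≤0) λ ()
    positive (suc x) _ = s≤s z≤n
    main : Dec (e ≤ δ) → Reduction (38 + 11 * L) N δ
    main (yes e≤δ) with reduce-filler δ e e≤δ δ≤2e (positive e δ≤2e)
    ... | δ₁ , δ₁≤e , fill = reduction e δ₁ (positive e δ≤2e) e≤δ δ₁≤e λ {c₁} b → bounded-weaken (≤-reflexive (cost c₁)) (assemble (fill b))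
    -- Now the filler (2 δ - e) / e is below 1. Its inverse has the same shape with g = 2 δ - e in
    -- the place of e, and 2 e ≤ 3 δ bounds that inverse by 3.
    main (no e≰δ) = flipped g≤δ δ≤2g
      where
      g : ℕ
      g = 2 * δ ∸ e
      flipped : g ≤ δ → δ ≤ 2 * g → Reduction (38 + 11 * L) N δ
      flipped g≤δ δ≤2g with reduce-filler δ g g≤δ δ≤2g (positive g δ≤2g)
      ... | δ₁ , δ₁≤g , fill = reduction g δ₁ (positive g δ≤2g) g≤δ δ₁≤g
          λ {c₁} b → bounded-weaken (≤-reflexive (cost c₁)) (assemble (bounded-cast refl (m∸[m∸n]≡n e≤2δ) (bounded-swap (fill b))))
      g≤δ : g ≤ δ
      g≤δ = ≤-trans (∸-monoʳ-≤ (2 * δ) (<⇒≤ (≰⇒> e≰δ))) (≤-reflexive (trans (cong (_∸ δ) (ring δ)) (m+n∸n≡m δ δ)))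
        where
        ring : ∀ d → 2 * d ≡ d + d
        ring = solve-∀
      δ≤2g : δ ≤ 2 * g
      δ≤2g = ≤-trans (≤-reflexive (sym (trans (cong (_∸ 3 * δ) (ring δ)) (m+n∸n≡m δ (3 * δ)))))
        (≤-trans (∸-monoʳ-≤ (2 * (2 * δ)) 2e≤3δ) (≤-reflexive (sym (*-distribˡ-∸ 2 (2 * δ) e))))
        where
        ring : ∀ d → 2 * (2 * d) ≡ d + 3 * d
        ring = solve-∀

-- Recursion on the bit length and the size bound

module UpperBound where

  open import Defs
  open Networks
  open Graphs
  open Ratios
  open Reductions
  open import Data.Nat hiding (_/_)
  open import Data.Nat.Properties
  open import Data.Nat.DivMod hiding (_/_)
  import Data.Nat.DivMod as DivMod
  open import Data.Nat.Tactic.RingSolver using (solve-∀)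
  open import Data.Nat.Induction using (<-rec)
  open import Data.Integer using () renaming (+_ to pos)
  import Data.Integer.Properties as ℤₚ
  open import Data.Rational using (_/_)
  open import Data.Fin using (Fin)
  open import Data.Product
  open import Data.Sum using (_⊎_; inj₁; inj₂)
  open import Relation.Binary.PropositionalEquality hiding (J; [_])
  open import Relation.Nullary using (contradiction; Dec; yes; no)

  reduction-weaken : ∀ {c c′ N δ} → c ≤ c′ → Reduction c N δ → Reduction c′ N δ
  reduction-weaken c≤c′ (reduction N₁ δ₁ 1≤N₁ N₁≤δ δ₁≤N₁ rebuild) =
    reduction N₁ δ₁ 1≤N₁ N₁≤δ δ₁≤N₁ λ {c₁} b → bounded-weaken (+-monoʳ-≤ c₁ c≤c′) (rebuild b)

  -- Dividing 2 N - 2 δ by δ leaves e₀ between 0 and δ, but the bridge wants e between δ / 2 and 3 δ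
  -- / 2; if e₀ is too small, one unit of j₀ moves into it. N ≥ 4 δ gives j₀ ≥ 6, so j remains
  -- positive. The chain must cover j < 2 ^ (ℓ + 2), and 38 + 2 · 11 = 60.
  reduce : ∀ N δ ℓ → .{{_ : NonZero δ}} → δ ≤ N → N < 2 ^ suc ℓ * δ → Reduction (60 + 11 * ℓ) N δ
  reduce N δ ℓ δ≤N N<2^δ with N <? 4 * δ
  ... | yes N<4δ = reduction-weaken (m≤m+n 3 (57 + 11 * ℓ)) (small-reduction N δ δ≤N N<4δ)
  ... | no N≮4δ = reduction-weaken (≤-reflexive (cost ℓ)) (centre (δ ≤? 2 * e₀))
    where
    cost : ∀ ℓ → 38 + 11 * suc (suc ℓ) ≡ 60 + 11 * ℓ
    cost = solve-∀
    w j₀ e₀ : ℕ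
    w = 2 * N ∸ 2 * δ
    j₀ = w DivMod./ δ
    e₀ = w % δ
    e₀<δ : e₀ < δ
    e₀<δ = m%n<n w δ
    2N≡2δ+w : 2 * N ≡ 2 * δ + w
    2N≡2δ+w = sym (m+[n∸m]≡n (*-monoʳ-≤ 2 δ≤N))
    6≤j₀ : 6 ≤ j₀
    6≤j₀ = ≤-trans (≤-reflexive (sym (m*n/n≡m 6 δ))) (/-monoˡ-≤ δ (≤-trans (≤-reflexive (sym (trans (cong (_∸ 2 * δ) (ring δ)) (m+n∸n≡m (6 * δ) (2 * δ))))) (∸-monoˡ-≤ (2 * δ) (*-monoʳ-≤ 2 (≮⇒≥ N≮4δ)))))
      where
      ring : ∀ d → 2 * (4 * d) ≡ 6 * d + 2 * d
      ring = solve-∀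
    expand : 2 * N ≡ (j₀ + 2) * δ + e₀
    expand = trans 2N≡2δ+w (trans (cong (2 * δ +_) (m≡m%n+[m/n]*n w δ)) (ring δ e₀ j₀))
      where
      ring : ∀ d e j → 2 * d + (e + j * d) ≡ (j + 2) * d + e
      ring = solve-∀
    small : ∀ j e → 2 * N ≡ (j + 2) * δ + e → j < 2 ^ suc (suc ℓ)
    small j e eq = *-cancelʳ-< δ j (2 ^ suc (suc ℓ)) (begin-strict
      j * δ                  ≤⟨ *-monoˡ-≤ δ (m≤m+n j 2) ⟩
      (j + 2) * δ            ≤⟨ m≤m+n _ e ⟩
      (j + 2) * δ + e        ≡⟨ eq ⟨
      2 * N                  <⟨ *-monoʳ-< 2 N<2^δ ⟩
      2 * (2 ^ suc ℓ * δ)    ≡⟨ *-assoc 2 (2 ^ suc ℓ) δ ⟨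
      2 ^ suc (suc ℓ) * δ    ∎)
      where open ≤-Reasoning
    centre : Dec (δ ≤ 2 * e₀) → Reduction (38 + 11 * suc (suc ℓ)) N δ
    centre (yes δ≤2e₀) = bridge-reduction N δ j₀ e₀ (suc (suc ℓ)) expand δ≤2e₀
      (≤-trans (*-monoʳ-≤ 2 (<⇒≤ e₀<δ)) (*-monoˡ-≤ δ (m≤m+n 2 1))) (≤-trans (m≤m+n 1 5) 6≤j₀) (small j₀ e₀ expand)
    centre (no δ≰2e₀) = bridge-reduction N δ (j₀ ∸ 1) (e₀ + δ) (suc (suc ℓ)) expand′
      (≤-trans (m≤n+m δ e₀) (m≤m+n (e₀ + δ) _)) upper (≤-trans (m≤m+n 1 4) (∸-monoˡ-≤ 1 6≤j₀)) (small (j₀ ∸ 1) (e₀ + δ) expand′)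
      where
      upper : 2 * (e₀ + δ) ≤ 3 * δ
      upper = ≤-trans (≤-reflexive (*-distribˡ-+ 2 e₀ δ)) (+-monoˡ-≤ (2 * δ) (<⇒≤ (≰⇒> δ≰2e₀)))
      expand′ : 2 * N ≡ (j₀ ∸ 1 + 2) * δ + (e₀ + δ)
      expand′ = trans expand (trans (cong (λ j → (j + 2) * δ + e₀) (sym (m∸n+n≡m (≤-trans (m≤m+n 1 5) 6≤j₀)))) (ring δ e₀ (j₀ ∸ 1)))
        where
        ring : ∀ d e j → (j + 1 + 2) * d + e ≡ (j + 2) * d + (e + d)
        ring = solve-∀

  level : ∀ k N δ → δ ≤ N → N < 2 ^ k * δ → ∃ λ ℓ → 2 ^ ℓ * δ ≤ N × N < 2 ^ suc ℓ * δ
  level zero N δ δ≤N N<δ = contradiction δ≤N (<⇒≱ (subst (N <_) (*-identityˡ δ) N<δ))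
  level (suc k) N δ δ≤N N<2^ with N <? 2 ^ k * δ
  ... | yes N< = level k N δ δ≤N N<
  ... | no N≮ = k , ≮⇒≥ N≮ , N<2^

  n<2^n : ∀ n → n < 2 ^ n
  n<2^n zero = s≤s z≤n
  n<2^n (suc n) = ≤-trans (+-mono-≤ (m^n>0 2 n) (n<2^n n)) (≤-reflexive (cong (2 ^ n +_) (sym (+-identityʳ (2 ^ n)))))

  -- Induction on a bound for the bit length of N. If N / δ is about 2 ^ ℓ, a reduction costs O(ℓ +
  -- 1) edges and removes ℓ bits, which pay for it as soon as ℓ ≥ 1.
  near-one : ∀ b N δ → 1 ≤ N → δ ≤ N → N < 2 ^ b → Bounded (1 + 240 * b) (N + δ) N
  near-one = <-rec _ body
    where
    body : ∀ b → (∀ {b′} → b′ < b → ∀ N δ → 1 ≤ N → δ ≤ N → N < 2 ^ b′ → Bounded (1 + 240 * b′) (N + δ) N) →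
      ∀ N δ → 1 ≤ N → δ ≤ N → N < 2 ^ b → Bounded (1 + 240 * b) (N + δ) N
    body b rec N zero 1≤N δ≤N N<2^b = 1 , m≤m+n 1 _ , ratio-cast (sym (+-identityʳ N)) refl refl (ratio-equal N {{>-nonZero 1≤N}})
    body b rec N δ@(suc _) 1≤N δ≤N N<2^b = split (level N N δ δ≤N (<-≤-trans (n<2^n N) (m≤m*n (2 ^ N) δ)))
      where
      -- `t` counts the bits certainly lost, as N₁ ≤ δ′ < 2 ^ (b - t). Since t ≥ 1 and ℓ ≤ t, the
      -- cost 61 + 11 ℓ is at most 72 t, within the allowance 240 t.
      continue : ∀ t ℓ N′ δ′ → .{{_ : NonZero δ′}} → 1 ≤ t → ℓ ≤ t → δ′ ≤ N′ → N′ < 2 ^ suc ℓ * δ′ → 2 ^ t * δ′ < 2 ^ b →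
        Bounded (240 * b) (N′ + δ′) N′
      continue t ℓ N′ δ′ 1≤t ℓ≤t δ′≤N′ N′< 2^tδ′<2^b with reduce N′ δ′ ℓ δ′≤N′ N′<
      ... | reduction N₁ δ₁ 1≤N₁ N₁≤δ′ δ₁≤N₁ rebuild =
          bounded-weaken bound (rebuild (rec (∸-monoʳ-< 1≤t t≤b) N₁ δ₁ 1≤N₁ δ₁≤N₁ N₁<))
        where
        t<b : t < b
        t<b = ≰⇒> λ b≤t → <⇒≱ 2^tδ′<2^b (≤-trans (^-monoʳ-≤ 2 b≤t) (m≤m*n (2 ^ t) δ′))
        t≤b : t ≤ b
        t≤b = <⇒≤ t<b
        N₁< : N₁ < 2 ^ (b ∸ t)
        N₁< = *-cancelˡ-< (2 ^ t) N₁ (2 ^ (b ∸ t)) (≤-<-trans (*-monoʳ-≤ (2 ^ t) N₁≤δ′)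
          (<-≤-trans 2^tδ′<2^b (≤-reflexive (trans (cong (2 ^_) (sym (m+[n∸m]≡n t≤b))) (^-distribˡ-+-* 2 t (b ∸ t))))))
        bound : 1 + 240 * (b ∸ t) + (60 + 11 * ℓ) ≤ 240 * b
        bound = begin
          1 + 240 * (b ∸ t) + (60 + 11 * ℓ)       ≤⟨ +-monoʳ-≤ (1 + 240 * (b ∸ t)) (+-monoʳ-≤ 60 (*-monoʳ-≤ 11 ℓ≤t)) ⟩
          1 + 240 * (b ∸ t) + (60 + 11 * t)       ≡⟨ ring₁ (b ∸ t) t ⟩
          240 * (b ∸ t) + (61 * 1 + 11 * t)       ≤⟨ +-monoʳ-≤ (240 * (b ∸ t)) (+-monoˡ-≤ (11 * t) (*-monoʳ-≤ 61 1≤t)) ⟩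
          240 * (b ∸ t) + (61 * t + 11 * t)       ≤⟨ +-monoʳ-≤ (240 * (b ∸ t)) (≤-trans (m≤m+n _ (168 * t)) (≤-reflexive (ring₂ t))) ⟩
          240 * (b ∸ t) + 240 * t                 ≡⟨ *-distribˡ-+ 240 (b ∸ t) t ⟨
          240 * (b ∸ t + t)                       ≡⟨ cong (240 *_) (m∸n+n≡m t≤b) ⟩
          240 * b                                 ∎
          where
          open ≤-Reasoning
          ring₁ : ∀ x t → 1 + 240 * x + (60 + 11 * t) ≡ 240 * x + (61 * 1 + 11 * t)
          ring₁ = solve-∀
          ring₂ : ∀ t → 61 * t + 11 * t + 168 * t ≡ 240 * t
          ring₂ = solve-∀
      split : (∃ λ ℓ → 2 ^ ℓ * δ ≤ N × N < 2 ^ suc ℓ * δ) → Bounded (1 + 240 * b) (N + δ) N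
      split (suc ℓ , lower , upper) = bounded-weaken (n≤1+n _) (continue (suc ℓ) (suc ℓ) N δ (s≤s z≤n) ≤-refl δ≤N upper (≤-<-trans lower N<2^b))
      -- For N < 2 δ passing to δ need not lose a bit. One Euclidean step, paid by the extra 1 in 1
      -- + 240 b, leads from 1 + δ / N to 1 + ρ / δ with ρ = N - δ ≤ N / 2.
      split (zero , lower , upper) = bounded-cast (trans (cong (δ +_) (*-identityˡ N)) (+-comm δ N)) refl (bounded-series* 1 (bounded-swap (bounded-cast (m+[n∸m]≡n δ≤N) refl inner)))
        where
        N<δ+δ : N < δ + δ
        N<δ+δ = subst (N <_) (cong (δ +_) (+-identityʳ δ)) upper
        rest : ∀ ρ → ρ ≤ δ → 2 * ρ < 2 ^ b → Bounded (240 * b) (δ + ρ) δ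
        rest zero _ _ = 1 , ≤-trans (m≤m+n 1 239) (*-monoʳ-≤ 240 1≤b) , ratio-cast (sym (+-identityʳ δ)) refl refl (ratio-equal δ)
          where
          1≤b : 1 ≤ b
          1≤b = ≰⇒> λ b≤0 → <⇒≱ N<2^b (≤-trans (^-monoʳ-≤ 2 b≤0) 1≤N)
        rest ρ@(suc _) ρ≤δ 2ρ<2^b with level δ δ ρ ρ≤δ (<-≤-trans (n<2^n δ) (m≤m*n (2 ^ δ) ρ))
        -- Here δ < 2 ρ, and the lost bit comes from 2 ρ ≤ N < 2 ^ b instead.
        ... | zero , _ , upper′ = continue 1 0 δ ρ ≤-refl z≤n ρ≤δ upper′ 2ρ<2^b
        ... | suc ℓ , lower′ , upper′ = continue (suc ℓ) (suc ℓ) δ ρ (s≤s z≤n) ≤-refl ρ≤δ upper′ (≤-<-trans lower′ (≤-<-trans δ≤N N<2^b))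
        inner : Bounded (240 * b) (δ + (N ∸ δ)) δ
        inner = rest (N ∸ δ) (≤-trans (∸-monoˡ-≤ δ (<⇒≤ N<δ+δ)) (≤-reflexive (m+n∸n≡m δ δ))) (≤-<-trans twice N<2^b)
          where
          twice : 2 * (N ∸ δ) ≤ N
          twice = begin
            2 * (N ∸ δ)             ≡⟨ cong (N ∸ δ +_) (+-identityʳ (N ∸ δ)) ⟩
            N ∸ δ + (N ∸ δ)         ≤⟨ +-monoʳ-≤ (N ∸ δ) (≤-trans (∸-monoˡ-≤ δ (<⇒≤ N<δ+δ)) (≤-reflexive (m+n∸n≡m δ δ))) ⟩
            N ∸ δ + δ               ≡⟨ m∸n+n≡m δ≤N ⟩
            N                       ∎
            where open ≤-Reasoning

  binary-size : ∀ p → 1 ≤ p → ∃ λ b → p < 2 ^ b × 2 ^ b ≤ 2 * p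
  binary-size p 1≤p with level p p 1 1≤p (subst (p <_) (sym (*-identityʳ (2 ^ p))) (n<2^n p))
  ... | ℓ , lower , upper = suc ℓ , subst (p <_) (*-identityʳ (2 ^ suc ℓ)) upper , *-monoʳ-≤ 2 (subst (_≤ p) (*-identityʳ (2 ^ ℓ)) lower)

  -- The bound m ≤ q / p + C log2 p, multiplied by p and exponentiated; the first alternative covers
  -- p m ≤ q, where the subtraction is truncated.
  Target : (C p q : ℕ) → .{{_ : NonZero p}} → Set
  Target C p q = Σ ℕ λ n → Σ ℕ λ m → Σ (Graph n m) λ G → Connected G × Planar G ×
    (Σ (Fin n) λ a → Σ (Fin n) λ b → EffRes G a b (pos q / p)) × ((p * m ≤ q) ⊎ (2 ^ (p * m ∸ q) ≤ p ^ (C * p)))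

  target : ∀ C p q m → .{{_ : NonZero p}} → 1 ≤ q → Ratio q p m → ((p * m ≤ q) ⊎ (2 ^ (p * m ∸ q) ≤ p ^ (C * p))) → Target C p q
  target C p@(suc _) (suc q) m _ (ratio (realises N k size≡m sol) _) bound =
    n , Close.m N , graph , connected , graph-planar ,
    effRes N (q + k * suc q) (suc k * p) p (suc q) (solution-cast (sym (ℤₚ.pos-* (suc k) (suc q))) (sym (ℤₚ.pos-* (suc k) p)) sol) (ring (suc q) (suc k) p) ,
    subst (λ m → (p * m ≤ suc q) ⊎ (2 ^ (p * m ∸ suc q) ≤ p ^ (C * p))) (sym (trans m≡size size≡m)) bound
    where
    open Close N hiding (m)
    ring : ∀ q k p → q * (k * p) ≡ p * (k * q)
    ring = solve-∀

  -- The integral part of q / p contributes all but one of its units as series resistors, leaving 1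
  -- + (q mod p) / p. For p = 1 the logarithm vanishes, and q resistors in series meet the bound
  -- exactly.
  upper-bound : (p q : ℕ) → {{_ : NonZero p}} → p < q → Target 482 p q
  upper-bound 1 q 1<q = target 482 1 q q (<⇒≤ 1<q) (ratio-cast shape refl (m∸n+n≡m (<⇒≤ 1<q)) (ratio-series* (q ∸ 1) ratio-unit)) (inj₁ (≤-reflexive (*-identityˡ q)))
    where
    shape : 1 + (q ∸ 1) * 1 ≡ q
    shape = trans (cong (1 +_) (*-identityʳ (q ∸ 1))) (m+[n∸m]≡n (<⇒≤ 1<q))
  upper-bound p@(suc (suc _)) q p<q with binary-size p (s≤s z≤n)
  ... | b , p<2^b , 2^b≤2p with near-one b p (q % p) (s≤s z≤n) (<⇒≤ (m%n<n q p)) p<2^b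
  ... | m₀ , m₀≤ , r = target 482 p q (a ∸ 1 + m₀) (≤-trans (s≤s z≤n) p<q) (ratio-cast shape refl refl (ratio-series* (a ∸ 1) r)) (inj₂ bound)
    where
    a : ℕ
    a = q DivMod./ p
    1≤a : 1 ≤ a
    1≤a = m≥n⇒m/n>0 (<⇒≤ p<q)
    shape : p + q % p + (a ∸ 1) * p ≡ q
    shape = begin
      p + q % p + (a ∸ 1) * p     ≡⟨ ring p (q % p) (a ∸ 1) ⟩
      q % p + (1 + (a ∸ 1)) * p   ≡⟨ cong (λ k → q % p + k * p) (m+[n∸m]≡n 1≤a) ⟩
      q % p + a * p               ≡⟨ m≡m%n+[m/n]*n q p ⟨
      q                           ∎
      where
      open ≡-Reasoning
      ring : ∀ p r k → p + r + k * p ≡ r + (1 + k) * p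
      ring = solve-∀
    1≤b : 1 ≤ b
    1≤b = ≰⇒> λ b≤0 → <⇒≱ p<2^b (≤-trans (^-monoʳ-≤ 2 b≤0) (s≤s z≤n))
    excess : p * (a ∸ 1 + m₀) ∸ q ≤ p * m₀
    excess = begin
      p * (a ∸ 1 + m₀) ∸ q            ≡⟨ cong (_∸ q) (*-distribˡ-+ p (a ∸ 1) m₀) ⟩
      p * (a ∸ 1) + p * m₀ ∸ q        ≤⟨ ∸-monoˡ-≤ q (+-monoˡ-≤ (p * m₀) (≤-trans (≤-reflexive (*-comm p (a ∸ 1))) (≤-trans (m≤n+m _ (p + q % p)) (≤-reflexive shape)))) ⟩
      q + p * m₀ ∸ q                  ≡⟨ m+n∸m≡n q (p * m₀) ⟩
      p * m₀                          ∎
      where open ≤-Reasoning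
    -- 482 = 2 · 241: the size 1 + 240 b is at most 241 b, and 2 ^ b ≤ 2 p ≤ p ^ 2 because p ≥ 2.
    bound : 2 ^ (p * (a ∸ 1 + m₀) ∸ q) ≤ p ^ (482 * p)
    bound = begin
      2 ^ (p * (a ∸ 1 + m₀) ∸ q)      ≤⟨ ^-monoʳ-≤ 2 excess ⟩
      2 ^ (p * m₀)                    ≤⟨ ^-monoʳ-≤ 2 (*-monoʳ-≤ p (≤-trans m₀≤ (+-monoˡ-≤ (240 * b) 1≤b))) ⟩
      2 ^ (p * (241 * b))             ≡⟨ cong (2 ^_) (ring p b) ⟩
      2 ^ (b * (241 * p))             ≡⟨ ^-*-assoc 2 b (241 * p) ⟨
      (2 ^ b) ^ (241 * p)             ≤⟨ ^-monoˡ-≤ (241 * p) (≤-trans 2^b≤2p (*-monoˡ-≤ p {2} {p} (s≤s (s≤s z≤n)))) ⟩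
      (p * p) ^ (241 * p)             ≡⟨ cong (λ s → (p * s) ^ (241 * p)) (*-identityʳ p) ⟨
      (p ^ 2) ^ (241 * p)             ≡⟨ ^-*-assoc p 2 (241 * p) ⟩
      p ^ (2 * (241 * p))             ≡⟨ cong (p ^_) (*-assoc 2 241 p) ⟨
      p ^ (482 * p)                   ∎
      where
      open ≤-Reasoning
      ring : ∀ p b → p * (241 * b) ≡ b * (241 * p)
      ring = solve-∀

open import Defs
open import Data.Nat using (ℕ; _*_; _∸_; _^_; _≤_; _<_; NonZero; s≤s; z≤n)
open import Data.Nat.Coprimality using (Coprime)
open import Data.Integer using (+_)
open import Data.Rational using (_/_)
open import Data.Fin using (Fin)
open import Data.Product using (Σ; _×_; ∃; _,_)
open import Data.Sum using (_⊎_)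
open import Relation.Binary.PropositionalEquality using (_≢_)
open LowerBound using (lower-bound)
open UpperBound using (upper-bound)

theorem3 : (∀ {n m} (G : Graph n m) → Connected G → (a b : Fin n) → a ≢ b →
    (p q : ℕ) → {{_ : NonZero p}} → Coprime p q → p < q →
    EffRes G a b ((+ q) / p) →
    (q ≤ p * m) × (q ≤ 2 ^ m))
    ×
    (Σ ℕ λ C → (1 ≤ C) ×
    ((p q : ℕ) → {{_ : NonZero p}} → Coprime p q → p < q →
    Σ ℕ λ n → Σ ℕ λ m → Σ (Graph n m) λ G →
    Connected G × Planar G ×
    (Σ (Fin n) λ a → Σ (Fin n) λ b → EffRes G a b ((+ q) / p)) ×
    ((p * m ≤ q) ⊎ (2 ^ (p * m ∸ q) ≤ p ^ (C * p)))))
theorem3 = lower-bound , 482 , s≤s z≤n , λ p q _ → upper-bound p q
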